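{- Let $H$ be a graph with at least two vertices, and let $H^{|E(H)|}$ be an $|E(H)|$-colorized graph obtained by coloring the edges of $H$ with distinct colors. Then the multiset $M=\mathrm{DS}(H^{|E(H)|})$ of $|E(H)|$-colored degrees is an extended profile of $\mathcal{S}(H)$. Moreover, for a host graph $G$ with ordered edges $e_1,\dots,e_m$ and maximum frontier size $w=\max_{i\in[m]}|F_i|$, there is an algorithm to construct a $(|E(H)|+1)$-DD $\mathbf{Z}^{|E(H)|+1}(\mathcal{C}_M^*)$ over $E(G)$, i.e. one representing the family of all $|E(H)|$-colored subgraphs of $G$ satisfying $\mathcal{C}_M^*$, with width at most $$2^{O(|E(H)|\,w\log w)+|V(H)|}\,\bigl(2^{|E(H)|}+|E(H)|\bigr)^{w}.$$
   Context: All graphs are finite and simple; $[k]=\{1,\dots,k\}$; $\mathbb{N}$ is the set of non-negative integers; the number $c$ of colors is always a positive integer; $O(\cdot)$ is the usual big-O notation. Subdivisions. Subdividing an edge $\{u,v\}$ means removing it, adding a new vertex $x$ and the edges $\{u,x\},\{v,x\}$. A subdivision of $H$ is any graph obtained from $H$ by subdividing edges an arbitrary number (possibly zero) of times. $\mathcal{S}(H)$ is the family of subdivisions of $H$ (considered up to isomorphism). Colored graphs. A $c$-colored subset over a finite set $E$ is a $c$-tuple $(D_1,\dots,D_c)$ of pairwise disjoint subsets of $E$. A $c$-colored graph is a finite vertex set $U$ together with a $c$-colored subset $(D_1,\dots,D_c)$ over the set of unordered pairs of distinct elements of $U$; edges in $D_i$ have color $i$. Its underlying graph is obtained by forgetting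 colors; it is a $c$-colorized graph of $F$ if its underlying graph is isomorphic to $F$. A $c$-colored degree is a tuple in $\mathbb{N}^c$. The colored degree of a vertex $u$ is the $c$-tuple $(\delta_1,\dots,\delta_c)$ where $\delta_i$ is the number of color-$i$ edges incident to $u$. $\mathrm{DS}(F^c)$ is the multiset of colored degrees of all vertices of $F^c$. The color-$i$ subgraph of $F^c$ consists of the color-$i$ edges and their endpoints. Extended profile. Let $\Delta^c$ be the set of the $c$ tuples in $\mathbb{N}^c$ with one entry equal to $2$ and all other entries $0$. For a multiset $M$ of $c$-colored degrees, a $c$-colored graph $F^c$ satisfies $\mathcal{C}_M^*$ if and only if (a) $\mathrm{DS}(F^c)$ is obtained by adding to $M$ an arbitrary number (possibly zero) of elements of $\Delta^c$, repetitions allowed, and (b) for each $i\in[c]$ the color-$i$ subgraph of $F^c$ is connected. $M$ is an extended profile of $\mathcal{S}(H)$ if for every graph $F$: $F$ belongs to $\mathcal{S}(H)$ if and only if there exists a $c$-colorized graph $F^c$ of $F$ satisfying $\mathcal{C}_M^*$. Colored subgraphs of $G$. A $c$-colored subgraph of $G$ is identified with a $c$-colored subset $(D_1,\dots,D_c)$ over $E(G)$; it stands for the edge-induced $c$-colored graph whose vertices are the endpoints of edges in $D_1\cup\dots\cup D_c$. Frontier. The $i$-th frontier $F_i$ is the set of vertices of $G$ incident both to some edge in $\{e_1,\dots,e_{i-1}\}$ and to some edge in $\{e_i,\dots,e_m\}$. Decision diagrams. A $(c+1)$-DD over $E=\{e_1,\dots,e_m\}$ is a finite directed acyclic graph with a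 unique root node and two terminal nodes $\top,\bot$ (no outgoing arcs). Each non-terminal node $\alpha$ has a label $\ell(\alpha)\in[m]$ and exactly $c+1$ outgoing arcs, called its $0$-arc, $1$-arc, ..., $c$-arc; each arc from $\alpha$ points to a terminal node or to a non-terminal node with label $\ell(\alpha)+1$. A directed path from the root to $\top$ represents the $c$-colored subset $(B_1,\dots,B_c)$ with $B_j=\{e_{\ell(\beta)} : \text{the path uses the } j\text{ -arc of } \beta\}$. The DD represents the family of all $c$-colored subsets represented by its root-to-$\top$ paths. Its width is the maximum number of nodes with the same label. -}

module Defs where

open import Data.Fin using (Fin; zero; suc; toℕ; _<_; _≟_; _≤?_; _<?_; _≤_)
open import Data.Fin.Properties using (any?; suc-injective; <-irrefl)
open import Data.Fin.Subset using (Subset; inside; _∈_; _∩_; ∣_∣; ⊤; Empty; Nonempty)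
open import Data.Fin.Subset.Properties using (nonempty?; _∈?_; ∈⊤; x∈p∩q⁺; x∈p∩q⁻)
open import Data.List using (List; _++_; map; filter; allFin; tabulate; []; _∷_)
open import Data.List.Extrema.Nat using (max)
open import Data.List.Membership.Propositional using () renaming (_∈_ to _∈ˡ_)
open import Data.List.Relation.Binary.Permutation.Propositional using (_↭_)
open import Data.List.Relation.Unary.All using (All)
open import Data.Nat using (ℕ; zero; suc; z<s; s<s)
open import Data.Product using (Σ-syntax; ∃; ∃-syntax; _×_; _,_; proj₁; proj₂)
open import Data.Sum using (_⊎_; inj₁; inj₂)
open import Data.Vec using (Vec; replicate; _[_]≔_)
import Data.Vec as Vec
open import Data.Vec.Properties using (lookup∘tabulate; []=⇒lookup; lookup⇒[]=)
open import Function.Bundles using (_↔_; _⇔_; Inverse)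
open import Function.Definitions using (Injective)
open import Level using (0ℓ)
open import Relation.Binary.Core using (Rel)
open import Relation.Binary.Construct.Closure.ReflexiveTransitive using (Star)
open import Relation.Binary.PropositionalEquality
  using (_≡_; _≢_; refl; sym; trans; cong; cong₂)
open import Relation.Nullary.Decidable
  using (Dec; yes; no; does; dec-true; _×-dec_; _⊎-dec_)
open import Relation.Nullary.Negation using (contradiction)
open import Relation.Unary using (Pred; Decidable)

⟦_⟧ : ∀ {n} {P : Pred (Fin n) 0ℓ} → Decidable P → Subset n
⟦ P? ⟧ = Vec.tabulate (λ x → does (P? x))

module _ {n : ℕ} {P : Pred (Fin n) 0ℓ} (P? : Decidable P) where

  ∈⟦⟧⁺ : ∀ {x} → P x → x ∈ ⟦ P? ⟧
  ∈⟦⟧⁺ {x} px =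
    lookup⇒[]= x _ (trans (lookup∘tabulate _ x) (dec-true (P? x) px))

  ∈⟦⟧⁻ : ∀ {x} → x ∈ ⟦ P? ⟧ → P x
  ∈⟦⟧⁻ {x} x∈
    with P? x | trans (sym (lookup∘tabulate (λ y → does (P? y)) x)) ([]=⇒lookup x∈)
  ... | yes px | _  = px
  ... | no  _  | ()

-- The unordered pair {u , v} is stored as (u , v) with u < v, so that
-- injectivity of `ends` says that there are no parallel edges.  The
-- enumeration of the edges by Fin ∣E∣ is the order e₁ , … , eₘ whenever an
-- order is needed, and is ignored otherwise.
record Graph : Set where
  field
    ∣V∣      : ℕ
    ∣E∣      : ℕ
    ends     : Fin ∣E∣ → Fin ∣V∣ × Fin ∣V∣
    sorted   : ∀ e → proj₁ (ends e) < proj₂ (ends e)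
    distinct : Injective _≡_ _≡_ ends

open Graph public

V : Graph → Set
V G = Fin (∣V∣ G)

E : Graph → Set
E G = Fin (∣E∣ G)

module _ (G : Graph) where

  Joins : E G → Rel (V G) 0ℓ
  Joins e u v = ends G e ≡ (u , v) ⊎ ends G e ≡ (v , u)

  Adjacent : Rel (V G) 0ℓ
  Adjacent u v = ∃[ e ] Joins e u v

  Incident : V G → Pred (E G) 0ℓ
  Incident v e = proj₁ (ends G e) ≡ v ⊎ proj₂ (ends G e) ≡ v

  incident? : ∀ v → Decidable (Incident v)
  incident? v e = (proj₁ (ends G e) ≟ v) ⊎-dec (proj₂ (ends G e) ≟ v)

  incidentEdges : V G → Subset (∣E∣ G)
  incidentEdges v = ⟦ incident? v ⟧

Isomorphic : {A B : Set} → Rel A 0ℓ → Rel B 0ℓ → Set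
Isomorphic {A} {B} R S =
  Σ[ φ ∈ A ↔ B ] (∀ x y → R x y ⇔ S (Inverse.to φ x) (Inverse.to φ y))

_≅_ : Graph → Graph → Set
G ≅ H = Isomorphic (Adjacent G) (Adjacent H)

-- The new vertex x is zero.  The edge e = {u , v} becomes {x , u}, and
-- {x , v} is added at the front of the enumeration.
module _ (G : Graph) (e : E G) where

  lift : V G × V G → Fin (suc (∣V∣ G)) × Fin (suc (∣V∣ G))
  lift (u , v) = suc u , suc v

  lift-injective : Injective _≡_ _≡_ lift
  lift-injective eq =
    cong₂ _,_ (suc-injective (cong proj₁ eq)) (suc-injective (cong proj₂ eq))

  u≢v : proj₁ (ends G e) ≢ proj₂ (ends G e)
  u≢v eq = <-irrefl eq (sorted G e)

  newEnds : Fin (suc (∣E∣ G)) → Fin (suc (∣V∣ G)) × Fin (suc (∣V∣ G))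
  newEnds zero = zero , suc (proj₂ (ends G e))
  newEnds (suc f) with f ≟ e
  ... | yes _ = zero , suc (proj₁ (ends G e))
  ... | no  _ = lift (ends G f)

  newSorted : ∀ f → proj₁ (newEnds f) < proj₂ (newEnds f)
  newSorted zero = z<s
  newSorted (suc f) with f ≟ e
  ... | yes _ = z<s
  ... | no  _ = s<s (sorted G f)

  newDistinct : Injective _≡_ _≡_ newEnds
  newDistinct {zero}  {zero}  _ = refl
  newDistinct {zero}  {suc g} eq with g ≟ e
  ... | yes _ = contradiction (sym (suc-injective (cong proj₂ eq))) u≢v
  ... | no  _ with () ← cong proj₁ eq
  newDistinct {suc f} {zero}  eq with f ≟ e
  ... | yes _ = contradiction (suc-injective (cong proj₂ eq)) u≢v
  ... | no  _ with () ← cong proj₁ eq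
  newDistinct {suc f} {suc g} eq with f ≟ e | g ≟ e
  ... | yes f≡e | yes g≡e = cong suc (trans f≡e (sym g≡e))
  ... | yes _   | no  _   with () ← cong proj₁ eq
  newDistinct {suc f} {suc g} eq | no _ | yes _ with () ← cong proj₁ eq
  newDistinct {suc f} {suc g} eq | no _ | no  _ =
    cong suc (distinct G (lift-injective eq))

  subdivide : Graph
  subdivide = record
    { ∣V∣      = suc (∣V∣ G)
    ; ∣E∣      = suc (∣E∣ G)
    ; ends     = newEnds
    ; sorted   = newSorted
    ; distinct = newDistinct
    }

data Subdivision (H : Graph) : Graph → Set where
  none : Subdivision H H
  step : ∀ {F} → Subdivision H F → (e : E F) → Subdivision H (subdivide F e)

𝒮 : Graph → Pred Graph 0ℓ
𝒮 H F = ∃[ F′ ] (Subdivision H F′ × F ≅ F′)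

record ColoredSubset (c m : ℕ) : Set where
  field
    D        : Fin c → Subset m
    disjoint : ∀ {i j} → i ≢ j → Empty (D i ∩ D j)

open ColoredSubset public

-- The vertex set and the pairs that may be colored are taken inside an
-- ambient graph.  This loses no generality, as the ambient graph may be
-- complete, and it covers edge-induced subgraphs without renumbering.
-- Edges of the ambient graph without a color are not edges of the colored
-- graph, and its vertices outside U are not vertices of the colored graph.
record ColoredGraph (c : ℕ) : Set where
  field
    ambient  : Graph
    U        : Subset (∣V∣ ambient)
    coloring : ColoredSubset c (∣E∣ ambient)
    closed   : ∀ {i e v} → e ∈ D coloring i → Incident ambient v e → v ∈ U

open ColoredGraph public

module _ {c : ℕ} (K : ColoredGraph c) where

  private G = ambient K

  ColorAdjacent : Fin c → Rel (V G) 0ℓ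
  ColorAdjacent i u v = ∃[ e ] (e ∈ D (coloring K) i × Joins G e u v)

  VertexOf : Set
  VertexOf = ∃[ v ] v ∈ U K

  UnderlyingAdjacent : Rel VertexOf 0ℓ
  UnderlyingAdjacent (u , _) (v , _) = ∃[ i ] ColorAdjacent i u v

  IsColorizationOf : Graph → Set
  IsColorizationOf F = Isomorphic UnderlyingAdjacent (Adjacent F)

  coloredDegree : V G → Vec ℕ c
  coloredDegree v = Vec.tabulate (λ i → ∣ D (coloring K) i ∩ incidentEdges G v ∣)

  -- A multiset is a list considered up to _↭_.
  DS : List (Vec ℕ c)
  DS = map coloredDegree (filter (_∈? U K) (allFin _))

  -- Any two vertices of the color-i subgraph are joined by a walk of
  -- color-i edges; this holds vacuously for an unused color.
  ColorConnected : Fin c → Set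
  ColorConnected i = ∀ u v →
    Nonempty (D (coloring K) i ∩ incidentEdges G u) →
    Nonempty (D (coloring K) i ∩ incidentEdges G v) →
    Star (ColorAdjacent i) u v

module _ (G : Graph) {c : ℕ} where

  colorize : (E G → Fin c) → ColoredGraph c
  colorize col = record
    { ambient  = G
    ; U        = ⊤
    ; coloring = record
      { D        = λ i → ⟦ (λ e → col e ≟ i) ⟧
      ; disjoint = λ {i} {j} i≢j (e , e∈) →
          let e∈i , e∈j = x∈p∩q⁻ _ _ e∈ in
          i≢j (trans (sym (∈⟦⟧⁻ (λ f → col f ≟ i) e∈i)) (∈⟦⟧⁻ (λ f → col f ≟ j) e∈j))
      }
    ; closed   = λ _ _ → ∈⊤
    }

  edgeInduced : ColoredSubset c (∣E∣ G) → ColoredGraph c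
  edgeInduced X = record
    { ambient  = G
    ; U        = ⟦ endpoint? ⟧
    ; coloring = X
    ; closed   = λ {i} {e} {v} e∈ inc →
        ∈⟦⟧⁺ endpoint? (i , e , x∈p∩q⁺ (e∈ , ∈⟦⟧⁺ (incident? G v) inc))
    }
    where
    endpoint? : Decidable (λ v → ∃[ i ] Nonempty (D X i ∩ incidentEdges G v))
    endpoint? v = any? (λ i → nonempty? (D X i ∩ incidentEdges G v))

_∈Δ : ∀ {c} → Vec ℕ c → Set
_∈Δ {c} d = ∃[ i ] d ≡ replicate c 0 [ i ]≔ 2

record _⊨𝒞*_ {c : ℕ} (K : ColoredGraph c) (M : List (Vec ℕ c)) : Set where
  field
    degrees   : ∃[ ds ] (All _∈Δ ds × DS K ↭ M ++ ds)
    connected : ∀ i → ColorConnected K i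

IsExtendedProfile : ∀ {c} → List (Vec ℕ c) → Pred Graph 0ℓ → Set
IsExtendedProfile {c} M 𝒢 =
  ∀ F → 𝒢 F ⇔ (Σ[ K ∈ ColoredGraph c ] (IsColorizationOf K F × K ⊨𝒞* M))

module _ (G : Graph) where

  IsFrontier : E G → Pred (V G) 0ℓ
  IsFrontier i v =
    (∃[ j ] (j < i × Incident G v j)) × (∃[ k ] (i ≤ k × Incident G v k))

  isFrontier? : ∀ i → Decidable (IsFrontier i)
  isFrontier? i v =
    any? (λ j → (j <? i) ×-dec incident? G v j) ×-dec
    any? (λ k → (i ≤? k) ×-dec incident? G v k)

  frontier : E G → Subset (∣V∣ G)
  frontier i = ⟦ isFrontier? i ⟧

  -- 0 if G has no edges.
  maxFrontierSize : ℕ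
  maxFrontierSize = max 0 (tabulate (λ i → ∣ frontier i ∣))

data Node (s : ℕ) : Set where
  ⊤ₙ ⊥ₙ : Node s
  inner : Fin s → Node s

-- The (c+1)-DDs over {e₁ , … , eₘ}.  Acyclicity follows from `layered`.
-- `source` and `unique` express that the root is unique: it has no incoming
-- arcs, while every other non-terminal node has one.  The root is a terminal
-- only if there are no non-terminal nodes, which cannot be avoided for m = 0.
record DD (c m : ℕ) : Set where
  field
    size    : ℕ
    label   : Fin size → Fin m
    arc     : Fin size → Fin (suc c) → Node size
    root    : Node size
    layered : ∀ α j {β} → arc α j ≡ inner β → toℕ (label β) ≡ suc (toℕ (label α))
    source  : ∀ α j → arc α j ≢ root
    unique  : ∀ β → inner β ≢ root → ∃[ α ] ∃[ j ] arc α j ≡ inner β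

module _ {c m : ℕ} (Z : DD c m) where

  open DD Z

  data Path⊤ : Node size → Set where
    end : Path⊤ ⊤ₙ
    via : ∀ α j → Path⊤ (arc α j) → Path⊤ (inner α)

  usedArcs : ∀ {ν} → Path⊤ ν → List (Fin size × Fin (suc c))
  usedArcs end         = []
  usedArcs (via α j p) = (α , j) ∷ usedArcs p

  PathRepresents : Path⊤ root → ColoredSubset c m → Set
  PathRepresents p X = ∀ j e →
    e ∈ D X j ⇔ (∃[ β ] (label β ≡ e × (β , suc j) ∈ˡ usedArcs p))

  Represents : Pred (ColoredSubset c m) 0ℓ → Set
  Represents 𝓕 = ∀ X → 𝓕 X ⇔ (∃[ p ] PathRepresents p X)

  width : ℕ
  width = max 0 (tabulate (λ l → ∣ ⟦ (λ α → label α ≟ l) ⟧ ∣))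

{-# OPTIONS --safe #-}

-- For the extended profile, a vertex of degree 2 outside the profile is
-- suppressed by joining its two neighbours.  This keeps the graph simple:
-- two edges of different colors with the same ends would be two parallel
-- edges of H, and a monochromatic cycle has no vertex with degree in M.
--
-- For the diagram, the completions of a colored prefix are determined by the
-- colored degrees of the frontier vertices, the connections among frontier
-- vertices in each color, and the part of M used up by finished vertices.  The
-- connections of one color are encoded by sending each frontier vertex to the
-- least one it is connected to: at most w ^ w ≤ 2 ^ (2 * (w * ⌊log₂ w ⌋))
-- possibilities, which is 1 for w ≤ 1.

module Submission where

open import Defs
open import Data.Empty using (⊥; ⊥-elim)
open import Data.Fin using (Fin; zero; suc; toℕ; _≟_; punchOut; fromℕ<; combine; remQuot; finToFun; funToFin; _↑ˡ_; _↑ʳ_; splitAt; inject≤)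
import Data.Fin.Properties as Fin
open import Data.Fin.Properties using (any?; injective⇒≤; toℕ-injective; punchOut-injective; toℕ<n; toℕ-fromℕ<; remQuot-combine; combine-remQuot; finToFun-funToFin; all?)
open import Data.Fin.Subset using (Subset; inside; outside; _∈_; _∩_; ∣_∣; Nonempty; ⊤)
open import Data.Fin.Subset.Properties using (x∈p∩q⁺; x∈p∩q⁻; ⊆-antisym; p⊆q⇒∣p∣≤∣q∣; _∈?_; ∈⊤; nonempty?)
open import Data.List using (List; []; _∷_; _++_; map; filter; tabulate; length; allFin; lookup)
open import Data.List.Extrema.Nat using (max≤v⁺; xs≤max)
open import Data.List.Membership.Propositional using () renaming (_∈_ to _∈ˡ_)
open import Data.List.Membership.Propositional.Properties using (∈-∃++; ∈-filter⁻; ∈-++⁻; ∈-filter⁺; ∈-allFin; ∈-tabulate⁻; ∈-tabulate⁺; ∈-++⁺ˡ; ∈-++⁺ʳ)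
open import Data.List.Properties using (filter-++; length-++; filter-accept; filter-all; filter-none; map-tabulate; ∷-injective; tabulate-lookup; ++-identityʳ; tabulate-cong; map-cong; filter-≐)
open import Data.List.Relation.Binary.Permutation.Propositional using (_↭_; ↭-refl; ↭-sym; ↭-trans; prep; ↭⇒↭ₛ; ↭-reflexive)
open import Data.List.Relation.Binary.Permutation.Propositional.Properties using (filter-↭; ↭-length; shift; ++⁺ʳ; ++-comm; ↭-map-inv; ∈-resp-↭)
import Data.List.Relation.Binary.Permutation.Setoid.Properties as Permₛ
import Data.List.Relation.Unary.All as All
open import Data.List.Relation.Unary.All using (All; []; _∷_)
import Data.List.Relation.Unary.All.Properties as All
open import Data.List.Relation.Unary.All.Properties using (all-filter)
open import Data.List.Relation.Unary.AllPairs using (_∷_)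
open import Data.List.Relation.Unary.Any using (here; there)
open import Data.List.Relation.Unary.Unique.Propositional using (Unique)
import Data.List.Relation.Unary.Unique.Propositional.Properties as Unique
open import Data.Maybe using (Maybe; just; nothing)
import Data.Maybe.Properties as Maybe
open import Data.Nat using (ℕ; zero; suc; _+_; _*_; _^_; _≤_; _<_; z≤n; s≤s; _<?_; _≤?_; ⌊_/2⌋; ⌈_/2⌉; >-nonZero)
open import Data.Nat.Induction using (<-rec)
open import Data.Nat.Logarithm using (⌊log₂_⌋; ⌊log₂⌋-mono-≤; ⌊log₂⌊n/2⌋⌋≡⌊log₂n⌋∸1; ⌊log₂[2^n]⌋≡n)
import Data.Nat.Properties as ℕ
open import Data.Nat.Properties using (+-suc; ≤-trans; 1+n≰n)
open import Data.Nat.Tactic.RingSolver using (solve-∀)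
open import Data.Product using (Σ-syntax; ∃; ∃-syntax; _×_; _,_; proj₁; proj₂)
open import Data.Sum using (_⊎_; inj₁; inj₂; swap; [_,_]′)
open import Data.Sum.Properties using (inj₁-injective; inj₂-injective)
import Data.Vec as Vec
open import Data.Vec using ([]; _∷_; here; there; Vec; replicate; _[_]≔_)
import Data.Vec.Properties as Vec
open import Data.Vec.Properties using (lookup∘tabulate; lookup∘update; lookup∘update′; lookup-replicate; tabulate∘lookup)
open import Function using (_∘_)
open import Function.Bundles using (_⇔_; mk⇔; _↔_; mk↔ₛ′; Inverse; Equivalence)
open import Function.Construct.Composition using (_↔-∘_; _⇔-∘_)
open import Function.Construct.Symmetry using (↔-sym)
open import Function.Definitions using (Injective)
open import Level using (0ℓ)
import Relation.Binary.Construct.Closure.ReflexiveTransitive as Star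
open import Relation.Binary.Construct.Closure.ReflexiveTransitive using (Star; ε; _◅_; _◅◅_; kleisliStar; reverse)
open import Relation.Binary.Core using (Rel)
open import Relation.Binary.Definitions using (DecidableEquality; tri<; tri≈; tri>)
open import Relation.Binary.PropositionalEquality using (_≡_; _≢_; refl; sym; trans; cong; cong₂; subst; subst₂; setoid)
open import Relation.Nullary using (Dec; yes; no; ¬_; contradiction; ¬?; _×-dec_; _⊎-dec_; _→-dec_)
import Relation.Nullary.Decidable as Dec
open import Relation.Unary using (Pred; Decidable)

-- The colors on `H` are distinct, so all entries of degrees in `M` are at most 1, and `M` is
-- disjoint from Δ. Condition (a) then says exactly that every degree outside Δ occurs as often as
-- in `M`; the number of vertices with degree in Δ is free and is not tracked. Two factors of the
-- width come from here. In a prefix that extends to a member of the family, a vertex has at most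
-- one edge of each color (2^c vectors), or two edges of one color and none of the others (c
-- vectors). The part of `M` used up so far is a set of vertices of `H`. Both facts hold only for
-- prefixes with a completion, so signatures are compared only between members of the family, and an
-- arc without completion leads to ⊥. The obstacle in exchanging prefixes is a color that is closed
-- off in one prefix and still absent from the other. No field of the signature records this, but
-- every color occurs at some vertex of `H`, so the counts of finished vertices reveal it.

private
  variable
    n N : ℕ

-- Counting in finite subsets

subset-ext : {p q : Subset n} → (∀ x → x ∈ p → x ∈ q) → (∀ x → x ∈ q → x ∈ p) → p ≡ q
subset-ext p⊆q q⊆p = ⊆-antisym (p⊆q _) (q⊆p _)

enum : (p : Subset n) → Fin ∣ p ∣ → Fin n
enum (inside  ∷ p) zero    = zero
enum (inside  ∷ p) (suc i) = suc (enum p i)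
enum (outside ∷ p) i       = suc (enum p i)

enum-∈ : (p : Subset n) → ∀ i → enum p i ∈ p
enum-∈ (inside  ∷ p) zero    = here
enum-∈ (inside  ∷ p) (suc i) = there (enum-∈ p i)
enum-∈ (outside ∷ p) i       = there (enum-∈ p i)

enum-injective : (p : Subset n) → Injective _≡_ _≡_ (enum p)
enum-injective (inside  ∷ p) {zero}  {zero}  eq = refl
enum-injective (inside  ∷ p) {suc i} {suc j} eq = cong suc (enum-injective p (Fin.suc-injective eq))
enum-injective (outside ∷ p) eq = enum-injective p (Fin.suc-injective eq)

enum-surjective : (p : Subset n) → ∀ {x} → x ∈ p → ∃[ i ] enum p i ≡ x
enum-surjective (inside  ∷ p) here       = zero , refl
enum-surjective (inside  ∷ p) (there x∈) =
  let i , eq = enum-surjective p x∈ in suc i , cong suc eq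
enum-surjective (outside ∷ p) (there x∈) =
  let i , eq = enum-surjective p x∈ in i , cong suc eq

∣∣-injection : (p : Subset n) (f : Fin n → Fin N) →
  (∀ {x y} → x ∈ p → y ∈ p → f x ≡ f y → x ≡ y) → ∣ p ∣ ≤ N
∣∣-injection p f inj = injective⇒≤ {f = f ∘ enum p} λ {i} {j} eq →
  enum-injective p (inj (enum-∈ p i) (enum-∈ p j) eq)

∣∣≥1 : (p : Subset n) → ∀ {x} → x ∈ p → 1 ≤ ∣ p ∣
∣∣≥1 p x∈ = ≤-trans (s≤s z≤n) (toℕ<n (proj₁ (enum-surjective p x∈)))

∣∣≥1⁻ : (p : Subset n) → 1 ≤ ∣ p ∣ → Nonempty p
∣∣≥1⁻ p 1≤ with ∣ p ∣ | enum p | enum-∈ p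
... | suc _ | e | e∈ = e zero , e∈ zero

∣∣≤1 : (p : Subset n) → ∣ p ∣ ≤ 1 → ∀ {x y} → x ∈ p → y ∈ p → x ≡ y
∣∣≤1 p ≤1 x∈ y∈ =
  let i , i≡ = enum-surjective p x∈
      j , j≡ = enum-surjective p y∈
  in trans (sym i≡) (trans (cong (enum p) (Fin≤1 ≤1 i j)) j≡)
  where
  Fin≤1 : ∀ {k} → k ≤ 1 → (i j : Fin k) → i ≡ j
  Fin≤1 (s≤s z≤n) zero zero = refl

∣∣≡2 : (p : Subset n) → ∣ p ∣ ≡ 2 →
  ∃[ x ] ∃[ y ] (x ≢ y × x ∈ p × y ∈ p × (∀ z → z ∈ p → z ≡ x ⊎ z ≡ y))
∣∣≡2 p eq
  with ∣ p ∣ | enum p | enum-∈ p | (λ i j → enum-injective p {i} {j}) | (λ x → enum-surjective p {x})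
∣∣≡2 p refl | _ | e | e∈ | inj | surj =
  e zero , e (suc zero) , (λ eq → case-≢ (inj _ _ eq)) , e∈ _ , e∈ _ , cover
  where
  case-≢ : _≢_ {A = Fin 2} zero (suc zero)
  case-≢ ()
  cover : ∀ z → z ∈ p → z ≡ e zero ⊎ z ≡ e (suc zero)
  cover z z∈ with surj z z∈
  ... | zero     , eq = inj₁ (sym eq)
  ... | suc zero , eq = inj₂ (sym eq)

rank : Subset n → Fin n → ℕ
rank (b       ∷ p) zero    = 0
rank (inside  ∷ p) (suc x) = suc (rank p x)
rank (outside ∷ p) (suc x) = rank p x

rank-surjective : (p : Subset n) → ∀ {k} → k < ∣ p ∣ → ∃[ x ] (x ∈ p × rank p x ≡ k)
rank-surjective (inside ∷ p) {zero} _ = zero , here , refl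
rank-surjective (inside ∷ p) {suc k} (s≤s k<) =
  let x , x∈ , eq = rank-surjective p k< in suc x , there x∈ , cong suc eq
rank-surjective (outside ∷ p) k< =
  let x , x∈ , eq = rank-surjective p k< in suc x , there x∈ , eq

# : {P : Pred (Fin n) 0ℓ} → Decidable P → ℕ
# P? = ∣ ⟦ P? ⟧ ∣

module _ {n : ℕ} {P Q : Pred (Fin n) 0ℓ} (P? : Decidable P) (Q? : Decidable Q) where

  ⟦⟧-cong : (∀ x → P x → Q x) → (∀ x → Q x → P x) → ⟦ P? ⟧ ≡ ⟦ Q? ⟧
  ⟦⟧-cong P⇒Q Q⇒P = subset-ext
    (λ x x∈ → ∈⟦⟧⁺ Q? (P⇒Q x (∈⟦⟧⁻ P? x∈)))
    (λ x x∈ → ∈⟦⟧⁺ P? (Q⇒P x (∈⟦⟧⁻ Q? x∈)))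

  #-cong : (∀ x → P x → Q x) → (∀ x → Q x → P x) → # P? ≡ # Q?
  #-cong P⇒Q Q⇒P = cong ∣_∣ (⟦⟧-cong P⇒Q Q⇒P)

  #-mono : (∀ x → P x → Q x) → # P? ≤ # Q?
  #-mono P⇒Q = p⊆q⇒∣p∣≤∣q∣ λ x∈ → ∈⟦⟧⁺ Q? (P⇒Q _ (∈⟦⟧⁻ P? x∈))

module _ {n : ℕ} {P : Pred (Fin n) 0ℓ} (P? : Decidable P) where

  #≥1 : ∀ {x} → P x → 1 ≤ # P?
  #≥1 px = ∣∣≥1 ⟦ P? ⟧ (∈⟦⟧⁺ P? px)

  #≥1⁻ : 1 ≤ # P? → ∃ P
  #≥1⁻ 1≤ = let x , x∈ = ∣∣≥1⁻ ⟦ P? ⟧ 1≤ in x , ∈⟦⟧⁻ P? x∈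

  #≡0 : (∀ x → ¬ P x) → # P? ≡ 0
  #≡0 ¬P with # P? | #≥1⁻
  ... | zero  | _ = refl
  ... | suc _ | w = contradiction (proj₂ (w (s≤s z≤n))) (¬P _)

  #≤1 : (∀ x y → P x → P y → x ≡ y) → # P? ≤ 1
  #≤1 unique = ∣∣-injection {N = 1} ⟦ P? ⟧ (λ _ → zero)
    (λ x∈ y∈ _ → unique _ _ (∈⟦⟧⁻ P? x∈) (∈⟦⟧⁻ P? y∈))

#-suc-yes : {P : Pred (Fin (suc n)) 0ℓ} (P? : Decidable P) → P zero → # P? ≡ suc (# (P? ∘ suc))
#-suc-yes P? p0 with P? zero
... | yes _  = refl
... | no ¬p0 = contradiction p0 ¬p0

#-suc-no : {P : Pred (Fin (suc n)) 0ℓ} (P? : Decidable P) → ¬ P zero → # P? ≡ # (P? ∘ suc)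
#-suc-no P? ¬p0 with P? zero
... | yes p0 = contradiction p0 ¬p0
... | no _   = refl

#-split : ∀ {n} {P R : Pred (Fin n) 0ℓ} (P? : Decidable P) (R? : Decidable R) →
  # P? ≡ # (λ x → P? x ×-dec R? x) + # (λ x → P? x ×-dec ¬? (R? x))
#-split {zero}  P? R? = refl
#-split {suc n} P? R? with P? zero | R? zero
... | no  _ | _     = #-split (P? ∘ suc) (R? ∘ suc)
... | yes _ | yes _ = cong suc (#-split (P? ∘ suc) (R? ∘ suc))
... | yes _ | no  _ =
  trans (cong suc (#-split (P? ∘ suc) (R? ∘ suc))) (sym (+-suc _ _))

injective⇒surjective : {f : Fin n → Fin n} → Injective _≡_ _≡_ f → ∀ y → ∃[ x ] f x ≡ y
injective⇒surjective {suc n} {f} inj y with any? (λ x → f x ≟ y)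
... | yes hit = hit
... | no miss = contradiction
  (injective⇒≤ {f = λ x → punchOut (y≢f x)}
    (λ {i} {j} eq → inj (punchOut-injective (y≢f i) (y≢f j) eq)))
  1+n≰n
  where
  y≢f : ∀ x → y ≢ f x
  y≢f x eq = miss (x , sym eq)

-- Multisets as multiplicities

↭-partition : {A : Set} {Q : Pred A 0ℓ} (Q? : Decidable Q) (xs : List A) →
  xs ↭ filter (¬? ∘ Q?) xs ++ filter Q? xs
↭-partition Q? [] = ↭-refl
↭-partition Q? (x ∷ xs) with Q? x
... | no  _ = prep x (↭-partition Q? xs)
... | yes _ = ↭-trans (prep x (↭-partition Q? xs)) (↭-sym (shift x (filter (¬? ∘ Q?) xs) _))

module Multiset {A : Set} (_≟_ : DecidableEquality A) where

  occ : A → List A → ℕ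
  occ d xs = length (filter (_≟ d) xs)

  occ-↭ : ∀ d {xs ys} → xs ↭ ys → occ d xs ≡ occ d ys
  occ-↭ d xs↭ys = ↭-length (filter-↭ (_≟ d) xs↭ys)

  occ-++ : ∀ d xs ys → occ d (xs ++ ys) ≡ occ d xs + occ d ys
  occ-++ d xs ys = trans (cong length (filter-++ (_≟ d) xs ys)) (length-++ (filter (_≟ d) xs))

  occ-self : ∀ d xs → occ d (d ∷ xs) ≡ suc (occ d xs)
  occ-self d xs = cong length (filter-accept (_≟ d) {xs = xs} refl)

  occ-∷-cancel : ∀ d x {xs ys} → occ d (x ∷ xs) ≡ occ d (x ∷ ys) → occ d xs ≡ occ d ys
  occ-∷-cancel d x eq with x ≟ d
  ... | yes _ = ℕ.suc-injective eq
  ... | no  _ = eq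

  occ≢0⇒∈ : ∀ d xs {k} → occ d xs ≡ suc k → d ∈ˡ xs
  occ≢0⇒∈ d (x ∷ xs) eq with x ≟ d
  ... | yes x≡d = here (sym x≡d)
  ... | no  _   = there (occ≢0⇒∈ d xs eq)

  occ-none : ∀ {Q : Pred A 0ℓ} {d xs} → All Q xs → ¬ Q d → occ d xs ≡ 0
  occ-none {Q} all ¬qd =
    cong length (filter-none (_≟ _) (All.map (λ qx x≡d → ¬qd (subst Q x≡d qx)) all))

  occ≡⇒↭ : ∀ xs ys → (∀ d → occ d xs ≡ occ d ys) → xs ↭ ys
  occ≡⇒↭ [] [] _ = ↭-refl
  occ≡⇒↭ [] (y ∷ ys) eq with () ← trans (eq y) (occ-self y ys)
  occ≡⇒↭ (x ∷ xs) ys eq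
    with ys₁ , ys₂ , refl ← ∈-∃++ (occ≢0⇒∈ x ys (trans (sym (eq x)) (occ-self x xs))) =
    ↭-trans (prep x (occ≡⇒↭ xs (ys₁ ++ ys₂) λ d →
      occ-∷-cancel d x (trans (eq d) (occ-↭ d (shift x ys₁ ys₂)))))
    (↭-sym (shift x ys₁ ys₂))

  module _ {Δ : Pred A 0ℓ} (Δ? : Decidable Δ) {M : List A} (M∌Δ : All (¬_ ∘ Δ) M) (L : List A) where

    private
      L′ = filter (¬? ∘ Δ?) L
      LΔ = filter Δ? L

      occ-L′ : ∀ d → ¬ Δ d → occ d L ≡ occ d L′
      occ-L′ d ¬Δd = trans (occ-↭ d (↭-partition Δ? L)) (trans (occ-++ d L′ LΔ)
        (trans (cong (occ d L′ +_) (occ-none (all-filter Δ? L) ¬Δd)) (ℕ.+-identityʳ _)))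

    -- No element of `M` lies in `Δ`, so the added part can only be the `Δ`-part of `L`, up to
    -- order, and what remains has to be a permutation of `M`.
    extension⇔occ : (∃[ ds ] (All Δ ds × L ↭ M ++ ds)) ⇔ (∀ d → ¬ Δ d → occ d L ≡ occ d M)
    extension⇔occ = mk⇔ to from
      where
      to : ∃[ ds ] (All Δ ds × L ↭ M ++ ds) → ∀ d → ¬ Δ d → occ d L ≡ occ d M
      to (ds , allΔ , L↭) d ¬Δd = trans (occ-↭ d L↭) (trans (occ-++ d M ds)
        (trans (cong (occ d M +_) (occ-none allΔ ¬Δd)) (ℕ.+-identityʳ _)))

      from : (∀ d → ¬ Δ d → occ d L ≡ occ d M) → ∃[ ds ] (All Δ ds × L ↭ M ++ ds)
      from eq = LΔ , all-filter Δ? L ,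
        ↭-trans (↭-partition Δ? L) (++⁺ʳ LΔ (occ≡⇒↭ L′ M same))
        where
        same : ∀ d → occ d L′ ≡ occ d M
        same d with Δ? d
        ... | no  ¬Δd = trans (sym (occ-L′ d ¬Δd)) (eq d ¬Δd)
        ... | yes Δd  = trans
          (occ-none (all-filter (¬? ∘ Δ?) L) (λ ¬Δd → ¬Δd Δd))
          (sym (occ-none M∌Δ (λ ¬Δd → ¬Δd Δd)))

  -- Turns multiplicities in a degree list into numbers of vertices, which can then be split by
  -- position relative to the frontier.
  occ-map-filter : ∀ {n k} {U : Pred (Fin k) 0ℓ} (U? : Decidable U) (f : Fin k → A) d (g : Fin n → Fin k) →
    occ d (map f (filter U? (tabulate g))) ≡ # (λ v → U? (g v) ×-dec (f (g v) ≟ d))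
  occ-map-filter {zero}  U? f d g = refl
  occ-map-filter {suc n} U? f d g with U? (g zero)
  ... | no _  = occ-map-filter U? f d (g ∘ suc)
  ... | yes _ with f (g zero) ≟ d
  ...   | yes _ = cong suc (occ-map-filter U? f d (g ∘ suc))
  ...   | no  _ = occ-map-filter U? f d (g ∘ suc)

-- Incidence in simple graphs and in a subdivided graph

module _ {G : Graph} where

  Joins-sym : ∀ {e u v} → Joins G e u v → Joins G e v u
  Joins-sym = swap

  Joins⇒≢ : ∀ {e u v} → Joins G e u v → u ≢ v
  Joins⇒≢ {e} (inj₁ eq) refl = u≢v G e (trans (cong proj₁ eq) (sym (cong proj₂ eq)))
  Joins⇒≢ {e} (inj₂ eq) refl = u≢v G e (trans (cong proj₁ eq) (sym (cong proj₂ eq)))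

  Joins⇒Incidentˡ : ∀ {e u v} → Joins G e u v → Incident G u e
  Joins⇒Incidentˡ (inj₁ eq) = inj₁ (cong proj₁ eq)
  Joins⇒Incidentˡ (inj₂ eq) = inj₂ (cong proj₂ eq)

  Joins⇒Incidentʳ : ∀ {e u v} → Joins G e u v → Incident G v e
  Joins⇒Incidentʳ {e} = Joins⇒Incidentˡ {e} ∘ Joins-sym {e}

  Incident⇒Joins : ∀ {e u} → Incident G u e → ∃[ v ] Joins G e u v
  Incident⇒Joins (inj₁ refl) = _ , inj₁ refl
  Incident⇒Joins (inj₂ refl) = _ , inj₂ refl

  Incident²⇒Joins : ∀ {e u v} → Incident G u e → Incident G v e → u ≢ v → Joins G e u v
  Incident²⇒Joins (inj₁ refl) (inj₁ refl) u≢v = contradiction refl u≢v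
  Incident²⇒Joins (inj₁ refl) (inj₂ refl) u≢v = inj₁ refl
  Incident²⇒Joins (inj₂ refl) (inj₁ refl) u≢v = inj₂ refl
  Incident²⇒Joins (inj₂ refl) (inj₂ refl) u≢v = contradiction refl u≢v

  Incident-Joins : ∀ {e u v w} → Joins G e u v → Incident G w e → w ≡ u ⊎ w ≡ v
  Incident-Joins (inj₁ eq) (inj₁ refl) = inj₁ (cong proj₁ eq)
  Incident-Joins (inj₁ eq) (inj₂ refl) = inj₂ (cong proj₂ eq)
  Incident-Joins (inj₂ eq) (inj₁ refl) = inj₂ (cong proj₁ eq)
  Incident-Joins (inj₂ eq) (inj₂ refl) = inj₁ (cong proj₂ eq)

  Joins-functional : ∀ {e u v w} → Joins G e u v → Joins G e u w → v ≡ w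
  Joins-functional {e} j k with Incident-Joins {e} j (Joins⇒Incidentʳ {e} k)
  ... | inj₁ w≡u = contradiction (sym w≡u) (Joins⇒≢ {e} k)
  ... | inj₂ w≡v = sym w≡v

  Joins-unique : ∀ {e f u v} → Joins G e u v → Joins G f u v → e ≡ f
  Joins-unique         (inj₁ p) (inj₁ q) = distinct G (trans p (sym q))
  Joins-unique         (inj₂ p) (inj₂ q) = distinct G (trans p (sym q))
  Joins-unique {e} {f} (inj₁ p) (inj₂ q) = ⊥-elim (Joins-asym {e} {f} p q)
    where
    Joins-asym : ∀ {e f u v} → ends G e ≡ (u , v) → ends G f ≡ (v , u) → ⊥
    Joins-asym {e} {f} p q with ends G e | sorted G e | ends G f | sorted G f
    Joins-asym refl refl | _ | u<v | _ | v<u = Fin.<-asym u<v v<u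
  Joins-unique {e} {f} (inj₂ p) (inj₁ q) = sym (Joins-unique {f} {e} (inj₁ q) (inj₂ p))

  Adjacent-sym : ∀ {u v} → Adjacent G u v → Adjacent G v u
  Adjacent-sym (e , j) = e , Joins-sym {e} j

module _ (G : Graph) (e : E G) where

  private G′ = subdivide G e

  ends-new : newEnds G e (suc e) ≡ (zero , suc (proj₁ (ends G e)))
  ends-new with e ≟ e
  ... | yes _  = refl
  ... | no e≢e = contradiction refl e≢e

  ends-old : ∀ {f} → f ≢ e → newEnds G e (suc f) ≡ lift G e (ends G f)
  ends-old {f} f≢e with f ≟ e
  ... | yes f≡e = contradiction f≡e f≢e
  ... | no _    = refl

  subdivide-new⁻ : ∀ {f w} → Joins G′ f zero (suc w) → Incident G w e
  subdivide-new⁻ {zero}  (inj₁ eq) = inj₂ (Fin.suc-injective (cong proj₂ eq))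
  subdivide-new⁻ {zero}  (inj₂ ())
  subdivide-new⁻ {suc f} j with f ≟ e
  subdivide-new⁻ {suc f} (inj₁ eq) | yes _ = inj₁ (Fin.suc-injective (cong proj₂ eq))
  subdivide-new⁻ {suc f} (inj₂ ()) | yes _
  subdivide-new⁻ {suc f} (inj₁ ()) | no _
  subdivide-new⁻ {suc f} (inj₂ ()) | no _

  subdivide-new⁺ : ∀ {w} → Incident G w e →
    Joins G′ zero zero (suc w) ⊎ Joins G′ (suc e) zero (suc w)
  subdivide-new⁺ (inj₁ refl) = inj₂ (inj₁ ends-new)
  subdivide-new⁺ (inj₂ refl) = inj₁ (inj₁ refl)

  subdivide-loopless : ¬ Adjacent G′ zero zero
  subdivide-loopless (f , j) = Joins⇒≢ {G′} {f} j refl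

  subdivide-old⁻ : ∀ {f u v} → Joins G′ f (suc u) (suc v) → ∃[ g ] (f ≡ suc g × g ≢ e × Joins G g u v)
  subdivide-old⁻ {zero}  (inj₁ ())
  subdivide-old⁻ {zero}  (inj₂ ())
  subdivide-old⁻ {suc f} j with f ≟ e
  subdivide-old⁻ {suc f} (inj₁ ()) | yes _
  subdivide-old⁻ {suc f} (inj₂ ()) | yes _
  subdivide-old⁻ {suc f} (inj₁ eq) | no f≢e = f , refl , f≢e , inj₁ (lift-injective G e eq)
  subdivide-old⁻ {suc f} (inj₂ eq) | no f≢e = f , refl , f≢e , inj₂ (lift-injective G e eq)

  subdivide-old⁺ : ∀ {f u v} → f ≢ e → Joins G f u v → Joins G′ (suc f) (suc u) (suc v)
  subdivide-old⁺ f≢e (inj₁ eq) = inj₁ (trans (ends-old f≢e) (cong (lift G e) eq))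
  subdivide-old⁺ f≢e (inj₂ eq) = inj₂ (trans (ends-old f≢e) (cong (lift G e) eq))

-- Undoing a subdivision by suppressing vertices of degree 2

module _ (H : Graph) {c : ℕ} (col : E H → Fin c) where

  Vertex : ℕ → Set
  Vertex k = Fin k ⊎ V H

  -- A colored graph that looks like a subdivision of H: a vertex inj₂ a has
  -- the colors of the edges of H at a, once each, and inj₁ s is one of the
  -- k vertices of degree 2, both of its edges having the color t s.
  record SubdivisionLike {k : ℕ} (t : Fin k → Fin c) (adj : Fin c → Rel (Vertex k) 0ℓ) : Set where
    field
      symmetric   : ∀ {j u v} → adj j u v → adj j v u
      loopless    : ∀ {j u} → ¬ adj j u u
      branch-col  : ∀ {j a v} → adj j (inj₂ a) v → ∃[ e ] (col e ≡ j × Incident H a e)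
      branch-≤1   : ∀ {j a v w} → adj j (inj₂ a) v → adj j (inj₂ a) w → v ≡ w
      branch-≥1   : ∀ {a} e → Incident H a e → ∃[ v ] adj (col e) (inj₂ a) v
      inner-col   : ∀ {j s v} → adj j (inj₁ s) v → j ≡ t s
      inner-nbrs  : ∀ s → ∃[ x ] ∃[ y ] (x ≢ y × adj (t s) (inj₁ s) x × adj (t s) (inj₁ s) y ×
                      (∀ v → adj (t s) (inj₁ s) v → v ≡ x ⊎ v ≡ y))
      linked      : ∀ {j u u′ v v′} → adj j u u′ → adj j v v′ → Star (adj j) u v

  up : ∀ {k} → Vertex k → Vertex (suc k)
  up (inj₁ s) = inj₁ (suc s)
  up (inj₂ a) = inj₂ a

  up-injective : ∀ {k} {u v : Vertex k} → up u ≡ up v → u ≡ v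
  up-injective {u = inj₁ s} {inj₁ t} eq = cong inj₁ (Fin.suc-injective (inj₁-injective eq))
  up-injective {u = inj₂ a} {inj₂ b} eq = cong inj₂ (inj₂-injective eq)

  data View {k : ℕ} : Vertex (suc k) → Set where
    is-zero : View (inj₁ zero)
    is-up   : ∀ u → View (up u)

  view : ∀ {k} (u : Vertex (suc k)) → View u
  view (inj₁ zero)    = is-zero
  view (inj₁ (suc s)) = is-up (inj₁ s)
  view (inj₂ a)       = is-up (inj₂ a)

  module Suppress (col-inj : Injective _≡_ _≡_ col) (col-surj : ∀ j → ∃[ e ] col e ≡ j)
    {k : ℕ} {t : Fin (suc k) → Fin c} {adj : Fin c → Rel (Vertex (suc k)) 0ℓ}
    (L : SubdivisionLike t adj) where

    open SubdivisionLike L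

    z : Vertex (suc k)
    z = inj₁ zero

    i : Fin c
    i = t zero

    -- Otherwise suppressing z would create a loop or a double edge: in the
    -- first case x, y and z form a monochromatic cycle, which contains no
    -- vertex of H, and in the second case H has two edges joining x and y.
    nbrs-nonadjacent : ∀ {x y} → x ≢ y → adj i z x → adj i z y →
      (∀ v → adj i z v → v ≡ x ⊎ v ≡ y) → ∀ j → ¬ adj j x y
    -- Both xy and zy have the color of the degree-2 vertex y. The branch vertex x then has two
    -- edges of one color, to z and to y, so y would equal z.
    nbrs-nonadjacent {inj₂ a} {inj₁ s} x≢y zx zy cover j xy
      with refl ← trans (inner-col (symmetric xy)) (sym (inner-col (symmetric zy)))
      with refl ← branch-≤1 (symmetric zx) xy = loopless zy
    nbrs-nonadjacent {inj₁ s} {inj₂ a} x≢y zx zy cover j xy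
      with refl ← trans (inner-col xy) (sym (inner-col (symmetric zx)))
      with refl ← branch-≤1 (symmetric zy) (symmetric xy) = loopless zx
    nbrs-nonadjacent {inj₂ a} {inj₂ b} x≢y zx zy cover j xy
      with e , e-col , ae ← branch-col (symmetric zx)
         | f , f-col , bf ← branch-col (symmetric zy)
         | e′ , e′-col , ae′ ← branch-col xy
         | f′ , f′-col , bf′ ← branch-col (symmetric xy)
      with refl ← col-inj (trans e-col (sym f-col)) | refl ← col-inj (trans e′-col (sym f′-col))
      with refl ← Joins-unique {H} {e} {e′} (Incident²⇒Joins {H} {e} ae bf (x≢y ∘ cong inj₂))
                    (Incident²⇒Joins {H} {e′} ae′ bf′ (x≢y ∘ cong inj₂))
      with refl ← trans (sym e-col) e′-col
      with () ← branch-≤1 (symmetric zx) xy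
    nbrs-nonadjacent {inj₁ s} {inj₁ s′} x≢y zx zy cover j xy
      with refl ← trans (inner-col xy) (sym (inner-col (symmetric zx))) = no-branch
      where
      x y : Vertex (suc k)
      x = inj₁ s
      y = inj₁ s′

      data Triangle : Vertex (suc k) → Set where
        at-z : Triangle z
        at-x : Triangle x
        at-y : Triangle y

      two-nbrs : ∀ {j} s₀ {p q} → p ≢ q → adj j (inj₁ s₀) p → adj j (inj₁ s₀) q →
        ∀ v → adj j (inj₁ s₀) v → v ≡ p ⊎ v ≡ q
      two-nbrs s₀ p≢q ap aq v av
        with x₀ , y₀ , _ , _ , _ , cover₀ ← inner-nbrs s₀
        with refl ← inner-col ap
        with cover₀ _ ap | cover₀ _ aq | cover₀ v av
      ... | inj₁ refl | inj₁ refl | _         = contradiction refl p≢q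
      ... | inj₁ refl | inj₂ refl | r         = r
      ... | inj₂ refl | inj₁ refl | r         = swap r
      ... | inj₂ refl | inj₂ refl | _         = contradiction refl p≢q

      closed-step : ∀ {u v} → Triangle u → adj i u v → Triangle v
      closed-step at-z uv with cover _ uv
      ... | inj₁ refl = at-x
      ... | inj₂ refl = at-y
      closed-step at-x uv with two-nbrs s (λ { refl → loopless zy }) (symmetric zx) xy _ uv
      ... | inj₁ refl = at-z
      ... | inj₂ refl = at-y
      closed-step at-y uv with two-nbrs s′ (λ { refl → loopless zx }) (symmetric zy) (symmetric xy) _ uv
      ... | inj₁ refl = at-z
      ... | inj₂ refl = at-x

      closed-walk : ∀ {u v} → Triangle u → Star (adj i) u v → Triangle v
      closed-walk tr ε       = tr
      closed-walk tr (a ◅ w) = closed-walk (closed-step tr a) w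

      -- Color `i` belongs to an edge of `H`, so some branch vertex has an edge of this color. By
      -- `linked` a walk from z reaches it, although no walk of color `i` leaves the triangle.
      no-branch : ⊥
      no-branch with e , e-col ← col-surj i
        with v , av ← branch-≥1 e (inj₁ refl)
        with closed-walk at-z (linked zx (subst (λ j → adj j _ _) e-col av))
      ... | ()

    module At {x′ y′ : Vertex k} (x≢y : up x′ ≢ up y′) (zx : adj i z (up x′)) (zy : adj i z (up y′))
      (cover : ∀ v → adj i z v → v ≡ up x′ ⊎ v ≡ up y′) where

      nonadjacent : ∀ j → ¬ adj j (up x′) (up y′)
      nonadjacent = nbrs-nonadjacent x≢y zx zy cover

      Ends : Rel (Vertex k) 0ℓ
      Ends u v = (u ≡ x′ × v ≡ y′) ⊎ (u ≡ y′ × v ≡ x′)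

      adj′ : Fin c → Rel (Vertex k) 0ℓ
      adj′ j u v = adj j (up u) (up v) ⊎ (j ≡ i × Ends u v)

      z≢up : ∀ v → z ≢ up v
      z≢up (inj₁ _) ()
      z≢up (inj₂ _) ()

      Ends-z : ∀ {u v} → Ends u v → adj i z (up u) × adj i z (up v)
      Ends-z (inj₁ (refl , refl)) = zx , zy
      Ends-z (inj₂ (refl , refl)) = zy , zx

      Ends-functional : ∀ {u v w} → Ends u v → Ends u w → v ≡ w
      Ends-functional (inj₁ (refl , refl)) (inj₁ (_ , refl)) = refl
      Ends-functional (inj₁ (refl , refl)) (inj₂ (refl , _)) = contradiction refl x≢y
      Ends-functional (inj₂ (refl , refl)) (inj₁ (refl , _)) = contradiction refl x≢y
      Ends-functional (inj₂ (refl , refl)) (inj₂ (_ , refl)) = refl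

      Ends-nonadjacent : ∀ {j u v} → Ends u v → ¬ adj j (up u) (up v)
      Ends-nonadjacent (inj₁ (refl , refl)) uv = nonadjacent _ uv
      Ends-nonadjacent (inj₂ (refl , refl)) uv = nonadjacent _ (symmetric uv)

      z-Ends : ∀ {u} → adj i z (up u) → ∃[ v ] Ends u v
      z-Ends zu with cover _ zu
      ... | inj₁ eq = y′ , inj₁ (up-injective eq , refl)
      ... | inj₂ eq = x′ , inj₂ (up-injective eq , refl)

      old-nbr : ∀ {j u v} → adj′ j u v → ∃[ w ] adj j (up u) w
      old-nbr (inj₁ uv)          = _ , uv
      old-nbr (inj₂ (refl , en)) = z , symmetric (proj₁ (Ends-z en))

      -- An edge that led to z is replaced by the new edge to the other end; the disjunction
      -- remembers which of the two cases occurred.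
      new-nbr : ∀ {j u w} → adj j (up u) w → ∃[ v ] (adj′ j u v × (w ≡ up v ⊎ (w ≡ z × j ≡ i × Ends u v)))
      new-nbr {w = w} uw with view w
      ... | is-up v = v , inj₁ uw , inj₁ refl
      ... | is-zero with refl ← inner-col (symmetric uw) =
        let v , en = z-Ends (symmetric uw) in v , inj₂ (refl , en) , inj₂ (refl , refl , en)

      contract : Vertex (suc k) → Vertex k
      contract u with view u
      ... | is-zero = x′
      ... | is-up u = u

      contract-up : ∀ u → contract (up u) ≡ u
      contract-up (inj₁ _) = refl
      contract-up (inj₂ _) = refl

      -- Collapsing z onto x′ shrinks the edge zx′ to a point and turns zy′ into the new edge x′y′,
      -- so monochromatic walks survive the suppression.
      contract-step : ∀ {j u v} → adj j u v → Star (adj′ j) (contract u) (contract v)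
      contract-step {j} {u} {v} uv with view u | view v
      ... | is-zero | is-zero = ε
      ... | is-up _ | is-up _ = inj₁ uv ◅ ε
      ... | is-zero | is-up _ with refl ← inner-col uv with cover _ uv
      ...   | inj₁ eq rewrite up-injective eq = ε
      ...   | inj₂ eq rewrite up-injective eq = inj₂ (refl , inj₁ (refl , refl)) ◅ ε
      contract-step {j} {u} {v} uv | is-up _ | is-zero with refl ← inner-col (symmetric uv) with cover _ (symmetric uv)
      ...   | inj₁ eq rewrite up-injective eq = ε
      ...   | inj₂ eq rewrite up-injective eq = inj₂ (refl , inj₂ (refl , refl)) ◅ ε

      contract-walk : ∀ {j u v} → Star (adj j) u v → Star (adj′ j) (contract u) (contract v)
      contract-walk ε        = ε
      contract-walk (uv ◅ w) = contract-step uv ◅◅ contract-walk w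

      symmetric′ : ∀ {j u v} → adj′ j u v → adj′ j v u
      symmetric′ (inj₁ uv)              = inj₁ (symmetric uv)
      symmetric′ (inj₂ (eq , inj₁ (p , q))) = inj₂ (eq , inj₂ (q , p))
      symmetric′ (inj₂ (eq , inj₂ (p , q))) = inj₂ (eq , inj₁ (q , p))

      loopless′ : ∀ {j u} → ¬ adj′ j u u
      loopless′ (inj₁ uu)                        = loopless uu
      loopless′ (inj₂ (_ , inj₁ (refl , refl))) = x≢y refl
      loopless′ (inj₂ (_ , inj₂ (refl , refl))) = x≢y refl

      old≢new : ∀ {j a v w} → adj j (inj₂ a) (up v) → ¬ (j ≡ i × Ends (inj₂ a) w)
      old≢new {v = v} av (refl , en) = z≢up v (branch-≤1 (symmetric (proj₁ (Ends-z en))) av)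

      branch-≤1′ : ∀ {j a v w} → adj′ j (inj₂ a) v → adj′ j (inj₂ a) w → v ≡ w
      branch-≤1′ (inj₁ av)       (inj₁ aw)        = up-injective (branch-≤1 av aw)
      branch-≤1′ (inj₁ av)       (inj₂ new)       = contradiction new (old≢new av)
      branch-≤1′ (inj₂ new)      (inj₁ aw)        = contradiction new (old≢new aw)
      branch-≤1′ (inj₂ (_ , en)) (inj₂ (_ , en′)) = Ends-functional en en′

      inner-nbrs′ : ∀ s → ∃[ x ] ∃[ y ] (x ≢ y × adj′ (t (suc s)) (inj₁ s) x × adj′ (t (suc s)) (inj₁ s) y ×
        (∀ v → adj′ (t (suc s)) (inj₁ s) v → v ≡ x ⊎ v ≡ y))
      inner-nbrs′ s
        with p , q , p≢q , ap , aq , cover₀ ← inner-nbrs (suc s)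
        with p′ , ap′ , p-eq ← new-nbr {u = inj₁ s} ap | q′ , aq′ , q-eq ← new-nbr {u = inj₁ s} aq =
        p′ , q′ , distinct′ p-eq q-eq , ap′ , aq′ , cover′
        where
        distinct′ : p ≡ up p′ ⊎ (p ≡ z × t (suc s) ≡ i × Ends (inj₁ s) p′) →
          q ≡ up q′ ⊎ (q ≡ z × t (suc s) ≡ i × Ends (inj₁ s) q′) → p′ ≢ q′
        distinct′ (inj₁ refl) (inj₁ refl) refl = p≢q refl
        -- An old edge and the new edge leading to the same vertex would mean that x′ and y′ were
        -- adjacent before, which `nonadjacent` excludes.
        distinct′ (inj₁ refl) (inj₂ (_ , _ , en)) refl = Ends-nonadjacent en ap
        distinct′ (inj₂ (_ , _ , en)) (inj₁ refl) refl = Ends-nonadjacent en aq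
        distinct′ (inj₂ (refl , _)) (inj₂ (refl , _)) _ = p≢q refl

        same : ∀ {w v v₀} → w ≡ up v ⊎ (w ≡ z × t (suc s) ≡ i × Ends (inj₁ s) v) →
          (adj (t (suc s)) (inj₁ (suc s)) (up v₀) × w ≡ up v₀) ⊎ (Ends (inj₁ s) v₀ × w ≡ z) → v₀ ≡ v
        same {v = v} (inj₁ refl) (inj₁ (_ , eq)) = up-injective (sym eq)
        same {v = inj₁ _} (inj₁ refl) (inj₂ (_ , ()))
        same {v = inj₂ _} (inj₁ refl) (inj₂ (_ , ()))
        same {v₀ = inj₁ _} (inj₂ (refl , _)) (inj₁ (_ , ()))
        same {v₀ = inj₂ _} (inj₂ (refl , _)) (inj₁ (_ , ()))
        same (inj₂ (_ , _ , en)) (inj₂ (en′ , _)) = Ends-functional en′ en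

        cover′ : ∀ v → adj′ (t (suc s)) (inj₁ s) v → v ≡ p′ ⊎ v ≡ q′
        cover′ v (inj₁ av) with cover₀ _ av
        ... | inj₁ eq = inj₁ (same p-eq (inj₁ (av , sym eq)))
        ... | inj₂ eq = inj₂ (same q-eq (inj₁ (av , sym eq)))
        cover′ v (inj₂ (eq , en))
          with cover₀ z (subst (λ j → adj j _ z) (sym eq) (symmetric (proj₁ (Ends-z en))))
        ... | inj₁ eq′ = inj₁ (same p-eq (inj₂ (en , sym eq′)))
        ... | inj₂ eq′ = inj₂ (same q-eq (inj₂ (en , sym eq′)))

      suppressed : SubdivisionLike (t ∘ suc) adj′
      suppressed = record
        { symmetric  = symmetric′
        ; loopless   = loopless′
        ; branch-col = λ av → branch-col (proj₂ (old-nbr av))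
        ; branch-≤1  = branch-≤1′
        ; branch-≥1  = λ e inc → let v , av , _ = new-nbr (proj₂ (branch-≥1 e inc)) in v , av
        ; inner-col  = λ sv → inner-col (proj₂ (old-nbr sv))
        ; inner-nbrs = inner-nbrs′
        ; linked     = λ {j} {u} {_} {v} uu′ vv′ → subst₂-Star (contract-up u) (contract-up v)
            (contract-walk (linked (proj₂ (old-nbr uu′)) (proj₂ (old-nbr vv′))))
        }
        where
        subst₂-Star : ∀ {j u u′ v v′} → u ≡ u′ → v ≡ v′ → Star (adj′ j) u v → Star (adj′ j) u′ v′
        subst₂-Star refl refl w = w

      module _ {F : Graph} (iso : Isomorphic (λ u v → ∃[ j ] adj′ j u v) (Adjacent F)) where

        private
          φ = proj₁ iso
          φ-adj = proj₂ iso
          open Inverse φ using (to; from; strictlyInverseˡ; strictlyInverseʳ)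

          injective : ∀ {u v} → to u ≡ to v → u ≡ v
          injective {u} {v} eq = trans (sym (strictlyInverseʳ u)) (trans (cong from eq) (strictlyInverseʳ v))

        e-adj : Adjacent F (to x′) (to y′)
        e-adj = Equivalence.to (φ-adj x′ y′) (i , inj₂ (refl , inj₁ (refl , refl)))

        e : E F
        e = proj₁ e-adj

        e-joins : Joins F e (to x′) (to y′)
        e-joins = proj₂ e-adj

        ψ-to : Vertex (suc k) → V (subdivide F e)
        ψ-to (inj₁ zero)    = zero
        ψ-to (inj₁ (suc s)) = suc (to (inj₁ s))
        ψ-to (inj₂ a)       = suc (to (inj₂ a))

        ψ-up : ∀ u → ψ-to (up u) ≡ suc (to u)
        ψ-up (inj₁ _) = refl
        ψ-up (inj₂ _) = refl

        ψ-from : V (subdivide F e) → Vertex (suc k)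
        ψ-from zero    = z
        ψ-from (suc v) = up (from v)

        ψ : Vertex (suc k) ↔ V (subdivide F e)
        ψ = mk↔ₛ′ ψ-to ψ-from to-from from-to
          where
          to-from : ∀ v → ψ-to (ψ-from v) ≡ v
          to-from zero    = refl
          to-from (suc v) = trans (ψ-up (from v)) (cong suc (strictlyInverseˡ v))
          from-to : ∀ u → ψ-from (ψ-to u) ≡ u
          from-to u with view u
          ... | is-zero = refl
          ... | is-up u rewrite ψ-up u = cong up (strictlyInverseʳ u)

        z-adj : ∀ v → (∃[ j ] adj j z (up v)) ⇔ Adjacent (subdivide F e) zero (suc (to v))
        z-adj v = mk⇔ fwd bwd
          where
          fwd : ∃[ j ] adj j z (up v) → Adjacent (subdivide F e) zero (suc (to v))
          fwd (j , zv) with refl ← inner-col zv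
            with subdivide-new⁺ F e {to v} (inc (cover _ zv))
            where
            inc : up v ≡ up x′ ⊎ up v ≡ up y′ → Incident F (to v) e
            inc (inj₁ eq) rewrite up-injective {u = v} {x′} eq = Joins⇒Incidentˡ {F} {e} e-joins
            inc (inj₂ eq) rewrite up-injective {u = v} {y′} eq = Joins⇒Incidentʳ {F} {e} e-joins
          ... | inj₁ j₀ = zero , j₀
          ... | inj₂ j₀ = suc e , j₀
          bwd : Adjacent (subdivide F e) zero (suc (to v)) → ∃[ j ] adj j z (up v)
          bwd (f , j₀) with Incident-Joins {F} {e} e-joins (subdivide-new⁻ F e {f} j₀)
          ... | inj₁ eq rewrite injective eq = i , zx
          ... | inj₂ eq rewrite injective eq = i , zy

        up-adj : ∀ u v → (∃[ j ] adj j (up u) (up v)) ⇔ Adjacent (subdivide F e) (suc (to u)) (suc (to v))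
        up-adj u v = mk⇔ fwd bwd
          where
          joins⇒Ends : Joins F e (to u) (to v) → Ends u v
          joins⇒Ends j₀
            with Incident-Joins {F} {e} e-joins (Joins⇒Incidentˡ {F} {e} j₀)
               | Incident-Joins {F} {e} e-joins (Joins⇒Incidentʳ {F} {e} j₀)
          ... | inj₁ p | inj₂ q = inj₁ (injective p , injective q)
          ... | inj₂ p | inj₁ q = inj₂ (injective p , injective q)
          ... | inj₁ p | inj₁ q = contradiction (trans p (sym q)) (Joins⇒≢ {F} {e} j₀)
          ... | inj₂ p | inj₂ q = contradiction (trans p (sym q)) (Joins⇒≢ {F} {e} j₀)

          fwd : ∃[ j ] adj j (up u) (up v) → Adjacent (subdivide F e) (suc (to u)) (suc (to v))
          fwd (j , uv) with f , j₀ ← Equivalence.to (φ-adj u v) (j , inj₁ uv) =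
            suc f , subdivide-old⁺ F e (λ { refl → Ends-nonadjacent (joins⇒Ends j₀) uv }) j₀

          Ends⇒joins : Ends u v → Joins F e (to u) (to v)
          Ends⇒joins (inj₁ (refl , refl)) = e-joins
          Ends⇒joins (inj₂ (refl , refl)) = Joins-sym {F} {e} e-joins

          bwd : Adjacent (subdivide F e) (suc (to u)) (suc (to v)) → ∃[ j ] adj j (up u) (up v)
          bwd (f , j₀) with g , _ , g≢e , j₁ ← subdivide-old⁻ F e {f} j₀
            with Equivalence.from (φ-adj u v) (g , j₁)
          ... | j , inj₁ uv       = j , uv
          ... | j , inj₂ (_ , en) =
            contradiction (Joins-unique {F} {g} {e} j₁ (Ends⇒joins en)) g≢e

        -- Subdividing the edge of `F` that stands for x′y′ undoes the suppression, with `zero` in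
        -- the place of z. By `nonadjacent`, the edge removed in doing so stands for no old edge.
        extended-iso : Isomorphic (λ u v → ∃[ j ] adj j u v) (Adjacent (subdivide F e))
        extended-iso = ψ , ψ-adj
          where
          ψ-adj : ∀ u v → (∃[ j ] adj j u v) ⇔ Adjacent (subdivide F e) (ψ-to u) (ψ-to v)
          ψ-adj u v with view u | view v
          ... | is-zero | is-zero = mk⇔
            (λ (_ , zz) → contradiction zz loopless) (λ adj₀ → contradiction adj₀ (subdivide-loopless F e))
          ... | is-zero | is-up v rewrite ψ-up v = z-adj v
          ... | is-up u | is-zero rewrite ψ-up u = mk⇔
            (λ (j , uz) → Adjacent-sym {subdivide F e} (Equivalence.to (z-adj u) (j , symmetric uz)))
            (λ adj₀ → let j , zu = Equivalence.from (z-adj u) (Adjacent-sym {subdivide F e} adj₀) in j , symmetric zu)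
          ... | is-up u | is-up v rewrite ψ-up u | ψ-up v = up-adj u v

  module _ (col-inj : Injective _≡_ _≡_ col) (col-surj : ∀ j → ∃[ e ] col e ≡ j) where

    -- Induction on the number of degree-2 vertices. When none is left, the color of an edge names
    -- the edge of `H` with the same ends; otherwise one vertex is suppressed, and the edge that
    -- replaces it is subdivided in the graph obtained by induction.
    SubdivisionLike⇒Subdivision : ∀ {k} {t : Fin k → Fin c} {adj : Fin c → Rel (Vertex k) 0ℓ} →
      SubdivisionLike t adj → ∃[ F ] (Subdivision H F × Isomorphic (λ u v → ∃[ j ] adj j u v) (Adjacent F))
    SubdivisionLike⇒Subdivision {zero} {t} {adj} L = H , none , φ , φ-adj
      where
      open SubdivisionLike L

      φ : Vertex 0 ↔ V H
      φ = mk↔ₛ′ (λ { (inj₁ ()) ; (inj₂ a) → a }) inj₂ (λ _ → refl) (λ { (inj₁ ()) ; (inj₂ _) → refl })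

      joined : ∀ {j a b} → adj j (inj₂ a) (inj₂ b) → ∃[ e ] (col e ≡ j × Joins H e a b)
      joined {j} {a} {b} ab
        with e , e-col , ae ← branch-col ab | f , f-col , bf ← branch-col (symmetric ab)
        with refl ← col-inj (trans e-col (sym f-col)) =
        e , e-col , Incident²⇒Joins {H} {e} ae bf λ { refl → loopless ab }

      φ-adj : ∀ u v → (∃[ j ] adj j u v) ⇔ Adjacent H (Inverse.to φ u) (Inverse.to φ v)
      φ-adj (inj₂ a) (inj₂ b) = mk⇔ (λ (_ , ab) → let e , _ , j₀ = joined ab in e , j₀) bwd
        where
        bwd : Adjacent H a b → ∃[ j ] adj j (inj₂ a) (inj₂ b)
        bwd (e , j₀) with branch-≥1 e (Joins⇒Incidentˡ {H} {e} j₀)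
        ... | inj₂ b′ , ab′ with f , f-col , j₁ ← joined ab′
          with refl ← col-inj f-col
          with refl ← Joins-functional {H} {e} j₀ j₁ = col e , ab′

    SubdivisionLike⇒Subdivision {suc k} {t} {adj} L =
      let x , y , x≢y , zx , zy , cover = inner-nbrs zero in suppress (view x) (view y) x≢y zx zy cover
      where
      open Suppress col-inj col-surj L
      open SubdivisionLike L
      suppress : ∀ {x y} → View x → View y → x ≢ y → adj i z x → adj i z y →
        (∀ v → adj i z v → v ≡ x ⊎ v ≡ y) →
        ∃[ F ] (Subdivision H F × Isomorphic (λ u v → ∃[ j ] adj j u v) (Adjacent F))
      suppress is-zero    _          x≢y zx zy cover = contradiction zx loopless
      suppress (is-up _)  is-zero    x≢y zx zy cover = contradiction zy loopless
      suppress (is-up x′) (is-up y′) x≢y zx zy cover =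
        let open At {x′} {y′} x≢y zx zy cover
            F , sub , iso = SubdivisionLike⇒Subdivision suppressed
        in subdivide F (e {F} iso) , step sub (e {F} iso) , extended-iso {F} iso

-- Isomorphisms, Δ, and colored degrees as neighbor counts

Isomorphic-sym : {A B : Set} {R : Rel A 0ℓ} {S : Rel B 0ℓ} → Isomorphic R S → Isomorphic S R
Isomorphic-sym {R = R} {S} (φ , φ-adj) = ↔-sym φ , λ x y → mk⇔
  (λ s → Equivalence.from (φ-adj _ _) (subst₂ S (sym (strictlyInverseˡ x)) (sym (strictlyInverseˡ y)) s))
  (λ r → subst₂ S (strictlyInverseˡ x) (strictlyInverseˡ y) (Equivalence.to (φ-adj _ _) r))
  where open Inverse φ

Isomorphic-trans : {A B C : Set} {R : Rel A 0ℓ} {S : Rel B 0ℓ} {T : Rel C 0ℓ} →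
  Isomorphic R S → Isomorphic S T → Isomorphic R T
Isomorphic-trans (φ , φ-adj) (χ , χ-adj) = χ ↔-∘ φ , λ x y → χ-adj _ _ ⇔-∘ φ-adj x y

vec-ext : ∀ {c} {A : Set} {d d′ : Vec A c} → (∀ i → Vec.lookup d i ≡ Vec.lookup d′ i) → d ≡ d′
vec-ext {d = d} {d′} eq = trans (sym (tabulate∘lookup d)) (trans (Vec.tabulate-cong eq) (tabulate∘lookup d′))

∈Δ⇒lookup : ∀ {c} {d : Vec ℕ c} → d ∈Δ →
  ∃[ i ] (Vec.lookup d i ≡ 2 × (∀ j → j ≢ i → Vec.lookup d j ≡ 0))
∈Δ⇒lookup {c} (i , refl) = i , lookup∘update i (replicate c 0) 2 ,
  λ j j≢i → trans (lookup∘update′ j≢i (replicate c 0) 2) (lookup-replicate j 0)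

lookup⇒∈Δ : ∀ {c} {d : Vec ℕ c} i → Vec.lookup d i ≡ 2 → (∀ j → j ≢ i → Vec.lookup d j ≡ 0) → d ∈Δ
lookup⇒∈Δ {c} {d} i two others = i , vec-ext λ j → same j (j ≟ i)
  where
  same : ∀ j → Dec (j ≡ i) → Vec.lookup d j ≡ Vec.lookup (replicate c 0 [ i ]≔ 2) j
  same j (yes refl) = trans two (sym (lookup∘update i (replicate c 0) 2))
  same j (no j≢i)   =
    trans (others j j≢i) (sym (trans (lookup∘update′ j≢i (replicate c 0) 2) (lookup-replicate j 0)))

∈Δ? : ∀ {c} → Decidable (_∈Δ {c})
∈Δ? {c} d = any? λ i → Vec.≡-dec ℕ._≟_ d (replicate c 0 [ i ]≔ 2)

∈Δ-≰1 : ∀ {c} {d : Vec ℕ c} → (∀ j → Vec.lookup d j ≤ 1) → ¬ d ∈Δ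
∈Δ-≰1 ≤1 d∈Δ with i , two , _ ← ∈Δ⇒lookup d∈Δ with s≤s () ← subst (_≤ 1) two (≤1 i)

Unique-tabulate⁻ : {A : Set} {n : ℕ} (h : Fin n → A) → Unique (tabulate h) → Injective _≡_ _≡_ h
Unique-tabulate⁻ h (x∉ ∷ uniq) {zero}  {zero}  eq = refl
Unique-tabulate⁻ h (x∉ ∷ uniq) {zero}  {suc j} eq = contradiction eq (All.tabulate⁻ x∉ j)
Unique-tabulate⁻ h (x∉ ∷ uniq) {suc i} {zero}  eq = contradiction (sym eq) (All.tabulate⁻ x∉ i)
Unique-tabulate⁻ h (x∉ ∷ uniq) {suc i} {suc j} eq = cong suc (Unique-tabulate⁻ (h ∘ suc) uniq eq)

Unique-tabulate-++⁻ : {A : Set} {k n : ℕ} (h₁ : Fin k → A) (h₂ : Fin n → A) →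
  Unique (tabulate h₁ ++ tabulate h₂) → Injective _≡_ _≡_ [ h₁ , h₂ ]′
Unique-tabulate-++⁻ {k = zero} h₁ h₂ uniq {inj₂ a} {inj₂ b} eq = cong inj₂ (Unique-tabulate⁻ h₂ uniq eq)
Unique-tabulate-++⁻ {k = suc k} h₁ h₂ (x∉ ∷ uniq) = inj
  where
  x∉₁ = All.++⁻ˡ (tabulate (h₁ ∘ suc)) x∉
  x∉₂ = All.++⁻ʳ (tabulate (h₁ ∘ suc)) x∉
  rec : Injective _≡_ _≡_ [ h₁ ∘ suc , h₂ ]′
  rec {u} {v} = Unique-tabulate-++⁻ (h₁ ∘ suc) h₂ uniq {u} {v}
  lift₁ : ∀ {i j} → inj₁ i ≡ inj₁ j → inj₁ {B = Fin _} (suc i) ≡ inj₁ (suc j)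
  lift₁ refl = refl
  lift₂ : ∀ {i b} → inj₁ i ≡ inj₂ b → inj₁ {B = Fin _} (suc i) ≡ inj₂ b
  lift₂ ()
  inj : Injective _≡_ _≡_ [ h₁ , h₂ ]′
  inj {inj₁ zero}    {inj₁ zero}    eq = refl
  inj {inj₁ zero}    {inj₁ (suc j)} eq = contradiction eq (All.tabulate⁻ x∉₁ j)
  inj {inj₁ zero}    {inj₂ b}       eq = contradiction eq (All.tabulate⁻ x∉₂ b)
  inj {inj₁ (suc i)} {inj₁ zero}    eq = contradiction (sym eq) (All.tabulate⁻ x∉₁ i)
  inj {inj₁ (suc i)} {inj₁ (suc j)} eq = lift₁ (rec {inj₁ i} {inj₁ j} eq)
  inj {inj₁ (suc i)} {inj₂ b}       eq = lift₂ (rec {inj₁ i} {inj₂ b} eq)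
  inj {inj₂ a}       {inj₁ zero}    eq = contradiction (sym eq) (All.tabulate⁻ x∉₂ a)
  inj {inj₂ a}       {inj₁ (suc j)} eq = sym (lift₂ (sym (rec {inj₂ a} {inj₁ j} eq)))
  inj {inj₂ a}       {inj₂ b}       eq with refl ← rec {inj₂ a} {inj₂ b} eq = refl

map-split : {A B : Set} (f : A → B) (xs : List B) {ys : List B} (zs : List A) → xs ++ ys ≡ map f zs →
  ∃[ zs₁ ] ∃[ zs₂ ] (zs ≡ zs₁ ++ zs₂ × xs ≡ map f zs₁ × ys ≡ map f zs₂)
map-split f []       zs       eq = [] , zs , refl , refl , eq
map-split f (x ∷ xs) (z ∷ zs) eq with refl , eq′ ← ∷-injective eq
  with zs₁ , zs₂ , refl , refl , refl ← map-split f xs zs eq′ = z ∷ zs₁ , zs₂ , refl , refl , refl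

tabulate≡map⁻ : {A B : Set} (f : A → B) {n : ℕ} (h : Fin n → B) (zs : List A) → tabulate h ≡ map f zs →
  ∃[ g ] (zs ≡ tabulate g × (∀ i → h i ≡ f (g i)))
tabulate≡map⁻ f {zero}  h []       eq = (λ ()) , refl , λ ()
tabulate≡map⁻ f {suc n} h (z ∷ zs) eq with h₀ , eq′ ← ∷-injective eq
  with g , refl , hg ← tabulate≡map⁻ f (h ∘ suc) zs eq′ =
  (λ { zero → z ; (suc i) → g i }) , refl , λ { zero → h₀ ; (suc i) → hg i }

∈-irrelevant : ∀ {n} {p : Subset n} {x} (x∈ x∈′ : x ∈ p) → x∈ ≡ x∈′
∈-irrelevant Vec.here      Vec.here       = refl
∈-irrelevant (Vec.there p) (Vec.there q) = cong Vec.there (∈-irrelevant p q)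

module _ {c : ℕ} (K : ColoredGraph c) where

  VertexOf-≡ : {u v : VertexOf K} → proj₁ u ≡ proj₁ v → u ≡ v
  VertexOf-≡ {u , u∈} {_ , v∈} refl = cong (u ,_) (∈-irrelevant u∈ v∈)

  private
    G = ambient K

    Dj = D (coloring K)

  colorDegree : Fin c → V G → ℕ
  colorDegree j v = ∣ Dj j ∩ incidentEdges G v ∣

  lookup-coloredDegree : ∀ v j → Vec.lookup (coloredDegree K v) j ≡ colorDegree j v
  lookup-coloredDegree v = lookup∘tabulate _

  ∈-incident⁺ : ∀ {j e v} → e ∈ Dj j → Incident G v e → e ∈ Dj j ∩ incidentEdges G v
  ∈-incident⁺ {v = v} e∈ inc = x∈p∩q⁺ (e∈ , ∈⟦⟧⁺ (incident? G v) inc)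

  ∈-incident⁻ : ∀ {j e v} → e ∈ Dj j ∩ incidentEdges G v → e ∈ Dj j × Incident G v e
  ∈-incident⁻ {v = v} e∈ = let e∈D , e∈v = x∈p∩q⁻ _ _ e∈ in e∈D , ∈⟦⟧⁻ (incident? G v) e∈v

  nbr⇒∈ : ∀ {j u v} → (a : ColorAdjacent K j u v) → proj₁ a ∈ Dj j ∩ incidentEdges G u
  nbr⇒∈ (e , e∈ , j₀) = ∈-incident⁺ e∈ (Joins⇒Incidentˡ {G} {e} j₀)

  ∈⇒nbr : ∀ {j e u} → e ∈ Dj j ∩ incidentEdges G u → ∃[ v ] (e ∈ Dj j × Joins G e u v)
  ∈⇒nbr {e = e} e∈ =
    let e∈D , inc = ∈-incident⁻ e∈
        v , j₀ = Incident⇒Joins {G} {e} inc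
    in v , e∈D , j₀

  ColorAdjacent-sym : ∀ {j u v} → ColorAdjacent K j u v → ColorAdjacent K j v u
  ColorAdjacent-sym (e , e∈ , j₀) = e , e∈ , Joins-sym {G} {e} j₀

  ColorAdjacent⇒∈U : ∀ {j u v} → ColorAdjacent K j u v → v ∈ U K
  ColorAdjacent⇒∈U (e , e∈ , j₀) = closed K e∈ (Joins⇒Incidentʳ {G} {e} j₀)

  nbr⇒≥1 : ∀ {j u v} → ColorAdjacent K j u v → 1 ≤ colorDegree j u
  nbr⇒≥1 a = ∣∣≥1 _ (nbr⇒∈ a)

  ≥1⇒nbr : ∀ {j u} → 1 ≤ colorDegree j u → ∃[ v ] ColorAdjacent K j u v
  ≥1⇒nbr ≥1 = let e , e∈ = ∣∣≥1⁻ _ ≥1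
                  v , e∈D , j₀ = ∈⇒nbr e∈
              in v , e , e∈D , j₀

  ≤1⇒nbr-unique : ∀ {j u v w} → colorDegree j u ≤ 1 → ColorAdjacent K j u v → ColorAdjacent K j u w → v ≡ w
  ≤1⇒nbr-unique ≤1 a@(e , _ , j₀) b@(f , _ , j₁) with refl ← ∣∣≤1 _ ≤1 (nbr⇒∈ a) (nbr⇒∈ b) =
    Joins-functional {G} {e} j₀ j₁

  ≡2⇒nbrs : ∀ {j u} → colorDegree j u ≡ 2 → ∃[ x ] ∃[ y ] (x ≢ y × ColorAdjacent K j u x ×
    ColorAdjacent K j u y × (∀ v → ColorAdjacent K j u v → v ≡ x ⊎ v ≡ y))
  ≡2⇒nbrs {j} {u} two
    with e , f , e≢f , e∈ , f∈ , cover ← ∣∣≡2 _ two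
    with x , e∈D , ux ← ∈⇒nbr e∈ | y , f∈D , uy ← ∈⇒nbr f∈ =
    x , y , (λ { refl → e≢f (Joins-unique {G} {e} {f} ux uy) }) , (e , e∈D , ux) , (f , f∈D , uy) , cover′
    where
    cover′ : ∀ v → ColorAdjacent K j u v → v ≡ x ⊎ v ≡ y
    cover′ v a@(g , _ , j₀) with cover g (nbr⇒∈ a)
    ... | inj₁ refl = inj₁ (Joins-functional {G} {g} j₀ ux)
    ... | inj₂ refl = inj₂ (Joins-functional {G} {g} j₀ uy)

module _ (H : Graph) {c : ℕ} (col : E H → Fin c) where

  private
    Hᶜ = colorize H col

  DS-colorize : DS Hᶜ ≡ tabulate (coloredDegree Hᶜ)
  DS-colorize = trans
    (cong (map (coloredDegree Hᶜ)) (filter-all (_∈? ⊤) {xs = allFin _} (All.tabulate λ _ → ∈⊤)))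
    (map-tabulate _ _)

  ∈D-colorize⁺ : ∀ {j e} → col e ≡ j → e ∈ D (coloring Hᶜ) j
  ∈D-colorize⁺ {j} = ∈⟦⟧⁺ (λ e → col e ≟ j)

  ∈D-colorize⁻ : ∀ {j e} → e ∈ D (coloring Hᶜ) j → col e ≡ j
  ∈D-colorize⁻ {j} = ∈⟦⟧⁻ (λ e → col e ≟ j)

  module _ (col-inj : Injective _≡_ _≡_ col) where

    colorDegree-colorize-≤1 : ∀ j a → colorDegree Hᶜ j a ≤ 1
    colorDegree-colorize-≤1 j a = ∣∣-injection {N = 1} _ (λ _ → zero) λ e∈ f∈ _ →
      col-inj (trans (∈D-colorize⁻ (proj₁ (∈-incident⁻ Hᶜ e∈)))
        (sym (∈D-colorize⁻ (proj₁ (∈-incident⁻ Hᶜ f∈)))))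

    coloredDegree-≤1 : ∀ a j → Vec.lookup (coloredDegree Hᶜ a) j ≤ 1
    coloredDegree-≤1 a j rewrite lookup-coloredDegree Hᶜ a j = colorDegree-colorize-≤1 j a

    profile-∌Δ : All (¬_ ∘ _∈Δ) (DS Hᶜ)
    profile-∌Δ rewrite DS-colorize = All.tabulate⁺ λ a → ∈Δ-≰1 (coloredDegree-≤1 a)

-- A graph satisfying the condition is a subdivision

module FromProfile (H : Graph) {c : ℕ} (col : E H → Fin c) (col-inj : Injective _≡_ _≡_ col)
  (col-surj : ∀ j → ∃[ e ] col e ≡ j) (K : ColoredGraph c) (K⊨ : K ⊨𝒞* DS (colorize H col)) where

  private
    Hᶜ = colorize H col
    G = ambient K
    open _⊨𝒞*_ K⊨

    vertices : List (V G)
    vertices = filter (_∈? U K) (allFin _)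

  record Typing : Set where
    field
      k        : ℕ
      g₁       : Fin k → V G
      g₂       : V H → V G
      arranged : vertices ↭ tabulate g₁ ++ tabulate g₂
      g₁-Δ     : ∀ s → coloredDegree K (g₁ s) ∈Δ
      g₂-M     : ∀ a → coloredDegree Hᶜ a ≡ coloredDegree K (g₂ a)

  typing : Typing
  typing
    with ds , allΔ , DS↭ ← degrees
    -- A permutation of the degree list lifts to one of the vertices, which assigns an actual vertex
    -- to each vertex of `H`. The part `ds` is moved to the front to match `Vertex`, which is
    -- `Fin k ⊎ V H`.
    with zs , eq , vs↭zs ← ↭-map-inv (coloredDegree K) {xs = vertices} (↭-trans DS↭ (++-comm (DS Hᶜ) ds))
    with zs₁ , zs₂ , refl , refl , eq₂ ← map-split (coloredDegree K) ds zs eq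
    with g , refl , hg ← tabulate≡map⁻ (coloredDegree K) _ zs₂ (trans (sym (DS-colorize H col)) eq₂) = record
    { k        = length zs₁
    ; g₁       = lookup zs₁
    ; g₂       = g
    ; arranged = subst (λ xs → vertices ↭ xs ++ tabulate g) (sym (tabulate-lookup zs₁)) vs↭zs
    ; g₁-Δ     = All.tabulate⁻ (subst (All _) (sym (tabulate-lookup zs₁)) (All.map⁻ allΔ))
    ; g₂-M     = hg
    }

  module Typed (T : Typing) where

    open Typing T

    g : Vertex H col k → V G
    g = [ g₁ , g₂ ]′

    g-injective : ∀ {u v} → g u ≡ g v → u ≡ v
    g-injective {u} {v} = Unique-tabulate-++⁻ g₁ g₂
      (Permₛ.Unique-resp-↭ (setoid _) (↭⇒↭ₛ arranged) (Unique.filter⁺ (_∈? U K) (Unique.allFin⁺ _))) {u} {v}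

    g-∈U : ∀ u → g u ∈ U K
    g-∈U u = proj₂ (∈-filter⁻ (_∈? U K) {xs = allFin _} (∈-resp-↭ (↭-sym arranged) (g-∈ u)))
      where
      g-∈ : ∀ u → g u ∈ˡ tabulate g₁ ++ tabulate g₂
      g-∈ (inj₁ s) = ∈-++⁺ˡ (∈-tabulate⁺ s)
      g-∈ (inj₂ a) = ∈-++⁺ʳ (tabulate g₁) (∈-tabulate⁺ a)

    g-surjective : ∀ {v} → v ∈ U K → ∃[ u ] g u ≡ v
    g-surjective {v} v∈ with ∈-++⁻ (tabulate g₁) (∈-resp-↭ arranged (∈-filter⁺ (_∈? U K) (∈-allFin v) v∈))
    ... | inj₁ v∈₁ = let s , eq = ∈-tabulate⁻ v∈₁ in inj₁ s , sym eq
    ... | inj₂ v∈₂ = let a , eq = ∈-tabulate⁻ v∈₂ in inj₂ a , sym eq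

    adj : Fin c → Rel (Vertex H col k) 0ℓ
    adj j u v = ColorAdjacent K j (g u) (g v)

    t : Fin k → Fin c
    t s = proj₁ (∈Δ⇒lookup (g₁-Δ s))

    inner-degree : ∀ s → colorDegree K (t s) (g₁ s) ≡ 2
    inner-degree s =
      trans (sym (lookup-coloredDegree K (g₁ s) (t s))) (proj₁ (proj₂ (∈Δ⇒lookup (g₁-Δ s))))

    branch-degree : ∀ a j → colorDegree Hᶜ j a ≡ colorDegree K j (g₂ a)
    branch-degree a j = trans (sym (lookup-coloredDegree Hᶜ a j))
      (trans (cong (λ d → Vec.lookup d j) (g₂-M a)) (lookup-coloredDegree K (g₂ a) j))

    nbr-lift : ∀ {j u w} → ColorAdjacent K j (g u) w → ∃[ v ] (g v ≡ w × adj j u v)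
    nbr-lift {j} {u} uw = let v , eq = g-surjective (ColorAdjacent⇒∈U K uw)
                          in v , eq , subst (ColorAdjacent K j (g u)) (sym eq) uw

    -- The walk is lifted edge by edge: the end of a colored edge lies in `U K`, all of which is in
    -- the image of `g`.
    walk-lift : ∀ {j u v w} → Star (ColorAdjacent K j) (g u) w → w ≡ g v → Star (adj j) u v
    walk-lift {j} {u} {v} ε eq = subst (Star (adj j) u) (g-injective {u} {v} eq) ε
    walk-lift {j} {u} {v} (a ◅ w) eq with x , refl , ux ← nbr-lift {u = u} a =
      _◅_ {j = x} ux (walk-lift {u = x} {v} w eq)

    like : SubdivisionLike H col t adj
    like = record
      { symmetric  = ColorAdjacent-sym K
      ; loopless   = λ { (e , _ , j₀) → Joins⇒≢ {G} {e} j₀ refl }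
      ; branch-col = λ {j} {a} av →
          let e , e∈ = ∣∣≥1⁻ _ (subst (1 ≤_) (sym (branch-degree a j)) (nbr⇒≥1 K av))
              e∈D , inc = ∈-incident⁻ Hᶜ e∈
          in e , ∈D-colorize⁻ H col e∈D , inc
      ; branch-≤1  = λ {j} {a} {v} {w} av aw → g-injective {v} {w} (≤1⇒nbr-unique K
          (subst (_≤ 1) (branch-degree a j) (colorDegree-colorize-≤1 H col col-inj j a)) av aw)
      ; branch-≥1  = λ {a} e inc →
          let w , aw = ≥1⇒nbr K (subst (1 ≤_) (branch-degree a (col e))
                         (∣∣≥1 _ (∈-incident⁺ Hᶜ (∈D-colorize⁺ H col refl) inc)))
              v , _ , av = nbr-lift {u = inj₂ a} aw
          in v , av
      ; inner-col  = λ {_} {s} {v} → inner-col {s = s} {v}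
      ; inner-nbrs = inner-nbrs
      ; linked     = λ {_} {u} {_} {v} uu′ vv′ → walk-lift {u = u} {v} (connected _ _ _ (_ , nbr⇒∈ K uu′) (_ , nbr⇒∈ K vv′)) refl
      }
      where
      inner-col : ∀ {j s v} → adj j (inj₁ s) v → j ≡ t s
      inner-col {j} {s} sv with j ≟ t s
      ... | yes eq = eq
      ... | no neq with () ← subst (1 ≤_) (trans (sym (lookup-coloredDegree K (g₁ s) j))
        (proj₂ (proj₂ (∈Δ⇒lookup (g₁-Δ s))) j neq)) (nbr⇒≥1 K sv)

      inner-nbrs : ∀ s → ∃[ x ] ∃[ y ] (x ≢ y × adj (t s) (inj₁ s) x × adj (t s) (inj₁ s) y ×
        (∀ v → adj (t s) (inj₁ s) v → v ≡ x ⊎ v ≡ y))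
      inner-nbrs s
        with _ , _ , x≢y , sx , sy , cover ← ≡2⇒nbrs K (inner-degree s)
        with x , refl , sx′ ← nbr-lift {u = inj₁ s} sx | y , refl , sy′ ← nbr-lift {u = inj₁ s} sy =
        x , y , (λ x≡y → x≢y (cong g x≡y)) , sx′ , sy′ ,
        λ v sv → [ inj₁ ∘ g-injective , inj₂ ∘ g-injective ]′ (cover (g v) sv)

    underlying-iso : Isomorphic (UnderlyingAdjacent K) (λ u v → ∃[ j ] adj j u v)
    underlying-iso = mk↔ₛ′ (λ (_ , v∈) → proj₁ (g-surjective v∈)) (λ u → g u , g-∈U u)
        (λ u → g-injective (proj₂ (g-surjective (g-∈U u))))
        (λ (_ , v∈) → VertexOf-≡ K (proj₂ (g-surjective v∈)))
      , λ (_ , u∈) (_ , v∈) → mk⇔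
          (λ (j , uv) → j , subst₂ (ColorAdjacent K j)
            (sym (proj₂ (g-surjective u∈))) (sym (proj₂ (g-surjective v∈))) uv)
          (λ (j , uv) → j , subst₂ (ColorAdjacent K j)
            (proj₂ (g-surjective u∈)) (proj₂ (g-surjective v∈)) uv)

  profile⇒𝒮 : ∀ F → IsColorizationOf K F → 𝒮 H F
  profile⇒𝒮 F colorization =
    let open Typed typing
        F′ , sub , iso = SubdivisionLike⇒Subdivision H col col-inj col-surj like
    in F′ , sub , Isomorphic-trans {S = UnderlyingAdjacent K} {T = Adjacent F′}
         (Isomorphic-sym {S = Adjacent F} colorization)
         (Isomorphic-trans {T = Adjacent F′} underlying-iso iso)

-- A subdivision satisfies the condition

⟦⟧-∩ : ∀ {n} {P Q : Pred (Fin n) 0ℓ} (P? : Decidable P) (Q? : Decidable Q) →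
  ⟦ P? ⟧ ∩ ⟦ Q? ⟧ ≡ ⟦ (λ x → P? x ×-dec Q? x) ⟧
⟦⟧-∩ P? Q? = subset-ext
  (λ x x∈ → let p , q = x∈p∩q⁻ _ _ x∈ in ∈⟦⟧⁺ (λ x → P? x ×-dec Q? x) (∈⟦⟧⁻ P? p , ∈⟦⟧⁻ Q? q))
  (λ x x∈ → let p , q = ∈⟦⟧⁻ (λ x → P? x ×-dec Q? x) x∈ in x∈p∩q⁺ (∈⟦⟧⁺ P? p , ∈⟦⟧⁺ Q? q))

#-extract : ∀ {n} {P : Pred (Fin n) 0ℓ} (P? : Decidable P) {e} → P e →
  # P? ≡ suc (# (λ x → P? x ×-dec ¬? (x ≟ e)))
#-extract P? {e} pe = trans (#-split P? (_≟ e)) (cong (_+ # (λ x → P? x ×-dec ¬? (x ≟ e))) (ℕ.≤-antisym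
  (#≤1 (λ x → P? x ×-dec (x ≟ e)) (λ _ _ (_ , p) (_ , q) → trans p (sym q)))
  (#≥1 (λ x → P? x ×-dec (x ≟ e)) (pe , refl))))

colorDegree-colorize : ∀ (G : Graph) {c} (col : E G → Fin c) j v →
  colorDegree (colorize G col) j v ≡ # (λ e → (col e ≟ j) ×-dec incident? G v e)
colorDegree-colorize G col j v = cong ∣_∣ (⟦⟧-∩ (λ e → col e ≟ j) (incident? G v))

module Subdivide (G : Graph) (e : E G) {c : ℕ} (col : E G → Fin c) where

  private
    G′ = subdivide G e
    K = colorize G col

  col′ : E G′ → Fin c
  col′ zero    = col e
  col′ (suc f) = col f

  private
    K′ = colorize G′ col′

  incident-old⁺ : ∀ {f v} → f ≢ e → Incident G v f → Incident G′ (suc v) (suc f)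
  incident-old⁺ {f} {v} f≢e inc with f ≟ e
  ... | yes f≡e = contradiction f≡e f≢e
  incident-old⁺ f≢e (inj₁ refl) | no _ = inj₁ refl
  incident-old⁺ f≢e (inj₂ refl) | no _ = inj₂ refl

  incident-old⁻ : ∀ {f v} → Incident G′ (suc v) (suc f) → Incident G v f
  incident-old⁻ {f} inc with f ≟ e
  incident-old⁻ (inj₁ ())  | yes _
  incident-old⁻ (inj₂ eq)  | yes refl = inj₁ (Fin.suc-injective eq)
  incident-old⁻ (inj₁ eq)  | no _ = inj₁ (Fin.suc-injective eq)
  incident-old⁻ (inj₂ eq)  | no _ = inj₂ (Fin.suc-injective eq)

  incident-split⁻ : ∀ {v} → Incident G′ (suc v) (suc e) → proj₁ (ends G e) ≡ v
  incident-split⁻ inc rewrite ends-new G e with inc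
  ... | inj₁ ()
  ... | inj₂ eq = Fin.suc-injective eq

  incident-zero⁻ : ∀ {v} → Incident G′ (suc v) zero → proj₂ (ends G e) ≡ v
  incident-zero⁻ (inj₁ ())
  incident-zero⁻ (inj₂ eq) = Fin.suc-injective eq

  incident-new⁻ : ∀ {f} → Incident G′ zero (suc f) → f ≡ e
  incident-new⁻ {f} inc with f ≟ e
  ... | yes eq = eq
  incident-new⁻ (inj₁ ()) | no _
  incident-new⁻ (inj₂ ()) | no _

  incident-new⁺ : Incident G′ zero (suc e)
  incident-new⁺ = inj₁ (cong proj₁ (ends-new G e))

  -- Each end of `e` keeps one half of the subdivided edge, in the same color. The half at
  -- `proj₁ (ends G e)` reuses the index of `e`, so only at `proj₂ (ends G e)` is `e` traded for the
  -- new index `zero`.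
  colorDegree-old : ∀ j v → colorDegree K′ j (suc v) ≡ colorDegree K j v
  colorDegree-old j v = trans (colorDegree-colorize G′ col′ j (suc v))
    (trans (counts (col e ≟ j) (proj₂ (ends G e) ≟ v)) (sym (colorDegree-colorize G col j v)))
    where
    old? : Decidable (λ f → col f ≡ j × Incident G v f)
    old? f = (col f ≟ j) ×-dec incident? G v f
    new? : Decidable (λ f → col′ f ≡ j × Incident G′ (suc v) f)
    new? f = (col′ f ≟ j) ×-dec incident? G′ (suc v) f
    counts : Dec (col e ≡ j) → Dec (proj₂ (ends G e) ≡ v) → # new? ≡ # old?
    counts (yes ej) (yes refl) = trans (#-suc-yes new? (ej , inj₂ refl))
      (trans (cong suc (#-cong (new? ∘ suc) (λ f → old? f ×-dec ¬? (f ≟ e))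
        (λ f (fj , inc) → (fj , incident-old⁻ inc) ,
          λ { refl → u≢v G e (incident-split⁻ inc) })
        (λ f ((fj , inc) , f≢e) → fj , incident-old⁺ f≢e inc)))
      (sym (#-extract old? (ej , inj₂ refl))))
    counts (yes ej) (no v≢) = trans (#-suc-no new? (λ (_ , inc) → v≢ (incident-zero⁻ inc)))
      (#-cong (new? ∘ suc) old? (λ f (fj , inc) → fj , incident-old⁻ inc) keep)
      where
      keep : ∀ f → col f ≡ j × Incident G v f → col f ≡ j × Incident G′ (suc v) (suc f)
      keep f (fj , inc) with f ≟ e in eq
      keep f (fj , inj₁ refl) | yes refl = fj , inj₂ refl
      keep f (fj , inj₂ p)    | yes refl = contradiction p v≢
      keep f (fj , inj₁ refl) | no _ = fj , inj₁ refl
      keep f (fj , inj₂ refl) | no _ = fj , inj₂ refl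
    counts (no e≢j) _ = trans (#-suc-no new? (λ (ej , _) → e≢j ej))
      (#-cong (new? ∘ suc) old? (λ f (fj , inc) → fj , incident-old⁻ inc)
        (λ f (fj , inc) → fj , incident-old⁺ (λ { refl → e≢j fj }) inc))

  colorDegree-new : colorDegree K′ (col e) zero ≡ 2
  colorDegree-new = trans (colorDegree-colorize G′ col′ (col e) zero)
    (trans (#-suc-yes new? (refl , inj₁ refl)) (cong suc (ℕ.≤-antisym
      (#≤1 (new? ∘ suc) λ _ _ (_ , p) (_ , q) → trans (incident-new⁻ p) (sym (incident-new⁻ q)))
      (#≥1 (new? ∘ suc) (refl , incident-new⁺)))))
    where
    new? : Decidable (λ f → col′ f ≡ col e × Incident G′ zero f)
    new? f = (col′ f ≟ col e) ×-dec incident? G′ zero f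

  new-edges : ∀ {f} → Incident G′ zero f → col′ f ≡ col e
  new-edges {zero}  _   = refl
  new-edges {suc f} inc = cong col (incident-new⁻ inc)

  new-∈Δ : coloredDegree K′ zero ∈Δ
  new-∈Δ = lookup⇒∈Δ (col e) (trans (lookup-coloredDegree K′ zero (col e)) colorDegree-new)
    λ j j≢ → trans (lookup-coloredDegree K′ zero j) (trans (colorDegree-colorize G′ col′ j zero)
      (#≡0 (λ f → (col′ f ≟ j) ×-dec incident? G′ zero f)
        λ f (fj , inc) → j≢ (trans (sym fj) (new-edges {f} inc))))

  old-degrees : ∀ v → coloredDegree K′ (suc v) ≡ coloredDegree K v
  old-degrees v = vec-ext λ j → trans (lookup-coloredDegree K′ (suc v) j)
    (trans (colorDegree-old j v) (sym (lookup-coloredDegree K v j)))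

  to-new : ∀ {w} → Incident G w e → ColorAdjacent K′ (col e) zero (suc w)
  to-new inc with subdivide-new⁺ G e inc
  ... | inj₁ j₀ = zero , ∈D-colorize⁺ G′ col′ refl , j₀
  ... | inj₂ j₀ = suc e , ∈D-colorize⁺ G′ col′ refl , j₀

  walk : ∀ {j u v} → Star (ColorAdjacent K j) u v → Star (ColorAdjacent K′ j) (suc u) (suc v)
  walk = kleisliStar suc edge
    where
    edge : ∀ {j u v} → ColorAdjacent K j u v → Star (ColorAdjacent K′ j) (suc u) (suc v)
    edge (f , f∈ , j₀) with refl ← ∈D-colorize⁻ G col f∈ with f ≟ e
    ... | no f≢e   = (suc f , ∈D-colorize⁺ G′ col′ refl , subdivide-old⁺ G e f≢e j₀) ◅ ε
    ... | yes refl = ColorAdjacent-sym K′ (to-new (Joins⇒Incidentˡ {G} {e} j₀)) ◅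
                     to-new (Joins⇒Incidentʳ {G} {e} j₀) ◅ ε

  Touched : Fin c → V G → Set
  Touched j u = Nonempty (D (coloring K) j ∩ incidentEdges G u)

  -- Walks can be transferred only between old vertices. The new vertex is therefore first moved
  -- along one of its two edges to an end of `e`.
  reach-old : ∀ {j} u → Nonempty (D (coloring K′) j ∩ incidentEdges G′ u) →
    ∃[ v ] (Touched j v × Star (ColorAdjacent K′ j) u (suc v))
  reach-old {j} u (f , f∈) with f∈D , inc ← ∈-incident⁻ K′ f∈ with refl ← ∈D-colorize⁻ G′ col′ f∈D = at u f inc
    where
    touch : ∀ {f v} → Incident G v f → Touched (col f) v
    touch {f} inc = f , ∈-incident⁺ K (∈D-colorize⁺ G col refl) inc
    at : ∀ u f → Incident G′ u f → ∃[ v ] (Touched (col′ f) v × Star (ColorAdjacent K′ (col′ f)) u (suc v))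
    at zero    f       inc rewrite new-edges {f} inc = _ , touch (inj₁ refl) , to-new (inj₁ refl) ◅ ε
    at (suc u) zero    inc = u , touch (inj₂ (incident-zero⁻ inc)) , ε
    at (suc u) (suc f) inc = u , touch (incident-old⁻ inc) , ε

  subdivide-⊨ : ∀ {M} → K ⊨𝒞* M → K′ ⊨𝒞* M
  subdivide-⊨ {M} K⊨ = record
    { degrees   = let ds , allΔ , DS↭ = degrees in
        coloredDegree K′ zero ∷ ds , new-∈Δ ∷ allΔ , ↭-trans
          (↭-reflexive (trans (DS-colorize G′ col′)
            (cong (coloredDegree K′ zero ∷_) (trans (tabulate-cong old-degrees) (sym (DS-colorize G col))))))
          (↭-trans (prep (coloredDegree K′ zero) DS↭) (↭-sym (shift _ M ds)))
    ; connected = λ j u v tu tv →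
        let u₀ , tu₀ , uu₀ = reach-old u tu
            v₀ , tv₀ , vv₀ = reach-old v tv
        in uu₀ ◅◅ walk (connected j u₀ v₀ tu₀ tv₀) ◅◅ reverse (ColorAdjacent-sym K′) vv₀
    }
    where open _⊨𝒞*_ K⊨

-- Each color class has at most one edge, so two distinct vertices that it touches are the ends of
-- that edge.
colorize-⊨ : ∀ (H : Graph) {c} (col : E H → Fin c) → Injective _≡_ _≡_ col →
  colorize H col ⊨𝒞* DS (colorize H col)
colorize-⊨ H col col-inj = record
  { degrees   = [] , [] , ↭-reflexive (sym (++-identityʳ _))
  ; connected = λ j u v (e , e∈) (f , f∈) → walk u v (∈-incident⁻ Hᶜ e∈) (∈-incident⁻ Hᶜ f∈)
  }
  where
  Hᶜ = colorize H col
  walk : ∀ {j e f} u v → e ∈ D (coloring Hᶜ) j × Incident H u e → f ∈ D (coloring Hᶜ) j × Incident H v f →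
    Star (ColorAdjacent Hᶜ j) u v
  walk {e = e} u v (e∈ , inc) (f∈ , inc′)
    with refl ← col-inj (trans (∈D-colorize⁻ H col e∈) (sym (∈D-colorize⁻ H col f∈))) with u ≟ v
  ... | yes refl = ε
  ... | no u≢v   = (e , e∈ , Incident²⇒Joins {H} {e} inc inc′ u≢v) ◅ ε

colorize-colorization : ∀ (G : Graph) {c} (col : E G → Fin c) → IsColorizationOf (colorize G col) G
colorize-colorization G col = mk↔ₛ′ proj₁ (λ v → v , ∈⊤) (λ _ → refl) (λ _ → VertexOf-≡ (colorize G col) refl)
  , λ _ _ → mk⇔ (λ (_ , e , _ , j₀) → e , j₀) (λ (e , j₀) → col e , e , ∈D-colorize⁺ G col refl , j₀)

Subdivision⇒coloring : ∀ {H F} {c} (col : E H → Fin c) → Injective _≡_ _≡_ col → Subdivision H F →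
  Σ[ col′ ∈ (E F → Fin c) ] colorize F col′ ⊨𝒞* DS (colorize H col)
Subdivision⇒coloring col col-inj none = col , colorize-⊨ _ col col-inj
Subdivision⇒coloring col col-inj (step {F} sub e) =
  let col₀ , F⊨ = Subdivision⇒coloring col col-inj sub
      open Subdivide F e col₀
  in col′ , subdivide-⊨ F⊨

isExtendedProfile : ∀ (H : Graph) {c} (col : E H → Fin c) → Injective _≡_ _≡_ col →
  (∀ j → ∃[ e ] col e ≡ j) → IsExtendedProfile (DS (colorize H col)) (𝒮 H)
isExtendedProfile H {c} col col-inj col-surj F = mk⇔ to
  λ (K , colorization , K⊨) → FromProfile.profile⇒𝒮 H col col-inj col-surj K K⊨ F colorization
  where
  to : 𝒮 H F → Σ[ K ∈ ColoredGraph c ] (IsColorizationOf K F × K ⊨𝒞* DS (colorize H col))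
  to (F′ , sub , F≅F′) =
    let col′ , F′⊨ = Subdivision⇒coloring col col-inj sub
    in colorize F′ col′ , Isomorphic-trans {T = Adjacent F} (colorize-colorization F′ col′)
         (Isomorphic-sym {S = Adjacent F′} F≅F′) , F′⊨

-- Decision diagrams from prefix signatures

module _ {c m : ℕ} where

  -- Colorings are functions, so a predicate has to respect pointwise equality before a search over
  -- the numbered functions `finToFun k` can decide it.
  Extensional : Pred (Fin m → Fin (suc c)) 0ℓ → Set
  Extensional P = ∀ {x y} → (∀ e → x e ≡ y e) → P x → P y

  any-coloring? : {P : Pred (Fin m → Fin (suc c)) 0ℓ} → Decidable P → Extensional P → Dec (∃ P)
  any-coloring? P? ext = Dec.map′ (λ (k , p) → finToFun k , p)
    (λ (x , p) → funToFin x , ext (λ e → sym (finToFun-funToFin x e)) p)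
    (any? (P? ∘ finToFun))

  splice : ℕ → (Fin m → Fin (suc c)) → (Fin m → Fin (suc c)) → Fin m → Fin (suc c)
  splice i x y e with toℕ e <? i
  ... | yes _ = x e
  ... | no _  = y e

  splice-< : ∀ i x y e → toℕ e < i → splice i x y e ≡ x e
  splice-< i x y e e<i with toℕ e <? i
  ... | yes _  = refl
  ... | no e≮i = contradiction e<i e≮i

  splice-≥ : ∀ i x y e → i ≤ toℕ e → splice i x y e ≡ y e
  splice-≥ i x y e i≤e with toℕ e <? i
  ... | yes e<i = contradiction e<i (ℕ.≤⇒≯ i≤e)
  ... | no _    = refl

  splice-suc : ∀ x y l → x l ≡ y l → ∀ e → splice (toℕ l) x y e ≡ splice (suc (toℕ l)) x y e
  splice-suc x y l eq e with toℕ e <? toℕ l | toℕ e <? suc (toℕ l)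
  ... | yes _   | yes _ = refl
  ... | no _    | no _  = refl
  ... | yes e<l | no e≮ = contradiction (ℕ.m<n⇒m<1+n e<l) e≮
  ... | no e≮l  | yes e< with refl ← toℕ-injective (ℕ.≤-antisym (ℕ.m<1+n⇒m≤n e<) (ℕ.≮⇒≥ e≮l)) = sym eq

  -- The value 0 stands for uncolored.
  Encodes : ColoredSubset c m → (Fin m → Fin (suc c)) → Set
  Encodes X x = ∀ j e → e ∈ D X j ⇔ x e ≡ suc j

  encode : ColoredSubset c m → Fin m → Fin (suc c)
  encode X e with any? (λ j → e ∈? D X j)
  ... | yes (j , _) = suc j
  ... | no _        = zero

  encode-encodes : ∀ X → Encodes X (encode X)
  encode-encodes X j e with any? (λ j → e ∈? D X j)
  ... | no e∉        = mk⇔ (λ e∈ → contradiction (j , e∈) e∉) λ ()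
  ... | yes (i , e∈) = mk⇔ same λ { refl → e∈ }
    where
    same : e ∈ D X j → suc i ≡ suc j
    same e∈j with i ≟ j
    ... | yes refl = refl
    ... | no i≢j   = contradiction (e , x∈p∩q⁺ (e∈ , e∈j)) (disjoint X i≢j)

-- An analogue of the Myhill–Nerode construction: a signature of prefixes that
-- determines the possible completions yields a diagram with at most N nodes
-- per level.
module Diagram (c m N : ℕ)
  (𝓕 : Pred (Fin m → Fin (suc c)) 0ℓ) (𝓕? : Decidable 𝓕) (𝓕-ext : Extensional 𝓕)
  (sig : ℕ → (Fin m → Fin (suc c)) → Fin N)
  (sig-local : ∀ i {x y} → (∀ e → toℕ e < i → x e ≡ y e) → sig i x ≡ sig i y)
  (exchange : ∀ i {x y} → 𝓕 x → 𝓕 y → sig i x ≡ sig i y → 𝓕 (splice i x y)) where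

  Coloring : Set
  Coloring = Fin m → Fin (suc c)

  Witness : Fin m → Fin N → Fin (suc c) → Coloring → Set
  Witness l σ j x = 𝓕 x × sig (toℕ l) x ≡ σ × x l ≡ j

  witness? : ∀ l σ j → Dec (∃ (Witness l σ j))
  witness? l σ j = any-coloring? (λ x → 𝓕? x ×-dec ((sig (toℕ l) x ≟ σ) ×-dec (x l ≟ j)))
    λ eq (𝓕x , s , xl) → 𝓕-ext eq 𝓕x , trans (sym (sig-local (toℕ l) λ e _ → eq e)) s , trans (sym (eq l)) xl

  -- The next signature is read off an arbitrary witness. Another witness may have a different
  -- signature there; `exchange` makes every choice good enough.
  next : Fin m → Fin N → Fin (suc c) → Maybe (Fin N)
  next l σ j with witness? l σ j
  ... | yes (x , _) = just (sig (suc (toℕ l)) x)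
  ... | no _        = nothing

  next≡just : ∀ l σ j {σ′} → next l σ j ≡ just σ′ → ∃[ x ] (Witness l σ j x × sig (suc (toℕ l)) x ≡ σ′)
  next≡just l σ j eq with witness? l σ j
  next≡just l σ j refl | yes (x , w) = x , w , refl

  next≡nothing : ∀ l σ j → next l σ j ≡ nothing → ∀ x → ¬ Witness l σ j x
  next≡nothing l σ j eq x w with witness? l σ j
  ... | no ¬w = ¬w (x , w)

  module Inhabited {x₀ : Coloring} (𝓕x₀ : 𝓕 x₀) (l₀ : Fin m) (l₀≡0 : toℕ l₀ ≡ 0) where

    -- Restricting the nodes to what the root reaches supplies the incoming arcs that `unique`
    -- demands of a DD.
    Reachable : ℕ → Fin N → Set
    Reachable zero    σ  = σ ≡ sig 0 x₀
    Reachable (suc i) σ′ = ∃[ l ] (toℕ l ≡ i × ∃[ σ ] ∃[ j ] (Reachable i σ × next l σ j ≡ just σ′))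

    reachable? : ∀ i σ → Dec (Reachable i σ)
    reachable? zero    σ  = σ ≟ sig 0 x₀
    reachable? (suc i) σ′ = any? λ l → (toℕ l ℕ.≟ i) ×-dec any? λ σ → any? λ j →
      reachable? i σ ×-dec Maybe.≡-dec _≟_ (next l σ j) (just σ′)

    level : Fin (m * N) → Fin m
    level k = proj₁ (remQuot N k)

    value : Fin (m * N) → Fin N
    value k = proj₂ (remQuot {m} N k)

    node? : Decidable (λ k → Reachable (toℕ (level k)) (value k))
    node? k = reachable? (toℕ (level k)) (value k)

    nodes : Subset (m * N)
    nodes = ⟦ node? ⟧

    label : Fin ∣ nodes ∣ → Fin m
    label α = level (enum nodes α)

    state : Fin ∣ nodes ∣ → Fin N
    state α = value (enum nodes α)

    reachable : ∀ α → Reachable (toℕ (label α)) (state α)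
    reachable α = ∈⟦⟧⁻ node? (enum-∈ nodes α)

    node-injective : ∀ {α β} → label α ≡ label β → state α ≡ state β → α ≡ β
    node-injective {α} {β} l≡ s≡ = enum-injective nodes
      (trans (sym (combine-remQuot {m} N (enum nodes α)))
        (trans (cong₂ combine l≡ s≡) (combine-remQuot {m} N (enum nodes β))))

    node : ∀ l σ → Reachable (toℕ l) σ → ∃[ α ] (label α ≡ l × state α ≡ σ)
    node l σ r =
      let α , eq = enum-surjective nodes (∈⟦⟧⁺ node? r′)
      in α , trans (cong level eq) (cong proj₁ (remQuot-combine l σ)) ,
         trans (cong value eq) (cong proj₂ (remQuot-combine l σ))
      where
      r′ : Reachable (toℕ (level (combine l σ))) (value (combine l σ))
      r′ = subst (λ (l′ , σ′) → Reachable (toℕ l′) σ′) (sym (remQuot-combine l σ)) r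

    -- The target of an arc comes with the reason for it, so that proofs can match on the three
    -- cases without unfolding `next`.
    data Arc (α : Fin ∣ nodes ∣) (j : Fin (suc c)) : Node ∣ nodes ∣ → Set where
      dead : next (label α) (state α) j ≡ nothing → Arc α j ⊥ₙ
      last : ∀ {σ} → next (label α) (state α) j ≡ just σ → ¬ suc (toℕ (label α)) < m → Arc α j ⊤ₙ
      live : ∀ {β} → next (label α) (state α) j ≡ just (state β) →
        toℕ (label β) ≡ suc (toℕ (label α)) → Arc α j (inner β)

    arc : ∀ α j → Σ[ ν ∈ Node ∣ nodes ∣ ] Arc α j ν
    arc α j with next (label α) (state α) j in eq
    ... | nothing = ⊥ₙ , dead eq
    ... | just σ with suc (toℕ (label α)) <? m
    ...   | no ≮m = ⊤ₙ , last eq ≮m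
    ...   | yes <m =
      let β , β-label , β-state = node (fromℕ< <m) σ (subst (λ i → Reachable i σ) (sym (toℕ-fromℕ< <m))
            (label α , refl , state α , j , reachable α , eq))
      in inner β , live (trans eq (cong just (sym β-state)))
           (trans (cong toℕ β-label) (toℕ-fromℕ< <m))

    root : ∃[ α ] (label α ≡ l₀ × state α ≡ sig 0 x₀)
    root = node l₀ (sig 0 x₀) (subst (λ i → Reachable i (sig 0 x₀)) (sym l₀≡0) refl)

    ρ : Fin ∣ nodes ∣
    ρ = proj₁ root

    ρ-label : toℕ (label ρ) ≡ 0
    ρ-label = trans (cong toℕ (proj₁ (proj₂ root))) l₀≡0

    arc-layered : ∀ {α j ν} → Arc α j ν → ∀ {β} → ν ≡ inner β → toℕ (label β) ≡ suc (toℕ (label α))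
    arc-layered (live _ lab) refl = lab

    arc-source : ∀ {α j ν} → Arc α j ν → ν ≢ inner ρ
    arc-source a eq with () ← trans (sym ρ-label) (arc-layered a eq)

    arc-deterministic : ∀ {α j ν} → Arc α j ν → ∀ {β} → next (label α) (state α) j ≡ just (state β) →
      toℕ (label β) ≡ suc (toℕ (label α)) → ν ≡ inner β
    arc-deterministic (dead eq) eq′ _ with () ← trans (sym eq) eq′
    arc-deterministic {α} (last _ ≮m) {β} _ lab = contradiction (subst (_< m) lab (toℕ<n (label β))) ≮m
    arc-deterministic (live eq lab) eq′ lab′ = cong inner (node-injective
      (toℕ-injective (trans lab (sym lab′))) (Maybe.just-injective (trans (sym eq) eq′)))

    unique : ∀ β → inner β ≢ inner ρ → ∃[ α ] ∃[ j ] proj₁ (arc α j) ≡ inner β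
    unique β β≢ρ = incoming (toℕ (label β)) refl (reachable β)
      where
      incoming : ∀ i → toℕ (label β) ≡ i → Reachable i (state β) → ∃[ α ] ∃[ j ] proj₁ (arc α j) ≡ inner β
      incoming zero lab s = contradiction
        (cong inner (node-injective (toℕ-injective (trans lab (sym ρ-label))) (trans s (sym (proj₂ (proj₂ root))))))
        β≢ρ
      incoming (suc i) lab (l , refl , σ , j , r , eq) with α , refl , refl ← node l σ r =
        α , j , arc-deterministic (proj₂ (arc α j)) eq lab

    Z : DD c m
    Z = record
      { size    = ∣ nodes ∣
      ; label   = label
      ; arc     = λ α j → proj₁ (arc α j)
      ; root    = inner ρ
      ; layered = λ α j → arc-layered (proj₂ (arc α j))
      ; source  = λ α j → arc-source (proj₂ (arc α j))
      ; unique  = unique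
      }

    width-Z : width Z ≤ N
    width-Z = max≤v⁺ z≤n (All.tabulate⁺ λ l → ∣∣-injection ⟦ (λ α → label α ≟ l) ⟧ state
      λ α∈ β∈ → node-injective
        (trans (∈⟦⟧⁻ (λ α → label α ≟ l) α∈) (sym (∈⟦⟧⁻ (λ α → label α ≟ l) β∈))))

    -- Only the levels from `i` on are constrained, so the values of `y` before `i` can be exchanged
    -- freely.
    record Follows (i : ℕ) (arcs : List (Fin ∣ nodes ∣ × Fin (suc c))) (y : Coloring) : Set where
      field
        used   : ∀ {β j} → (β , j) ∈ˡ arcs → i ≤ toℕ (label β) × y (label β) ≡ j
        covers : ∀ e → i ≤ toℕ e → ∃[ β ] (label β ≡ e × (β , y e) ∈ˡ arcs)

    follows-[] : ∀ {i y} → ¬ i < m → Follows i [] y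
    follows-[] i≮m = record
      { used   = λ ()
      ; covers = λ e i≤e → contradiction (ℕ.≤-<-trans i≤e (toℕ<n e)) i≮m
      }

    follows-∷ : ∀ {α arcs y} → Follows (suc (toℕ (label α))) arcs y →
      Follows (toℕ (label α)) ((α , y (label α)) ∷ arcs) y
    follows-∷ {α} {arcs} {y} f = record { used = used′ ; covers = covers′ }
      where
      open Follows f
      used′ : ∀ {β j} → (β , j) ∈ˡ (α , y (label α)) ∷ arcs → toℕ (label α) ≤ toℕ (label β) × y (label β) ≡ j
      used′ (here refl) = ℕ.≤-refl , refl
      used′ (there b∈)  = let i≤ , eq = used b∈ in ℕ.≤-trans (ℕ.n≤1+n _) i≤ , eq
      covers′ : ∀ e → toℕ (label α) ≤ toℕ e → ∃[ β ] (label β ≡ e × (β , y e) ∈ˡ (α , y (label α)) ∷ arcs)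
      covers′ e l≤e with label α ≟ e
      ... | yes refl = α , refl , here refl
      ... | no l≢e   =
        let β , lab , β∈ = covers e (ℕ.≤∧≢⇒< l≤e (l≢e ∘ toℕ-injective)) in β , lab , there β∈

    follows-cong : ∀ {i arcs y y′} → (∀ e → i ≤ toℕ e → y e ≡ y′ e) → Follows i arcs y → Follows i arcs y′
    follows-cong {arcs = arcs} eq f = record
      { used   = λ b∈ → let i≤ , y≡ = used b∈ in i≤ , trans (sym (eq _ i≤)) y≡
      ; covers = λ e i≤e → let β , lab , β∈ = covers e i≤e
                           in β , lab , subst (λ j → (β , j) ∈ˡ arcs) (eq e i≤e) β∈
      }
      where open Follows f

    Realizes : Fin ∣ nodes ∣ → List (Fin ∣ nodes ∣ × Fin (suc c)) → Coloring → Set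
    Realizes α arcs y = 𝓕 y × sig (toℕ (label α)) y ≡ state α × Follows (toℕ (label α)) arcs y

    mutual

      sound : ∀ {α} (p : Path⊤ Z (inner α)) → ∃ (Realizes α (usedArcs Z p))
      sound (via α j p) = sound-arc (proj₂ (arc α j)) p

      sound-arc : ∀ {α j ν} → Arc α j ν → (p : Path⊤ Z ν) → ∃ (Realizes α ((α , j) ∷ usedArcs Z p))
      sound-arc {α} {j} (last eq ≮m) end with next≡just (label α) (state α) j eq
      ... | x , (𝓕x , s , refl) , _ = x , 𝓕x , s , follows-∷ (follows-[] ≮m)
      sound-arc {α} {j} (live {β} eq lab) p
        with next≡just (label α) (state α) j eq | sound p
      -- The coloring x justifies the arc just taken, and y the rest of the path. Both have the
      -- state of β as signature at the cut behind this arc, so the splice is in `𝓕`.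
      ... | x , (𝓕x , s , refl) , s′ | y , 𝓕y , t , f =
        splice i x y ,
        exchange i 𝓕x 𝓕y (trans s′ (trans (sym t) (cong (λ k → sig k y) lab))) ,
        trans (sig-local (toℕ (label α)) λ e e< → splice-< i x y e (ℕ.m<n⇒m<1+n e<)) s ,
        subst (λ k → Follows (toℕ (label α)) ((α , k) ∷ usedArcs Z p) (splice i x y))
          (splice-< i x y (label α) ℕ.≤-refl)
          (follows-∷ (follows-cong (λ e i≤ → sym (splice-≥ i x y e i≤))
            (subst (λ k → Follows k (usedArcs Z p) y) lab f)))
        where i = suc (toℕ (label α))

    mutual

      -- The number `k` is fuel: it bounds the levels that remain, and each arc uses up one unit.
      complete : ∀ k α y → m ≤ k + toℕ (label α) → 𝓕 y → sig (toℕ (label α)) y ≡ state α →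
        Σ[ p ∈ Path⊤ Z (inner α) ] Follows (toℕ (label α)) (usedArcs Z p) y
      complete zero α y m≤ 𝓕y s = contradiction (toℕ<n (label α)) (ℕ.≤⇒≯ m≤)
      complete (suc k) α y m≤ 𝓕y s =
        let p , f = complete-arc k α y (ℕ.≤-trans m≤ (ℕ.≤-reflexive (sym (ℕ.+-suc k _)))) 𝓕y s
                      (proj₂ (arc α (y (label α))))
        in via α (y (label α)) p , follows-∷ f

      complete-arc : ∀ k α y → m ≤ k + suc (toℕ (label α)) → 𝓕 y → sig (toℕ (label α)) y ≡ state α →
        ∀ {ν} → Arc α (y (label α)) ν →
        Σ[ p ∈ Path⊤ Z ν ] Follows (suc (toℕ (label α))) (usedArcs Z p) y
      complete-arc k α y m≤ 𝓕y s (dead eq) =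
        contradiction (𝓕y , s , refl) (next≡nothing (label α) (state α) (y (label α)) eq y)
      complete-arc k α y m≤ 𝓕y s (last eq ≮m) = end , follows-[] ≮m
      -- The witness x behind the arc may differ from y in its signature at the next level. The
      -- recursion therefore continues with x before the next cut and y after it: this coloring has
      -- the state of β as signature, and the rest of the path sees only its part after the cut.
      complete-arc k α y m≤ 𝓕y s (live {β} eq lab)
        with x , (𝓕x , t , xl) , t′ ← next≡just (label α) (state α) (y (label α)) eq
        with p , f ← complete k β (splice (suc (toℕ (label α))) x y)
          (subst (λ i → m ≤ k + i) (sym lab) m≤)
          (𝓕-ext (splice-suc x y (label α) xl) (exchange (toℕ (label α)) 𝓕x 𝓕y (trans t (sym s))))
          (trans (cong (λ i → sig i _) lab)
            (trans (sig-local _ λ e e< → splice-< _ x y e e<) t′)) =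
        p , follows-cong (λ e i≤ → splice-≥ _ x y e i≤) (subst (λ i → Follows i (usedArcs Z p) _) lab f)

    follows⇒represents : ∀ {p y} {X : ColoredSubset c m} → Follows (toℕ (label ρ)) (usedArcs Z p) y →
      Encodes X y → PathRepresents Z p X
    follows⇒represents {y = y} {X} f enc j e = mk⇔
      (λ e∈ → let β , lab , β∈ = covers e (subst (_≤ toℕ e) (sym ρ-label) z≤n)
              in β , lab , subst (λ k → (β , k) ∈ˡ _) (Equivalence.to (enc j e) e∈) β∈)
      (λ { (β , refl , β∈) → Equivalence.from (enc j e) (proj₂ (used β∈)) })
      where open Follows f

    represents⇒encodes : ∀ {p y} {X : ColoredSubset c m} → Follows (toℕ (label ρ)) (usedArcs Z p) y →
      PathRepresents Z p X → Encodes X y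
    represents⇒encodes {y = y} {X} f rep j e = mk⇔
      (λ e∈ → let β , lab , β∈ = Equivalence.to (rep j e) e∈ in trans (cong y (sym lab)) (proj₂ (used β∈)))
      (λ ye → let β , lab , β∈ = covers e (subst (_≤ toℕ e) (sym ρ-label) z≤n)
              in Equivalence.from (rep j e) (β , lab , subst (λ k → (β , k) ∈ˡ _) ye β∈))
      where open Follows f

  module _ (𝓖 : Pred (ColoredSubset c m) 0ℓ) (𝓖⇔𝓕 : ∀ X x → Encodes X x → 𝓖 X ⇔ 𝓕 x) where

    trivial : (ν : Node 0) → DD c m
    trivial ν = record
      { size = 0 ; label = λ () ; arc = λ () ; root = ν ; layered = λ () ; source = λ () ; unique = λ () }

    trivial-width : ∀ ν → width (trivial ν) ≤ N
    trivial-width ν = max≤v⁺ {xs = tabulate {n = m} λ _ → 0} z≤n (All.tabulate⁺ λ _ → z≤n)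

    nonempty-represents : ∀ {x₀} (𝓕x₀ : 𝓕 x₀) l₀ l₀≡0 → Represents (Inhabited.Z 𝓕x₀ l₀ l₀≡0) 𝓖
    nonempty-represents {x₀} 𝓕x₀ l₀ l₀≡0 X = mk⇔
      (λ 𝓖X →
        let 𝓕x = Equivalence.to (𝓖⇔𝓕 X (encode X) (encode-encodes X)) 𝓖X
            p , f = complete m ρ (encode X) (ℕ.m≤m+n m _) 𝓕x
              (trans (sig-local _ λ e e< → contradiction (subst (toℕ e <_) ρ-label e<) λ ())
                (trans (cong (λ i → sig i x₀) ρ-label) (sym (proj₂ (proj₂ root)))))
        in p , follows⇒represents {p} {X = X} f (encode-encodes X))
      (λ (p , rep) →
        let y , 𝓕y , _ , f = sound p
        in Equivalence.from (𝓖⇔𝓕 X y (represents⇒encodes {p} {X = X} f rep)) 𝓕y)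
      where open Inhabited 𝓕x₀ l₀ l₀≡0

    diagram : Σ[ Z ∈ DD c m ] (Represents Z 𝓖 × width Z ≤ N)
    diagram with any-coloring? 𝓕? 𝓕-ext
    ... | no ¬∃ = trivial ⊥ₙ , (λ X → mk⇔
      (λ 𝓖X → contradiction (encode X , Equivalence.to (𝓖⇔𝓕 X (encode X) (encode-encodes X)) 𝓖X) ¬∃)
      λ { (() , _) }) , trivial-width ⊥ₙ
    ... | yes (x₀ , 𝓕x₀) with 0 <? m
    ...   | yes 0<m =
      Inhabited.Z 𝓕x₀ (fromℕ< 0<m) (toℕ-fromℕ< 0<m) ,
      nonempty-represents 𝓕x₀ (fromℕ< 0<m) (toℕ-fromℕ< 0<m) ,
      Inhabited.width-Z 𝓕x₀ (fromℕ< 0<m) (toℕ-fromℕ< 0<m)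
    -- Without edges all colorings agree pointwise, so `𝓕x₀` accepts every colored subset, and the
    -- root can be ⊤ itself.
    ...   | no 0≮m = trivial ⊤ₙ , (λ X → mk⇔
      (λ _ → end , λ j e → contradiction (no-edge e) λ ())
      (λ _ → Equivalence.from (𝓖⇔𝓕 X (encode X) (encode-encodes X)) (𝓕-ext (λ e → contradiction (no-edge e) λ ()) 𝓕x₀))) ,
      trivial-width ⊤ₙ
      where
      no-edge : Fin m → ⊥
      no-edge e = 0≮m (ℕ.≤-<-trans z≤n (toℕ<n e))

-- The family as a decidable predicate on colorings of the host

module _ {A : Set} (_≟_ : DecidableEquality A) where

  open Multiset _≟_

  -- An element of neither list has multiplicity 0 in both, so only the elements of `xs ++ ys` have
  -- to be checked.
  occ-agree? : {Q : Pred A 0ℓ} (Q? : Decidable Q) (xs ys : List A) → Dec (∀ d → Q d → occ d xs ≡ occ d ys)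
  occ-agree? {Q} Q? xs ys = Dec.map′ everywhere (λ agree → All.universal agree (xs ++ ys))
    (All.all? (λ d → Q? d →-dec (occ d xs ℕ.≟ occ d ys)) (xs ++ ys))
    where
    everywhere : All.All (λ d → Q d → occ d xs ≡ occ d ys) (xs ++ ys) → ∀ d → Q d → occ d xs ≡ occ d ys
    everywhere agree d q with occ d xs in eq | occ d ys in eq′
    ... | zero  | zero  = refl
    ... | suc _ | _     = trans (sym eq) (trans (All.lookup agree (∈-++⁺ˡ (occ≢0⇒∈ d xs eq)) q) eq′)
    ... | zero  | suc _ = trans (sym eq) (trans (All.lookup agree (∈-++⁺ʳ xs (occ≢0⇒∈ d ys eq′)) q) eq′)

module _ (G : Graph) where

  EdgeRel : Pred (E G) 0ℓ → Rel (V G) 0ℓ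
  EdgeRel Q u v = ∃[ e ] (Q e × Joins G e u v)

  Touches : Pred (E G) 0ℓ → Pred (V G) 0ℓ
  Touches Q v = ∃[ e ] (Q e × Incident G v e)

  touches? : {Q : Pred (E G) 0ℓ} → Decidable Q → Decidable (Touches Q)
  touches? Q? v = any? λ e → Q? e ×-dec incident? G v e

module _ {G : Graph} where

  EdgeRel-sym : ∀ {Q u v} → EdgeRel G Q u v → EdgeRel G Q v u
  EdgeRel-sym (e , q , j) = e , q , Joins-sym {G} {e} j

  EdgeRel-mono : ∀ {Q R} → (∀ e → Q e → R e) → ∀ {u v} → EdgeRel G Q u v → EdgeRel G R u v
  EdgeRel-mono Q⇒R (e , q , j) = e , Q⇒R e q , j

  EdgeRel⇒Touchesˡ : ∀ {Q u v} → EdgeRel G Q u v → Touches G Q u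
  EdgeRel⇒Touchesˡ (e , q , j) = e , q , Joins⇒Incidentˡ {G} {e} j

  Walk-mono : ∀ {Q R} → (∀ e → Q e → R e) → ∀ {u v} → Star (EdgeRel G Q) u v → Star (EdgeRel G R) u v
  Walk-mono Q⇒R = Star.map (EdgeRel-mono Q⇒R)

  -- Inserting an edge e = {a , b} merges the components of a and b.
  module Insert (e : E G) (es : List (E G)) where

    private
      a = proj₁ (ends G e)
      b = proj₂ (ends G e)
      S = Star (EdgeRel G (_∈ˡ es))
      S⁺ = Star (EdgeRel G (_∈ˡ e ∷ es))

    Merged : Rel (V G) 0ℓ
    Merged u v = S u v ⊎ ((S u a × S b v) ⊎ (S u b × S a v))

    merged-prepend : ∀ {u w v} → EdgeRel G (_∈ˡ es) u w → Merged w v → Merged u v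
    merged-prepend s (inj₁ p)              = inj₁ (s ◅ p)
    merged-prepend s (inj₂ (inj₁ (p , q))) = inj₂ (inj₁ (s ◅ p , q))
    merged-prepend s (inj₂ (inj₂ (p , q))) = inj₂ (inj₂ (s ◅ p , q))

    walk⇒merged : ∀ {u v} → S⁺ u v → Merged u v
    walk⇒merged ε = inj₁ ε
    walk⇒merged ((f , there f∈ , j) ◅ w) = merged-prepend (f , f∈ , j) (walk⇒merged w)
    walk⇒merged ((f , here refl , inj₁ refl) ◅ w) with walk⇒merged w
    ... | inj₁ p              = inj₂ (inj₁ (ε , p))
    ... | inj₂ (inj₁ (_ , q)) = inj₂ (inj₁ (ε , q))
    ... | inj₂ (inj₂ (_ , q)) = inj₁ q
    walk⇒merged ((f , here refl , inj₂ refl) ◅ w) with walk⇒merged w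
    ... | inj₁ p              = inj₂ (inj₂ (ε , p))
    ... | inj₂ (inj₁ (_ , q)) = inj₁ q
    ... | inj₂ (inj₂ (_ , q)) = inj₂ (inj₂ (ε , q))

    merged⇒walk : ∀ {u v} → Merged u v → S⁺ u v
    merged⇒walk (inj₁ p) = Walk-mono (λ _ → there) p
    merged⇒walk (inj₂ (inj₁ (p , q))) =
      Walk-mono (λ _ → there) p ◅◅ (e , here refl , inj₁ refl) ◅ Walk-mono (λ _ → there) q
    merged⇒walk (inj₂ (inj₂ (p , q))) =
      Walk-mono (λ _ → there) p ◅◅ (e , here refl , inj₂ refl) ◅ Walk-mono (λ _ → there) q

  walk-list? : ∀ es u v → Dec (Star (EdgeRel G (_∈ˡ es)) u v)
  walk-list? []       u v = Dec.map′ (λ { refl → ε }) (λ { ε → refl ; ((_ , () , _) ◅ _) }) (u ≟ v)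
  walk-list? (e ∷ es) u v = Dec.map′ merged⇒walk walk⇒merged
    (walk-list? es u v ⊎-dec ((walk-list? es u _ ×-dec walk-list? es _ v) ⊎-dec
                              (walk-list? es u _ ×-dec walk-list? es _ v)))
    where open Insert e es

  walk? : ∀ {Q : Pred (E G) 0ℓ} → Decidable Q → ∀ u v → Dec (Star (EdgeRel G Q) u v)
  walk? Q? u v = Dec.map′
    (Walk-mono λ e e∈ → proj₂ (∈-filter⁻ Q? {xs = allFin _} e∈))
    (Walk-mono λ e q → ∈-filter⁺ Q? (∈-allFin e) q)
    (walk-list? (filter Q? (allFin _)) u v)

  -- The walk is followed up to the first edge that `split` assigns to `B`. The vertex reached there
  -- is touched by both `A` and `B`; when these are a prefix and a suffix of the edge order, it is a
  -- frontier vertex.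
  walk-split : ∀ {A B Q : Pred (E G) 0ℓ} → (∀ e → Q e → A e ⊎ B e) →
    ∀ {u v} → Touches G A u → Star (EdgeRel G Q) u v →
    (Star (EdgeRel G A) u v × Touches G A v) ⊎
    (∃[ w ] (Star (EdgeRel G A) u w × Touches G A w × Touches G B w))
  walk-split split t ε = inj₁ (ε , t)
  walk-split split {u} t ((e , q , j) ◅ w) with split e q
  ... | inj₂ b = inj₂ (u , ε , t , e , b , Joins⇒Incidentˡ {G} {e} j)
  ... | inj₁ a with walk-split split (e , a , Joins⇒Incidentʳ {G} {e} j) w
  ...   | inj₁ (p , t′)          = inj₁ ((e , a , j) ◅ p , t′)
  ...   | inj₂ (x , p , t′ , t″) = inj₂ (x , (e , a , j) ◅ p , t′ , t″)

_≟ᵛ_ : ∀ {c} → DecidableEquality (Vec ℕ c)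
_≟ᵛ_ = Vec.≡-dec ℕ._≟_

NonzeroVec : ∀ {c} → Pred (Vec ℕ c) 0ℓ
NonzeroVec d = ∃[ j ] 1 ≤ Vec.lookup d j

nonzeroVec? : ∀ {c} → Decidable (NonzeroVec {c})
nonzeroVec? d = any? λ j → 1 ≤? Vec.lookup d j

module Family (H : Graph) {c : ℕ} (col : E H → Fin c) (G : Graph) where

  open Multiset (_≟ᵛ_ {c}) using (occ; extension⇔occ; occ-map-filter)

  Coloring : Set
  Coloring = E G → Fin (suc c)

  profile : List (Vec ℕ c)
  profile = DS (colorize H col)

  Colored : Coloring → Fin c → Pred (E G) 0ℓ
  Colored x j e = x e ≡ suc j

  colored? : ∀ x j → Decidable (Colored x j)
  colored? x j e = x e ≟ suc j

  degree : Coloring → V G → Fin c → ℕ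
  degree x v j = # (λ e → colored? x j e ×-dec incident? G v e)

  degrees : Coloring → V G → Vec ℕ c
  degrees x v = Vec.tabulate (degree x v)

  -- The vertices of the edge-induced graph are those of nonzero colored degree; all other vertices
  -- of `G` are dropped.
  degreeList : Coloring → List (Vec ℕ c)
  degreeList x = map (degrees x) (filter (nonzeroVec? ∘ degrees x) (allFin _))

  -- Condition (a) enters through multiplicities outside Δ, a form that is decidable and can be
  -- counted vertex by vertex.
  record 𝓕 (x : Coloring) : Set where
    constructor mk𝓕
    field
      matching  : ∀ d → ¬ d ∈Δ → occ d (degreeList x) ≡ occ d profile
      connected : ∀ j u v → Touches G (Colored x j) u → Touches G (Colored x j) v →
        Star (EdgeRel G (Colored x j)) u v

  𝓕? : Decidable 𝓕
  𝓕? x = Dec.map′ (λ (p , q) → mk𝓕 p q) (λ (mk𝓕 p q) → p , q)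
    (occ-agree? _≟ᵛ_ (¬? ∘ ∈Δ?) (degreeList x) profile ×-dec
     (all? λ j → all? λ u → all? λ v →
       touches? G (colored? x j) u →-dec (touches? G (colored? x j) v →-dec walk? {G} (colored? x j) u v)))

  degrees-cong : ∀ {x y} v → (∀ e → Incident G v e → x e ≡ y e) → degrees x v ≡ degrees y v
  degrees-cong {x} {y} v eq = Vec.tabulate-cong λ j →
    #-cong (λ e → colored? x j e ×-dec incident? G v e) (λ e → colored? y j e ×-dec incident? G v e)
      (λ e (xe , inc) → trans (sym (eq e inc)) xe , inc) (λ e (ye , inc) → trans (eq e inc) ye , inc)

  private
    degreeList-cong : ∀ {f g : V G → Vec ℕ c} {P Q : Pred (V G) 0ℓ} (P? : Decidable P) (Q? : Decidable Q) →
      (∀ v → f v ≡ g v) → (∀ v → P v → Q v) → (∀ v → Q v → P v) →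
      map f (filter P? (allFin _)) ≡ map g (filter Q? (allFin _))
    degreeList-cong {g = g} P? Q? eq P⇒Q Q⇒P =
      trans (map-cong eq _) (cong (map g) (filter-≐ P? Q? ((λ {v} → P⇒Q v) , (λ {v} → Q⇒P v)) (allFin _)))

  𝓕-ext : Extensional 𝓕
  𝓕-ext {x} {y} eq (mk𝓕 p q) = mk𝓕
    (λ d ¬Δ → trans (cong (occ d) (sym lists)) (p d ¬Δ))
    (λ j u v tu tv → Walk-mono {G} (λ e xe → trans (sym (eq e)) xe) (q j u v (back tu) (back tv)))
    where
    same : ∀ v → degrees x v ≡ degrees y v
    same v = degrees-cong v λ e _ → eq e
    lists : degreeList x ≡ degreeList y
    lists = degreeList-cong (nonzeroVec? ∘ degrees x) (nonzeroVec? ∘ degrees y) same (λ v → subst NonzeroVec (same v)) (λ v → subst NonzeroVec (sym (same v)))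
    back : ∀ {j u} → Touches G (Colored y j) u → Touches G (Colored x j) u
    back (e , ye , inc) = e , trans (eq e) ye , inc

  module _ (profile-∌ : All.All (¬_ ∘ _∈Δ) profile) (X : ColoredSubset c (∣E∣ G)) (x : Coloring) (enc : Encodes X x) where

    private
      K = edgeInduced G X

      D≡ : ∀ j v → D X j ∩ incidentEdges G v ≡ ⟦ (λ e → colored? x j e ×-dec incident? G v e) ⟧
      D≡ j v = subset-ext
        (λ e e∈ → let e∈D , inc = ∈-incident⁻ K e∈
                  in ∈⟦⟧⁺ (λ e → colored? x j e ×-dec incident? G v e) (Equivalence.to (enc j e) e∈D , inc))
        (λ e e∈ → let xe , inc = ∈⟦⟧⁻ (λ e → colored? x j e ×-dec incident? G v e) e∈
                  in ∈-incident⁺ K (Equivalence.from (enc j e) xe) inc)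

      same : ∀ v → coloredDegree K v ≡ degrees x v
      same v = Vec.tabulate-cong λ j → cong ∣_∣ (D≡ j v)

      endpoint? : Decidable (λ v → ∃[ j ] Nonempty (D X j ∩ incidentEdges G v))
      endpoint? v = any? (λ j → nonempty? (D X j ∩ incidentEdges G v))

      lists : DS K ≡ degreeList x
      lists = degreeList-cong (_∈? U K) (nonzeroVec? ∘ degrees x) same
        (λ v v∈ → let j , e , e∈ = ∈⟦⟧⁻ endpoint? v∈
                  in j , subst (1 ≤_) (sym (lookup∘tabulate (degree x v) j))
                       (subst (λ p → 1 ≤ ∣ p ∣) (D≡ j v) (∣∣≥1 _ e∈)))
        (λ v (j , 1≤) → ∈⟦⟧⁺ endpoint?
          (j , ∣∣≥1⁻ _ (subst (λ p → 1 ≤ ∣ p ∣) (sym (D≡ j v)) (subst (1 ≤_) (lookup∘tabulate (degree x v) j) 1≤))))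

    ⊨⇔𝓕 : K ⊨𝒞* profile ⇔ 𝓕 x
    ⊨⇔𝓕 = mk⇔
      (λ K⊨ → mk𝓕
        (λ d ¬Δ → trans (cong (occ d) (sym lists))
          (Equivalence.to (extension⇔occ ∈Δ? profile-∌ (DS K)) (_⊨𝒞*_.degrees K⊨) d ¬Δ))
        (λ j u v (e , xe , inc) (f , xf , inc′) →
          Star.map (λ (g , g∈ , j₀) → g , Equivalence.to (enc j g) g∈ , j₀)
          (_⊨𝒞*_.connected K⊨ j u v
            (e , ∈-incident⁺ K (Equivalence.from (enc j e) xe) inc)
            (f , ∈-incident⁺ K (Equivalence.from (enc j f) xf) inc′))))
      (λ (mk𝓕 p q) → record
        { degrees   = Equivalence.from (extension⇔occ ∈Δ? profile-∌ (DS K))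
            (λ d ¬Δ → trans (cong (occ d) lists) (p d ¬Δ))
        ; connected = λ j u v (e , e∈) (f , f∈) →
            let e∈D , inc = ∈-incident⁻ K e∈
                f∈D , inc′ = ∈-incident⁻ K f∈
            in Star.map (λ (g , xg , j₀) → g , Equivalence.from (enc j g) xg , j₀)
                 (q j u v (e , Equivalence.to (enc j e) e∈D , inc) (f , Equivalence.to (enc j f) f∈D , inc′))
        })

  profileDegree : V H → Vec ℕ c
  profileDegree = coloredDegree (colorize H col)

  occ-profile : ∀ d → occ d profile ≡ # (λ h → profileDegree h ≟ᵛ d)
  occ-profile d = trans (occ-map-filter (_∈? ⊤) profileDegree d (λ h → h))
    (#-cong (λ h → (h ∈? ⊤) ×-dec (profileDegree h ≟ᵛ d)) (λ h → profileDegree h ≟ᵛ d)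
      (λ _ (_ , eq) → eq) (λ _ eq → ∈⊤ , eq))

  HasDegrees : Coloring → Vec ℕ c → Pred (V G) 0ℓ
  HasDegrees x d v = NonzeroVec (degrees x v) × degrees x v ≡ d

  hasDegrees? : ∀ x d → Decidable (HasDegrees x d)
  hasDegrees? x d v = nonzeroVec? (degrees x v) ×-dec (degrees x v ≟ᵛ d)

  occ-degreeList : ∀ x d → occ d (degreeList x) ≡ # (hasDegrees? x d)
  occ-degreeList x d = occ-map-filter (nonzeroVec? ∘ degrees x) (degrees x) d (λ v → v)

-- Exchanging prefixes across the frontier

module Frontier (G : Graph) (i : ℕ) where

  -- The cut `i` ranges over ℕ, so that the cut behind the last edge, whose frontier is empty, is
  -- included.
  Early Late Front : Pred (V G) 0ℓ
  Early = Touches G (λ e → toℕ e < i)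
  Late  = Touches G (λ e → i ≤ toℕ e)
  Front v = Early v × Late v

  early? : Decidable Early
  early? = touches? G (λ e → toℕ e <? i)

  late? : Decidable Late
  late? = touches? G (λ e → i ≤? toℕ e)

  front? : Decidable Front
  front? v = early? v ×-dec late? v

  not-late⇒< : ∀ {v} → ¬ Late v → ∀ {e} → Incident G v e → toℕ e < i
  not-late⇒< ¬late {e} inc with toℕ e <? i
  ... | yes e<i = e<i
  ... | no e≮i  = contradiction (e , ℕ.≮⇒≥ e≮i , inc) ¬late

module Exchange (H : Graph) {c : ℕ} (col : E H → Fin c) (G : Graph) (i : ℕ) where

  open Family H col G
  open Frontier G i

  Prefix Suffix : Coloring → Fin c → Pred (E G) 0ℓ
  Prefix x j e = toℕ e < i × Colored x j e
  Suffix x j e = i ≤ toℕ e × Colored x j e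

  prefix? : ∀ x j → Decidable (Prefix x j)
  prefix? x j e = (toℕ e <? i) ×-dec colored? x j e

  suffix? : ∀ x j → Decidable (Suffix x j)
  suffix? x j e = (i ≤? toℕ e) ×-dec colored? x j e

  colored-split : ∀ x j e → Colored x j e → Prefix x j e ⊎ Suffix x j e
  colored-split x j e xe with toℕ e <? i
  ... | yes e<i = inj₁ (e<i , xe)
  ... | no e≮i  = inj₂ (ℕ.≮⇒≥ e≮i , xe)

  prefixDegree suffixDegree : Coloring → V G → Fin c → ℕ
  prefixDegree x v j = # (λ e → prefix? x j e ×-dec incident? G v e)
  suffixDegree x v j = # (λ e → suffix? x j e ×-dec incident? G v e)

  prefixDegrees : Coloring → V G → Vec ℕ c
  prefixDegrees x v = Vec.tabulate (prefixDegree x v)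

  degree-split : ∀ x v j → degree x v j ≡ prefixDegree x v j + suffixDegree x v j
  degree-split x v j = trans (#-split at? (λ e → toℕ e <? i)) (cong₂ _+_
    (#-cong (λ e → at? e ×-dec (toℕ e <? i)) (λ e → prefix? x j e ×-dec incident? G v e)
      (λ e ((xe , inc) , e<i) → (e<i , xe) , inc) (λ e ((e<i , xe) , inc) → (xe , inc) , e<i))
    (#-cong (λ e → at? e ×-dec ¬? (toℕ e <? i)) (λ e → suffix? x j e ×-dec incident? G v e)
      (λ e ((xe , inc) , e≮i) → (ℕ.≮⇒≥ e≮i , xe) , inc)
      (λ e ((i≤e , xe) , inc) → (xe , inc) , ℕ.≤⇒≯ i≤e)))
    where
    at? : Decidable (λ e → Colored x j e × Incident G v e)
    at? e = colored? x j e ×-dec incident? G v e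

  lookup-degrees : ∀ x v j → Vec.lookup (degrees x v) j ≡ degree x v j
  lookup-degrees x v = lookup∘tabulate (degree x v)

  degree⇒Touches : ∀ {x v j} → 1 ≤ Vec.lookup (degrees x v) j → Touches G (Colored x j) v
  degree⇒Touches {x} {v} {j} 1≤
    with e , xe , inc ← #≥1⁻ (λ e → colored? x j e ×-dec incident? G v e) (subst (1 ≤_) (lookup-degrees x v j) 1≤) =
    e , xe , inc

  finished? : ∀ x d → Decidable (λ v → HasDegrees x d v × ¬ Late v)
  finished? x d v = hasDegrees? x d v ×-dec ¬? (late? v)

  -- The field `front-linked` is directed because the spliced coloring has the prefix of x: links
  -- through the prefix of y have to be imitated there. A vertex that is not late has its final
  -- degrees, so `finished` counts what the prefix has settled.
  record SameSignature (x y : Coloring) : Set where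
    field
      front-degrees : ∀ v → Front v → prefixDegrees x v ≡ prefixDegrees y v
      finished      : ∀ d → ¬ d ∈Δ → # (finished? x d) ≡ # (finished? y d)
      front-linked  : ∀ j u v → Front u → Front v →
        Star (EdgeRel G (Prefix y j)) u v → Star (EdgeRel G (Prefix x j)) u v

  prefix-touches⇒Early : ∀ {x j v} → Touches G (Prefix x j) v → Early v
  prefix-touches⇒Early (e , (e<i , _) , inc) = e , e<i , inc

  suffix-touches⇒Late : ∀ {x j v} → Touches G (Suffix x j) v → Late v
  suffix-touches⇒Late (e , (i≤e , _) , inc) = e , i≤e , inc

  Touches-mono : ∀ {Q R : Pred (E G) 0ℓ} → (∀ e → Q e → R e) → ∀ {v} → Touches G Q v → Touches G R v
  Touches-mono Q⇒R (e , q , inc) = e , Q⇒R e q , inc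

  module _ {x y : Coloring} (𝓕x : 𝓕 x) (𝓕y : 𝓕 y) (same : SameSignature x y)
    (branch : ∀ j → ∃[ h ] (1 ≤ Vec.lookup (profileDegree h) j × ¬ profileDegree h ∈Δ)) where

    open SameSignature same
    open 𝓕

    private
      z : Coloring
      z = splice i x y

      z-prefix : ∀ {j} e → Prefix x j e → Colored z j e
      z-prefix e (e<i , xe) = trans (splice-< i x y e e<i) xe

      z-suffix : ∀ {j} e → Suffix y j e → Colored z j e
      z-suffix e (i≤e , ye) = trans (splice-≥ i x y e i≤e) ye

      z-split : ∀ {j} e → Colored z j e → Prefix x j e ⊎ Suffix y j e
      z-split e ze with toℕ e <? i
      ... | yes e<i = inj₁ (e<i , ze)
      ... | no e≮i  = inj₂ (ℕ.≮⇒≥ e≮i , ze)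

      prefixDegree-late : ∀ {v} → Late v → ∀ j → prefixDegree x v j ≡ prefixDegree y v j
      prefixDegree-late {v} late j with early? v
      ... | yes early = trans (sym (lookup∘tabulate (prefixDegree x v) j))
        (trans (cong (λ d → Vec.lookup d j) (front-degrees v (early , late)))
          (lookup∘tabulate (prefixDegree y v) j))
      ... | no ¬early = trans (untouched x) (sym (untouched y))
        where
        untouched : ∀ x → prefixDegree x v j ≡ 0
        untouched x = #≡0 (λ e → prefix? x j e ×-dec incident? G v e)
          λ e ((e<i , _) , inc) → ¬early (e , e<i , inc)

      -- A late vertex either lies on the frontier, where the prefix degrees agree, or meets no
      -- prefix edge, so that both prefix degrees are 0. Its later edges are colored as in y.
      degrees-late : ∀ {v} → Late v → degrees z v ≡ degrees y v
      degrees-late {v} late = Vec.tabulate-cong λ j → trans (degree-split z v j) (trans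
        (cong₂ _+_
          (trans (#-cong (λ e → prefix? z j e ×-dec incident? G v e) (λ e → prefix? x j e ×-dec incident? G v e)
            (λ e ((e<i , ze) , inc) → (e<i , trans (sym (splice-< i x y e e<i)) ze) , inc)
            (λ e (p@(e<i , _) , inc) → (e<i , z-prefix e p) , inc)) (prefixDegree-late late j))
          (#-cong (λ e → suffix? z j e ×-dec incident? G v e) (λ e → suffix? y j e ×-dec incident? G v e)
            (λ e ((i≤e , ze) , inc) → (i≤e , trans (sym (splice-≥ i x y e i≤e)) ze) , inc)
            (λ e (p@(i≤e , _) , inc) → (i≤e , z-suffix e p) , inc)))
        (sym (degree-split y v j)))

      degrees-finished : ∀ {v} → ¬ Late v → degrees z v ≡ degrees x v
      degrees-finished {v} ¬late =
        degrees-cong v λ e inc → splice-< i x y e (not-late⇒< ¬late inc)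

      HasDegrees-cong : ∀ {a b v} d → degrees a v ≡ degrees b v → HasDegrees a d v → HasDegrees b d v
      HasDegrees-cong d eq (nz , has) = subst NonzeroVec eq nz , trans (sym eq) has

      -- Late vertices have their degrees from y and the others from x. The others are exactly what
      -- `finished` counts, and these counts agree for x and y.
      matching-z : ∀ d → ¬ d ∈Δ → # (hasDegrees? z d) ≡ # (hasDegrees? y d)
      matching-z d ¬Δ = trans (#-split (hasDegrees? z d) late?) (trans
        (cong₂ _+_
          (#-cong (λ v → hasDegrees? z d v ×-dec late? v) (λ v → hasDegrees? y d v ×-dec late? v)
            (λ v (has , late) → HasDegrees-cong {z} {y} d (degrees-late late) has , late)
            (λ v (has , late) → HasDegrees-cong {y} {z} d (sym (degrees-late late)) has , late))
          (trans (#-cong (finished? z d) (finished? x d)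
            (λ v (has , ¬late) → HasDegrees-cong {z} {x} d (degrees-finished ¬late) has , ¬late)
            (λ v (has , ¬late) → HasDegrees-cong {x} {z} d (sym (degrees-finished ¬late)) has , ¬late))
            (finished d ¬Δ)))
        (sym (#-split (hasDegrees? y d) late?)))

      front-touches : ∀ {j v} → Front v → Touches G (Prefix x j) v → Touches G (Prefix y j) v
      front-touches {j} {v} front (e , p , inc)
        with f , q , inc′ ← #≥1⁻ (λ e → prefix? y j e ×-dec incident? G v e)
          (subst (1 ≤_) (prefixDegree-late (proj₂ front) j)
            (#≥1 (λ e → prefix? x j e ×-dec incident? G v e) {e} (p , inc))) = f , q , inc′

      front-touches⁻ : ∀ {j v} → Front v → Touches G (Prefix y j) v → Touches G (Prefix x j) v
      front-touches⁻ {j} {v} front (e , p , inc)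
        with f , q , inc′ ← #≥1⁻ (λ e → prefix? x j e ×-dec incident? G v e)
          (subst (1 ≤_) (sym (prefixDegree-late (proj₂ front) j))
            (#≥1 (λ e → prefix? y j e ×-dec incident? G v e) {e} (p , inc))) = f , q , inc′

      both⇒Front : ∀ {a b j v} → Touches G (Prefix a j) v → Touches G (Suffix b j) v → Front v
      both⇒Front {a} {b} tp ts = prefix-touches⇒Early {a} tp , suffix-touches⇒Late {b} ts

      prefix-walk : ∀ {j u v} → Star (EdgeRel G (Prefix x j)) u v → Star (EdgeRel G (Colored z j)) u v
      prefix-walk = Walk-mono {G} z-prefix

      -- The ends of a nonempty prefix segment are early. Being late as well, they lie on the
      -- frontier, where links of y can be imitated in x.
      late-segment : ∀ {j s v} → Late s → Late v → Star (EdgeRel G (Prefix y j)) s v →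
        Star (EdgeRel G (Colored z j)) s v
      late-segment late-s late-v ε = ε
      late-segment {j} {s} {v} late-s late-v w@(first ◅ _)
        -- Splitting off an empty second part only extracts that the prefix touches the last vertex.
        with walk-split {G} {A = Prefix y j} {B = λ _ → ⊥} (λ _ → inj₁) (EdgeRel⇒Touchesˡ {G} first) w
      ... | inj₂ (_ , _ , _ , _ , () , _)
      ... | inj₁ (_ , last) = prefix-walk (front-linked j s v
        (prefix-touches⇒Early {y} (EdgeRel⇒Touchesˡ {G} first) , late-s)
        (prefix-touches⇒Early {y} last , late-v) w)

      -- The prefix part of the walk is collected into segments between late
      -- vertices, which are then replaced by walks in the prefix of x.
      late-walk : ∀ {j s u v} → Late s → Star (EdgeRel G (Prefix y j)) s u → Star (EdgeRel G (Colored y j)) u v →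
        Late v → Star (EdgeRel G (Colored z j)) s v
      late-walk late-s seg ε late-v = late-segment late-s late-v seg
      late-walk {j} late-s seg ((e , ye , j₀) ◅ w) late-v with colored-split y j e ye
      ... | inj₁ p           = late-walk late-s (seg ◅◅ (e , p , j₀) ◅ ε) w late-v
      ... | inj₂ p@(i≤e , _) = late-segment late-s (e , i≤e , Joins⇒Incidentˡ {G} {e} j₀) seg ◅◅
        (e , z-suffix e p , j₀) ◅ late-walk (e , i≤e , Joins⇒Incidentʳ {G} {e} j₀) ε w late-v

      z-walk-sym : ∀ {j u v} → Star (EdgeRel G (Colored z j)) u v → Star (EdgeRel G (Colored z j)) v u
      z-walk-sym = reverse (EdgeRel-sym {G})

      touches-split : ∀ {j u} → Touches G (Colored z j) u → Touches G (Prefix x j) u ⊎ Touches G (Suffix y j) u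
      touches-split (e , ze , inc) with z-split e ze
      ... | inj₁ p = inj₁ (e , p , inc)
      ... | inj₂ p = inj₂ (e , p , inc)

      prefix-colored : ∀ {a j v} → Touches G (Prefix a j) v → Touches G (Colored a j) v
      prefix-colored = Touches-mono λ _ → proj₂

      suffix-colored : ∀ {a j v} → Touches G (Suffix a j) v → Touches G (Colored a j) v
      suffix-colored = Touches-mono λ _ → proj₂

      module _ {j w} (front-w : Front w) (touch-w : Touches G (Prefix x j) w) where

        -- A vertex touched by the prefix follows its walk to `w` in x. The walk either stays in the
        -- prefix up to `w` or first leaves it at some frontier vertex. Both are late, and equal
        -- prefix degrees show that y has color `j` there too.
        reach-late : ∀ {u} → Touches G (Colored z j) u →
          ∃[ u′ ] (Star (EdgeRel G (Colored z j)) u u′ × Late u′ × Touches G (Colored y j) u′)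
        reach-late {u} tu with touches-split tu
        ... | inj₂ ts = u , ε , suffix-touches⇒Late {y} ts , suffix-colored {y} ts
        ... | inj₁ tp with walk-split {G} (colored-split x j) tp
                             (connected 𝓕x j u w (prefix-colored {x} tp) (prefix-colored {x} touch-w))
        ...   | inj₁ (p , t) = w , prefix-walk p , proj₂ front-w ,
          prefix-colored {y} (front-touches front-w t)
        ...   | inj₂ (u′ , p , t , t′) = let front = both⇒Front {x} {x} t t′ in
          u′ , prefix-walk p , proj₂ front , prefix-colored {y} (front-touches front t)

        connected-front : ∀ u v → Touches G (Colored z j) u → Touches G (Colored z j) v →
          Star (EdgeRel G (Colored z j)) u v
        connected-front u v tu tv =
          let u′ , uu′ , late-u , tu′ = reach-late tu
              v′ , vv′ , late-v , tv′ = reach-late tv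
          in uu′ ◅◅ late-walk late-u ε (connected 𝓕y j u′ v′ tu′ tv′) late-v ◅◅ z-walk-sym vv′

      module _ {j} (no-front : ∀ w → Front w → ¬ Touches G (Prefix x j) w) where

        no-front-y : ∀ w → Front w → ¬ Touches G (Prefix y j) w
        no-front-y w front t = no-front w front (front-touches⁻ front t)

        -- Leaving the prefix would take a frontier vertex with a prefix edge of color `j`, so the
        -- walk that connectedness of x provides remains in the prefix.
        stay : ∀ {u v} → Touches G (Prefix x j) u → Touches G (Colored x j) v →
          Star (EdgeRel G (Prefix x j)) u v × Touches G (Prefix x j) v
        stay {u} {v} tu tv with walk-split {G} (colored-split x j) tu (connected 𝓕x j u v (prefix-colored {x} tu) tv)
        ... | inj₁ r = r
        ... | inj₂ (w , _ , t , t′) = contradiction t (no-front w (both⇒Front {x} {x} t t′))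

        -- A vertex whose degrees are not in Δ witnesses that color j has been
        -- used up by the prefix of x, hence also by the prefix of y.
        not-mixed : ∀ {u v} → Touches G (Prefix x j) u → ¬ Touches G (Suffix y j) v
        not-mixed {u} {v} tu tv =
          let h , 1≤h , ¬Δ = branch j
              d = profileDegree h
              v₁ , (_ , has₁) = #≥1⁻ (hasDegrees? x d)
                (subst (1 ≤_) (trans (sym (occ-profile d)) (trans (sym (matching 𝓕x d ¬Δ)) (occ-degreeList x d)))
                  (#≥1 (λ h → profileDegree h ≟ᵛ d) refl))
              t₁ = degree⇒Touches {x} {v₁} (subst (λ d → 1 ≤ Vec.lookup d j) (sym has₁) 1≤h)
              _ , t₁′ = stay tu t₁
              ¬late₁ = λ late → no-front v₁ (prefix-touches⇒Early {x} t₁′ , late) t₁′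
              v₂ , ((_ , has₂) , ¬late₂) = #≥1⁻ (finished? y d) (subst (1 ≤_) (finished d ¬Δ)
                (#≥1 (finished? x d) (((j , subst (λ d → 1 ≤ Vec.lookup d j) (sym has₁) 1≤h) , has₁) , ¬late₁)))
              e , ye , inc = degree⇒Touches {y} {v₂} (subst (λ d → 1 ≤ Vec.lookup d j) (sym has₂) 1≤h)
          -- The vertex `v₂` is finished in y, so its edges of color `j` precede the cut, while `v`
          -- has one behind it. The walk between them would cross the frontier in color `j`.
          in escape (walk-split {G} (colored-split y j) (e , (not-late⇒< ¬late₂ inc , ye) , inc)
               (connected 𝓕y j v₂ v (e , ye , inc) (suffix-colored {y} tv)))
          where
          escape : ∀ {v₂} → (Star (EdgeRel G (Prefix y j)) v₂ v × Touches G (Prefix y j) v) ⊎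
            (∃[ w ] (Star (EdgeRel G (Prefix y j)) v₂ w × Touches G (Prefix y j) w × Touches G (Suffix y j) w)) → ⊥
          escape (inj₁ (_ , t))          = no-front-y v (both⇒Front {y} {y} t tv) t
          escape (inj₂ (w , _ , t , t′)) = no-front-y w (both⇒Front {y} {y} t t′) t

        connected-no-front : ∀ u v → Touches G (Colored z j) u → Touches G (Colored z j) v →
          Star (EdgeRel G (Colored z j)) u v
        connected-no-front u v tu tv with touches-split tu | touches-split tv
        ... | inj₁ p | inj₂ s = contradiction s (not-mixed p)
        ... | inj₂ s | inj₁ p = contradiction s (not-mixed p)
        ... | inj₁ p | inj₁ q = prefix-walk (proj₁ (stay p (prefix-colored {x} q)))
        ... | inj₂ s | inj₂ t with walk-split {G} (λ e ye → swap (colored-split y j e ye)) s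
                                     (connected 𝓕y j u v (suffix-colored {y} s) (suffix-colored {y} t))
        ...   | inj₁ (w , _) = Walk-mono {G} z-suffix w
        ...   | inj₂ (w , _ , t′ , t″) = contradiction t″ (no-front-y w (both⇒Front {y} {y} t″ t′))

    exchange : 𝓕 (splice i x y)
    exchange = mk𝓕
      (λ d ¬Δ → trans (occ-degreeList z d) (trans (matching-z d ¬Δ)
        (trans (sym (occ-degreeList y d)) (matching 𝓕y d ¬Δ))))
      λ j u v tu tv → decide j u v tu tv (any? λ w → front? w ×-dec touches? G (prefix? x j) w)
      where
      decide : ∀ j u v → Touches G (Colored z j) u → Touches G (Colored z j) v →
        Dec (∃[ w ] (Front w × Touches G (Prefix x j) w)) → Star (EdgeRel G (Colored z j)) u v
      decide j u v tu tv (yes (w , front , t)) = connected-front front t u v tu tv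
      decide j u v tu tv (no ¬∃) = connected-no-front (λ w front t → ¬∃ (w , front , t)) u v tu tv

-- Arithmetic of the width bound

⌊log₂⌋≥1 : ∀ n → 1 ≤ ⌊log₂ suc (suc n) ⌋
⌊log₂⌋≥1 n = ℕ.≤-trans (ℕ.≤-reflexive (sym (⌊log₂[2^n]⌋≡n 1))) (⌊log₂⌋-mono-≤ {2} {suc (suc n)} (s≤s (s≤s z≤n)))

-- Strong induction by halving, which lowers the logarithm by exactly one when n ≥ 2.
n<2^1+⌊log₂n⌋ : ∀ n → n < 2 ^ suc ⌊log₂ n ⌋
n<2^1+⌊log₂n⌋ = <-rec _ bound
  where
  open ℕ.≤-Reasoning
  bound : ∀ n → (∀ {m} → m < n → m < 2 ^ suc ⌊log₂ m ⌋) → n < 2 ^ suc ⌊log₂ n ⌋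
  bound zero          rec = s≤s z≤n
  bound (suc zero)    rec = s≤s (s≤s z≤n)
  bound n@(suc (suc k)) rec = begin-strict
    n                         ≡⟨ sym (ℕ.⌊n/2⌋+⌈n/2⌉≡n n) ⟩
    h + ⌈ n /2⌉               ≤⟨ ℕ.+-monoʳ-≤ h (ℕ.⌊n/2⌋-mono (ℕ.n≤1+n (suc n))) ⟩
    h + suc h                 <⟨ ℕ.n<1+n (h + suc h) ⟩
    suc h + suc h             ≤⟨ ℕ.+-mono-≤ half half ⟩
    2 ^ L + 2 ^ L             ≡⟨ cong (2 ^ L +_) (sym (ℕ.+-identityʳ (2 ^ L))) ⟩
    2 ^ suc L                 ∎
    where
    h = ⌊ n /2⌋
    L = ⌊log₂ n ⌋
    1+log-half : suc ⌊log₂ h ⌋ ≡ L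
    1+log-half = trans (cong suc (⌊log₂⌊n/2⌋⌋≡⌊log₂n⌋∸1 n)) (ℕ.m+[n∸m]≡n (⌊log₂⌋≥1 k))
    half : h < 2 ^ L
    half = subst (λ k → h < 2 ^ k) 1+log-half (rec (s≤s (s≤s (ℕ.⌊n/2⌋≤n k))))

-- The origin of the constant 2: with L the floor of the logarithm, w < 2^(1+L), and 1+L ≤ 2L as
-- soon as w ≥ 2.
w^w≤ : ∀ w → w ^ w ≤ 2 ^ (2 * (w * ⌊log₂ w ⌋))
w^w≤ zero             = s≤s z≤n
w^w≤ (suc zero)       = s≤s z≤n
w^w≤ w@(suc (suc k)) = begin
  w ^ w             ≤⟨ ℕ.^-monoˡ-≤ w (ℕ.≤-trans (ℕ.<⇒≤ (n<2^1+⌊log₂n⌋ w)) (ℕ.^-monoʳ-≤ 2 1+L≤2L)) ⟩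
  (2 ^ (2 * L)) ^ w ≡⟨ ℕ.^-*-assoc 2 (2 * L) w ⟩
  2 ^ (2 * L * w)   ≡⟨ cong (2 ^_) (trans (ℕ.*-assoc 2 L w) (cong (2 *_) (ℕ.*-comm L w))) ⟩
  2 ^ (2 * (w * L)) ∎
  where
  open ℕ.≤-Reasoning
  L = ⌊log₂ w ⌋
  1+L≤2L : suc L ≤ 2 * L
  1+L≤2L = ℕ.+-mono-≤ (⌊log₂⌋≥1 k) (ℕ.≤-reflexive (sym (ℕ.+-identityʳ L)))

signature-bound : ∀ a c w →
  2 ^ a * ((2 ^ c + c) ^ w * (w ^ w) ^ c) ≤ 2 ^ (2 * (c * (w * ⌊log₂ w ⌋)) + a) * (2 ^ c + c) ^ w
signature-bound a c w = begin
  2 ^ a * (B * (w ^ w) ^ c)                     ≤⟨ ℕ.*-monoʳ-≤ (2 ^ a) (ℕ.*-monoʳ-≤ B (ℕ.^-monoˡ-≤ c (w^w≤ w))) ⟩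
  2 ^ a * (B * (2 ^ (2 * (w * L))) ^ c)         ≡⟨ cong (λ k → 2 ^ a * (B * k)) (trans (ℕ.^-*-assoc 2 (2 * (w * L)) c)
                                                     (cong (2 ^_) (trans (ℕ.*-assoc 2 (w * L) c) (cong (2 *_) (ℕ.*-comm (w * L) c))))) ⟩
  2 ^ a * (B * 2 ^ (2 * (c * (w * L))))         ≡⟨ rearrange (2 ^ a) B (2 ^ (2 * (c * (w * L)))) ⟩
  2 ^ (2 * (c * (w * L))) * 2 ^ a * B           ≡⟨ cong (_* B) (sym (ℕ.^-distribˡ-+-* 2 (2 * (c * (w * L))) a)) ⟩
  2 ^ (2 * (c * (w * L)) + a) * B               ∎
  where
  open ℕ.≤-Reasoning
  L = ⌊log₂ w ⌋
  B = (2 ^ c + c) ^ w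
  rearrange : ∀ x y z → x * (y * z) ≡ z * x * y
  rearrange = solve-∀

-- Levels have frontiers of different sizes, while the diagram has a single set of signatures for
-- all of them; hence the passage to the maximum.
signature-mono : ∀ a c {f w} → f ≤ w →
  2 ^ a * ((2 ^ c + c) ^ f * (f ^ f) ^ c) ≤ 2 ^ a * ((2 ^ c + c) ^ w * (w ^ w) ^ c)
signature-mono a c {f} {w} f≤w = ℕ.*-monoʳ-≤ (2 ^ a) (ℕ.*-mono-≤
  (ℕ.^-monoʳ-≤ (2 ^ c + c) {{>-nonZero (ℕ.≤-trans (ℕ.m^n>0 2 c) (ℕ.m≤m+n (2 ^ c) c))}} f≤w)
  (ℕ.^-monoˡ-≤ c (self-power f≤w)))
  where
  self-power : ∀ {f w} → f ≤ w → f ^ f ≤ w ^ w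
  -- Here 0 ^ 0 is 1 on both sides; for larger w the base is positive, and the power is monotone in
  -- the exponent.
  self-power {zero}  {zero}  _   = s≤s z≤n
  self-power {f}     {suc w} f≤w = ℕ.≤-trans (ℕ.^-monoˡ-≤ f f≤w) (ℕ.^-monoʳ-≤ (suc w) f≤w)

-- Encoding signatures as numbers

funToFin-cong : ∀ {m n} {f g : Fin m → Fin n} → (∀ i → f i ≡ g i) → funToFin f ≡ funToFin g
funToFin-cong {zero}  eq = refl
funToFin-cong {suc m} eq = cong₂ combine (eq zero) (funToFin-cong (eq ∘ suc))

funToFin-injective : ∀ {m n} {f g : Fin m → Fin n} → funToFin f ≡ funToFin g → ∀ i → f i ≡ g i
funToFin-injective {f = f} {g} eq i =
  trans (sym (finToFun-funToFin f i)) (trans (cong (λ k → finToFun k i) eq) (finToFun-funToFin g i))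

least : ∀ {n} {P : Pred (Fin n) 0ℓ} → Decidable P → ∃ P → Fin n
least {suc n} P? w with P? zero
... | yes _ = zero
least {suc n} P? (zero  , p) | no ¬p = contradiction p ¬p
least {suc n} P? (suc i , p) | no ¬p = suc (least (P? ∘ suc) (i , p))

least-holds : ∀ {n} {P : Pred (Fin n) 0ℓ} (P? : Decidable P) w → P (least P? w)
least-holds {suc n} P? w with P? zero
... | yes p = p
least-holds {suc n} P? (zero  , p) | no ¬p = contradiction p ¬p
least-holds {suc n} P? (suc i , p) | no ¬p = least-holds (P? ∘ suc) (i , p)

least-cong : ∀ {n} {P Q : Pred (Fin n) 0ℓ} (P? : Decidable P) (Q? : Decidable Q) w w′ →
  (∀ i → P i → Q i) → (∀ i → Q i → P i) → least P? w ≡ least Q? w′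
least-cong {suc n} P? Q? w w′ P⇒Q Q⇒P with P? zero | Q? zero
... | yes _ | yes _ = refl
... | yes p | no ¬q = contradiction (P⇒Q zero p) ¬q
... | no ¬p | yes q = contradiction (Q⇒P zero q) ¬p
least-cong {suc n} P? Q? (zero  , p) _ _ _ | no ¬p | no _ = contradiction p ¬p
least-cong {suc n} P? Q? (suc _ , _) (zero  , q) _ _ | no _ | no ¬q = contradiction q ¬q
least-cong {suc n} P? Q? (suc i , p) (suc j , q) P⇒Q Q⇒P | no _ | no _ =
  cong suc (least-cong (P? ∘ suc) (Q? ∘ suc) (i , p) (j , q) (P⇒Q ∘ suc) (Q⇒P ∘ suc))

flag : {A : Set} → Dec A → Fin 2
flag (yes _) = suc zero
flag (no _)  = zero

flag-true : {A B : Set} (A? : Dec A) (B? : Dec B) → flag A? ≡ flag B? → A → B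
flag-true (yes _) (yes b) _  _ = b
flag-true (yes _) (no _)  () _
flag-true (no ¬a) _       _  a = contradiction a ¬a

flag-cong : {A B : Set} (A? : Dec A) (B? : Dec B) → (A → B) → (B → A) → flag A? ≡ flag B?
flag-cong (yes _) (yes _) _   _   = refl
flag-cong (yes a) (no ¬b) A⇒B _   = contradiction (A⇒B a) ¬b
flag-cong (no ¬a) (yes b) _   B⇒A = contradiction (B⇒A b) ¬a
flag-cong (no _)  (no _)  _   _   = refl

-- The degrees a vertex can have after only some of its edges have been seen.
PartialDegrees : ∀ {c} → Pred (Vec ℕ c) 0ℓ
PartialDegrees d = (∀ j → Vec.lookup d j ≤ 1) ⊎
  (∃[ j ] (Vec.lookup d j ≡ 2 × (∀ k → k ≢ j → Vec.lookup d k ≡ 0)))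

twice? : ∀ {c} (d : Vec ℕ c) → Dec (∃[ j ] 2 ≤ Vec.lookup d j)
twice? d = any? λ j → 2 ≤? Vec.lookup d j

-- The codes below 2 ^ c stand for the set of colors present, each once; the last c codes name a
-- single color that is present twice. The code is faithful on `PartialDegrees`.
encodeDegrees : ∀ {c} → Vec ℕ c → Fin (2 ^ c + c)
encodeDegrees {c} d with twice? d
... | yes (j , _) = (2 ^ c) ↑ʳ j
... | no _        = funToFin (λ j → flag (1 ≤? Vec.lookup d j)) ↑ˡ c

encodeDegrees-injective : ∀ {c} {d d′ : Vec ℕ c} → PartialDegrees d → PartialDegrees d′ →
  encodeDegrees d ≡ encodeDegrees d′ → d ≡ d′
encodeDegrees-injective {c} {d} {d′} pd pd′ eq with twice? d | twice? d′
... | yes (j , 2≤d) | yes (k , 2≤d′) with refl ← Fin.↑ʳ-injective (2 ^ c) j k eq =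
  vec-ext λ i → same i (i ≟ j)
  where
  shape : ∀ d → PartialDegrees d → 2 ≤ Vec.lookup d j →
    Vec.lookup d j ≡ 2 × (∀ k → k ≢ j → Vec.lookup d k ≡ 0)
  shape d (inj₁ ≤1) 2≤ = contradiction (≤1 j) (ℕ.<⇒≱ 2≤)
  shape d (inj₂ (k , two , others)) 2≤ with j ≟ k
  ... | yes refl = two , others
  ... | no j≢k with () ← subst (2 ≤_) (others j j≢k) 2≤
  same : ∀ i → Dec (i ≡ j) → Vec.lookup d i ≡ Vec.lookup d′ i
  same i (yes refl) = trans (proj₁ (shape d pd 2≤d)) (sym (proj₁ (shape d′ pd′ 2≤d′)))
  same i (no i≢j)   = trans (proj₂ (shape d pd 2≤d) i i≢j) (sym (proj₂ (shape d′ pd′ 2≤d′) i i≢j))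
... | yes (j , _) | no _ with () ←
  trans (sym (Fin.splitAt-↑ʳ (2 ^ c) c j)) (trans (cong (splitAt (2 ^ c)) eq) (Fin.splitAt-↑ˡ (2 ^ c) _ c))
... | no _ | yes (k , _) with () ←
  trans (sym (Fin.splitAt-↑ʳ (2 ^ c) c k)) (trans (cong (splitAt (2 ^ c)) (sym eq)) (Fin.splitAt-↑ˡ (2 ^ c) _ c))
... | no ¬2≤ | no ¬2≤′ = vec-ext λ j → same j (funToFin-injective (Fin.↑ˡ-injective c _ _ eq) j)
  where
  small : ∀ {a b} → a < 2 → b < 2 → flag (1 ≤? a) ≡ flag (1 ≤? b) → a ≡ b
  small {zero}        {zero}        _ _ _ = refl
  small {suc zero}    {suc zero}    _ _ _ = refl
  small {zero}        {suc zero}    _ _ ()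
  small {suc zero}    {zero}        _ _ ()
  small {suc (suc _)} (s≤s (s≤s ()))
  small {zero}     {suc (suc _)} _ (s≤s (s≤s ()))
  small {suc zero} {suc (suc _)} _ (s≤s (s≤s ()))
  same : ∀ j → flag (1 ≤? Vec.lookup d j) ≡ flag (1 ≤? Vec.lookup d′ j) → Vec.lookup d j ≡ Vec.lookup d′ j
  same j = small (ℕ.≰⇒> (λ 2≤ → ¬2≤ (j , 2≤))) (ℕ.≰⇒> (λ 2≤ → ¬2≤′ (j , 2≤)))

module Signature (H : Graph) {c : ℕ} (col : E H → Fin c) (col-inj : Injective _≡_ _≡_ col) (G : Graph) (i : ℕ) where

  open Family H col G
  open Frontier G i
  open Exchange H col G i

  f : ℕ
  f = # front?

  frontVertex : Fin f → V G
  frontVertex = enum ⟦ front? ⟧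

  profileClass : Vec ℕ c → Subset (∣V∣ H)
  profileClass d = ⟦ (λ h → profileDegree h ≟ᵛ d) ⟧

  -- The finished vertices use up a submultiset of the profile; a vertex h of
  -- H is flagged if the copy of its degree that it stands for is used up.
  consumed? : ∀ x h → Dec (rank (profileClass (profileDegree h)) h < # (finished? x (profileDegree h)))
  consumed? x h = rank (profileClass (profileDegree h)) h <? # (finished? x (profileDegree h))

  linked? : ∀ x j k k′ → Dec (Star (EdgeRel G (Prefix x j)) (frontVertex k) (frontVertex k′))
  linked? x j k k′ = walk? {G} (prefix? x j) (frontVertex k) (frontVertex k′)

  component : Coloring → Fin c → Fin f → Fin f
  component x j k = least (linked? x j k) (k , ε)

  bound : ℕ
  bound = 2 ^ ∣V∣ H * ((2 ^ c + c) ^ f * (f ^ f) ^ c)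

  signature : Coloring → Fin bound
  signature x = combine (funToFin (λ h → flag (consumed? x h))) (combine
    (funToFin (λ k → encodeDegrees (prefixDegrees x (frontVertex k))))
    (funToFin (λ j → funToFin (component x j))))

  module _ {x y : Coloring} (agree : ∀ e → toℕ e < i → x e ≡ y e) where

    private
      prefix⇒ : ∀ j e → Prefix x j e → Prefix y j e
      prefix⇒ j e (e<i , xe) = e<i , trans (sym (agree e e<i)) xe

      prefix⇐ : ∀ j e → Prefix y j e → Prefix x j e
      prefix⇐ j e (e<i , ye) = e<i , trans (agree e e<i) ye

      finished-degrees : ∀ {v} → ¬ Late v → degrees x v ≡ degrees y v
      finished-degrees {v} ¬late = degrees-cong v λ e inc → agree e (not-late⇒< ¬late inc)

      finished-cong : ∀ d → # (finished? x d) ≡ # (finished? y d)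
      finished-cong d = #-cong (finished? x d) (finished? y d)
        (λ v ((nz , has) , ¬late) → let eq = finished-degrees ¬late in
          (subst NonzeroVec eq nz , trans (sym eq) has) , ¬late)
        (λ v ((nz , has) , ¬late) → let eq = finished-degrees ¬late in
          (subst NonzeroVec (sym eq) nz , trans eq has) , ¬late)

    signature-local : signature x ≡ signature y
    signature-local = cong₂ combine
      (funToFin-cong λ h → flag-cong (consumed? x h) (consumed? y h)
        (subst (_ <_) (finished-cong (profileDegree h))) (subst (_ <_) (sym (finished-cong (profileDegree h)))))
      (cong₂ combine
        (funToFin-cong λ k → cong encodeDegrees (Vec.tabulate-cong λ j →
          #-cong (λ e → prefix? x j e ×-dec incident? G (frontVertex k) e)
            (λ e → prefix? y j e ×-dec incident? G (frontVertex k) e)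
            (λ e (p , inc) → prefix⇒ j e p , inc) (λ e (p , inc) → prefix⇐ j e p , inc)))
        (funToFin-cong λ j → funToFin-cong λ k → least-cong (linked? x j k) (linked? y j k) _ _
          (λ _ → Walk-mono {G} (prefix⇒ j)) (λ _ → Walk-mono {G} (prefix⇐ j))))

  finished≤class : ∀ {x} → 𝓕 x → ∀ d → ¬ d ∈Δ → # (finished? x d) ≤ ∣ profileClass d ∣
  finished≤class {x} 𝓕x d ¬Δ = ℕ.≤-trans
    (#-mono (finished? x d) (hasDegrees? x d) (λ _ → proj₁))
    (ℕ.≤-reflexive (trans (sym (occ-degreeList x d)) (trans (𝓕.matching 𝓕x d ¬Δ) (occ-profile d))))

  -- Ranks number the copies of `d` in the profile from 0. If x had fewer finished vertices of
  -- degree `d`, the copy whose rank is the count for x would be flagged for y but not for x. It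
  -- exists because y, being in `𝓕`, uses no more copies than there are.
  not-fewer : ∀ {x y} → 𝓕 y → (∀ h → flag (consumed? x h) ≡ flag (consumed? y h)) →
    ∀ d → ¬ d ∈Δ → ¬ (# (finished? x d) < # (finished? y d))
  not-fewer {x} {y} 𝓕y flags d ¬Δ x<y
    with h , h∈ , rank≡ ← rank-surjective (profileClass d) (ℕ.<-≤-trans x<y (finished≤class 𝓕y d ¬Δ))
    with refl ← ∈⟦⟧⁻ (λ h → profileDegree h ≟ᵛ d) h∈ =
    ℕ.<-irrefl rank≡ (flag-true (consumed? y h) (consumed? x h) (sym (flags h))
      (subst (_< # (finished? y (profileDegree h))) (sym rank≡) x<y))

  -- Prefix degrees are bounded by final ones. A final degree outside Δ, if nonzero, occurs in the
  -- profile and has entries at most 1; one in Δ has a single entry 2, which the prefix has or has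
  -- not reached.
  partialDegrees : ∀ {x} → 𝓕 x → ∀ v → PartialDegrees (prefixDegrees x v)
  partialDegrees {x} 𝓕x v = from (∈Δ? (degrees x v))
    where
    prefix≤ : ∀ j → Vec.lookup (prefixDegrees x v) j ≤ Vec.lookup (degrees x v) j
    prefix≤ j = subst₂ _≤_ (sym (lookup∘tabulate (prefixDegree x v) j)) (sym (lookup-degrees x v j))
      (ℕ.≤-trans (ℕ.m≤m+n _ _) (ℕ.≤-reflexive (sym (degree-split x v j))))

    ≤1 : ¬ degrees x v ∈Δ → ∀ j → Vec.lookup (degrees x v) j ≤ 1
    ≤1 ¬Δ j with 1 ≤? Vec.lookup (degrees x v) j
    ... | no ≱1  = ℕ.<⇒≤ (ℕ.≰⇒> ≱1)
    ... | yes ≥1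
      with h , eq ← #≥1⁻ (λ h → profileDegree h ≟ᵛ degrees x v) (subst (1 ≤_)
             (trans (sym (occ-degreeList x (degrees x v)))
               (trans (𝓕.matching 𝓕x (degrees x v) ¬Δ) (occ-profile (degrees x v))))
             (#≥1 (hasDegrees? x (degrees x v)) ((j , ≥1) , refl))) =
      subst (λ d → Vec.lookup d j ≤ 1) eq (coloredDegree-≤1 H col col-inj h j)

    from : Dec (degrees x v ∈Δ) → PartialDegrees (prefixDegrees x v)
    from (no ¬Δ) = inj₁ λ j → ℕ.≤-trans (prefix≤ j) (≤1 ¬Δ j)
    from (yes d∈Δ) with j , two , others ← ∈Δ⇒lookup d∈Δ = split (Vec.lookup (prefixDegrees x v) j ℕ.≟ 2)
      where
      zeros : ∀ k → k ≢ j → Vec.lookup (prefixDegrees x v) k ≡ 0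
      zeros k k≢j = ℕ.n≤0⇒n≡0 (subst (Vec.lookup (prefixDegrees x v) k ≤_) (others k k≢j) (prefix≤ k))
      split : Dec (Vec.lookup (prefixDegrees x v) j ≡ 2) → PartialDegrees (prefixDegrees x v)
      split (yes ≡2) = inj₂ (j , ≡2 , zeros)
      split (no ≢2)  = inj₁ λ k → at k (k ≟ j)
        where
        at : ∀ k → Dec (k ≡ j) → Vec.lookup (prefixDegrees x v) k ≤ 1
        at k (yes refl) = ℕ.m<1+n⇒m≤n (ℕ.≤∧≢⇒< (subst (Vec.lookup (prefixDegrees x v) k ≤_) two (prefix≤ k)) ≢2)
        at k (no k≢j)   = ℕ.≤-trans (ℕ.≤-reflexive (zeros k k≢j)) z≤n

  same-signature : ∀ {x y} → 𝓕 x → 𝓕 y → signature x ≡ signature y → SameSignature x y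
  same-signature {x} {y} 𝓕x 𝓕y eq = record
    { front-degrees = front-degrees
    ; finished      = finished
    ; front-linked  = front-linked
    }
    where
    eqs = Fin.combine-injective (funToFin (λ h → flag (consumed? x h))) _ (funToFin (λ h → flag (consumed? y h))) _ eq
    eqs₂ = Fin.combine-injective (funToFin (λ k → encodeDegrees (prefixDegrees x (frontVertex k)))) _
      (funToFin (λ k → encodeDegrees (prefixDegrees y (frontVertex k)))) _ (proj₂ eqs)

    flags : ∀ h → flag (consumed? x h) ≡ flag (consumed? y h)
    flags = funToFin-injective (proj₁ eqs)

    finished : ∀ d → ¬ d ∈Δ → # (finished? x d) ≡ # (finished? y d)
    finished d ¬Δ with ℕ.<-cmp (# (finished? x d)) (# (finished? y d))
    ... | tri< x<y _ _ = contradiction x<y (not-fewer {x} {y} 𝓕y flags d ¬Δ)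
    ... | tri≈ _ x≡y _ = x≡y
    ... | tri> _ _ y<x = contradiction y<x (not-fewer {y} {x} 𝓕x (λ h → sym (flags h)) d ¬Δ)

    front-degrees : ∀ v → Front v → prefixDegrees x v ≡ prefixDegrees y v
    front-degrees v front with k , refl ← enum-surjective ⟦ front? ⟧ (∈⟦⟧⁺ front? front) =
      encodeDegrees-injective (partialDegrees 𝓕x _) (partialDegrees 𝓕y _) (funToFin-injective (proj₁ eqs₂) k)

    components : ∀ j k → component x j k ≡ component y j k
    components j = funToFin-injective (funToFin-injective (proj₂ eqs₂) j)

    flip-walk : ∀ {x j u v} → Star (EdgeRel G (Prefix x j)) u v → Star (EdgeRel G (Prefix x j)) v u
    flip-walk = reverse (EdgeRel-sym {G})

    -- Vertices linked in y have the same least representative. It is also their representative in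
    -- x, where both are linked to it.
    front-linked : ∀ j u v → Front u → Front v →
      Star (EdgeRel G (Prefix y j)) u v → Star (EdgeRel G (Prefix x j)) u v
    front-linked j u v front-u front-v w
      with k , refl ← enum-surjective ⟦ front? ⟧ (∈⟦⟧⁺ front? front-u)
         | k′ , refl ← enum-surjective ⟦ front? ⟧ (∈⟦⟧⁺ front? front-v) =
      subst (λ l → Star (EdgeRel G (Prefix x j)) (frontVertex k) (frontVertex l)) same
        (least-holds (linked? x j k) (k , ε)) ◅◅
      flip-walk {x} (least-holds (linked? x j k′) (k′ , ε))
      where
      same : component x j k ≡ component x j k′
      same = trans (components j k) (trans
        (least-cong (linked? y j k) (linked? y j k′) _ _
          (λ _ p → flip-walk {y} w ◅◅ p) (λ _ p → w ◅◅ p))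
        (sym (components j k′)))

  front≤max : f ≤ maxFrontierSize G
  front≤max with i <? ∣E∣ G
  ... | yes i<m = ℕ.≤-trans
    (#-mono front? (isFrontier? G l) λ v ((e , e<i , inc) , (e′ , i≤e′ , inc′)) →
      (e , subst (toℕ e <_) (sym l≡i) e<i , inc) , (e′ , subst (_≤ toℕ e′) (sym l≡i) i≤e′ , inc′))
    (All.tabulate⁻ (xs≤max 0 (tabulate (λ l → ∣ frontier G l ∣))) l)
    where
    l = fromℕ< i<m
    l≡i : toℕ l ≡ i
    l≡i = toℕ-fromℕ< i<m
  ... | no i≮m = ℕ.≤-trans (ℕ.≤-reflexive (#≡0 front? λ v (_ , e , i≤e , _) →
    i≮m (ℕ.≤-<-trans i≤e (toℕ<n e)))) z≤n

-- The diagram for a host graph and the theorem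

module _ (H : Graph) (col : E H → Fin (∣E∣ H)) (col-inj : Injective _≡_ _≡_ col) (G : Graph) where

  private
    c = ∣E∣ H
    w = maxFrontierSize G

    M = DS (colorize H col)
    module S = Signature H col col-inj G

  open Family H col G

  -- An end of the edge with color `j` serves: it sees that color, and its entries are at most 1,
  -- which keeps it out of Δ.
  branch-vertex : ∀ j → ∃[ h ] (1 ≤ Vec.lookup (profileDegree h) j × ¬ profileDegree h ∈Δ)
  branch-vertex j with e , refl ← injective⇒surjective col-inj j =
    h , subst (1 ≤_) (sym (lookup-coloredDegree (colorize H col) h (col e)))
      (∣∣≥1 _ (∈-incident⁺ (colorize H col) {v = h} (∈D-colorize⁺ H col refl) (inj₁ refl))) ,
    ∈Δ-≰1 (coloredDegree-≤1 H col col-inj h)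
    where h = proj₁ (ends H e)

  bound≤ : ∀ i → S.bound i ≤ 2 ^ ∣V∣ H * ((2 ^ c + c) ^ w * (w ^ w) ^ c)
  bound≤ i = signature-mono (∣V∣ H) c (S.front≤max i)

  bounded-diagram : Σ[ Z ∈ DD c (∣E∣ G) ] (Represents Z (λ X → edgeInduced G X ⊨𝒞* M) ×
    width Z ≤ 2 ^ (2 * (c * (w * ⌊log₂ w ⌋)) + ∣V∣ H) * (2 ^ c + c) ^ w)
  bounded-diagram =
    let Z , rep , width≤ = Diagram.diagram c (∣E∣ G) _ 𝓕 𝓕? 𝓕-ext
          (λ i x → inject≤ (S.signature i x) (bound≤ i))
          (λ i agree → cong (λ s → inject≤ s (bound≤ i)) (S.signature-local i agree))
          (λ i 𝓕x 𝓕y eq → Exchange.exchange H col G i 𝓕x 𝓕y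
            (S.same-signature i 𝓕x 𝓕y (Fin.inject≤-injective (bound≤ i) (bound≤ i) _ _ eq)) branch-vertex)
          (λ X → edgeInduced G X ⊨𝒞* M)
          (⊨⇔𝓕 (profile-∌Δ H col col-inj))
    in Z , rep , ℕ.≤-trans width≤ (signature-bound (∣V∣ H) c w)

theorem3 :
  Σ[ C ∈ ℕ ]
  ((H : Graph) → 2 ≤ ∣V∣ H →
   (col : E H → Fin (∣E∣ H)) → Injective _≡_ _≡_ col →
   let c = ∣E∣ H
       M = DS (colorize H col)
   in
   IsExtendedProfile M (𝒮 H) ×
   (Σ[ Z ∈ ((G : Graph) → DD c (∣E∣ G)) ]
    ((G : Graph) →
     let w = maxFrontierSize G in
     Represents (Z G) (λ X → edgeInduced G X ⊨𝒞* M) ×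
     width (Z G) ≤ 2 ^ (C * (c * (w * ⌊log₂ w ⌋)) + ∣V∣ H) * (2 ^ c + c) ^ w)))
theorem3 = 2 , λ H _ col col-inj →
  -- An injection of a finite set into itself is onto, so every color appears in `H`. A cycle in an
  -- absent color could otherwise satisfy the condition without belonging to any subdivision.
  isExtendedProfile H col col-inj (injective⇒surjective col-inj) ,
  (λ G → proj₁ (bounded-diagram H col col-inj G)) ,
  λ G → proj₂ (bounded-diagram H col col-inj G)
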